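{- Let $\mathcal{V}=\{a^n:\ a,n\in\mathbb{N},\ a\ge 1,\ n\ge 2\}$ denote the set of pure powers. Let $F_3(N)$ denote the largest $d$ such that there exist distinct positive integers $a_1,\dots,a_d$ for which every non-empty subset sum $\sum_{i\in I}a_i$ ($\emptyset\ne I\subseteq\{1,\dots,d\}$) lies in $\mathcal{V}\cap[1,N]$. Then $F_3(N)\ll(\log\log N)^2$.
   Context: $X\ll Y$ means $X\le CY$ for an absolute constant $C$ (for all sufficiently large $N$). -}

module Defs where

open import Data.Nat using (ℕ; zero; suc; _+_; _*_; _^_; _≤_)
open import Data.Nat.Logarithm using (⌊log₂_⌋)
open import Data.Bool using (Bool; true; false)
open import Data.Fin using (Fin; zero; suc)
open import Data.Fin.Subset using (Subset; _∈_; Nonempty)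
open import Data.Vec using (Vec; []; _∷_)
open import Data.Product using (Σ; ∃; _×_)
open import Relation.Binary.PropositionalEquality using (_≡_)
open import Function.Definitions using (Injective)

PurePower : ℕ → Set
PurePower x = Σ ℕ λ a → Σ ℕ λ n → (1 ≤ a) × (2 ≤ n) × (x ≡ a ^ n)

subsetSum : ∀ {d} → (Fin d → ℕ) → Subset d → ℕ
subsetSum {zero}  a []          = 0
subsetSum {suc d} a (true  ∷ p) = a zero + subsetSum (λ i → a (suc i)) p
subsetSum {suc d} a (false ∷ p) = subsetSum (λ i → a (suc i)) p

Admissible : ℕ → (d : ℕ) → (Fin d → ℕ) → Set
Admissible N d a =
  Injective _≡_ _≡_ a × (∀ i → 1 ≤ a i) ×
  (∀ (I : Subset d) → Nonempty I →
     PurePower (subsetSum a I) × 1 ≤ subsetSum a I × subsetSum a I ≤ N)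

loglog : ℕ → ℕ
loglog N = ⌊log₂ ⌊log₂ N ⌋ ⌋

-- Write K = 2^(loglog N + 1), so that N < 2^K. Label the elements of a block by ℤ/L, L = 2^m, and consider, for
-- each of the m bits, the sum of the elements whose label has that bit. If a block of about m L log K elements
-- has at most K^O(1) distinct subset sums, a rank bound for a tensor power of the matrix 1 - (cyclic shift)
-- yields two labellings with the same bit sums whose difference is 0 or 1 at every element. The carries of this
-- addition cut the moved elements into parts of sums x, x, 2x, 4x, …, so that x, 2x, …, Lx are all subset
-- sums. But j x and j' x cannot both be g-th powers for distinct odd squarefree j, j' and g ≥ 2: the
-- exponents of the powers j x are pairwise coprime divisors of the 2-adic valuation of x, which is less than K,
-- and this bounds m L by O(loglog N).
--
-- Otherwise each of two disjoint blocks has more distinct subset sums than a large fixed power of K, and all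
-- sums h + y of one from each are powers. After removing a power of 2 they may be taken odd, and a double count gives h₁, …, h_r and many y for
-- which all h_i + y are q-th powers with one q (2 or odd), K³ ≤ q^r ≤ K⁴. Around one such y₀ the roots
-- ψ_i = (h_i + y)^(1/q) are power series over ℤ in a parameter z, where y = y₀ + Q z. A Bombieri–Pila argument at
-- the prime 2 gives a relation ∑ c_e ∏ ψ_i^(e_i) = 0, 0 ≤ e_i < q, that holds at all these y; eliminating, a
-- nonzero multiple of ∑ c_e ∏ ψ_i^(e_i) is a polynomial in y with too many zeros. This contradicts the linear
-- independence of the products ∏ ψ_i^(e_i) over ℤ[y], which follows by differentiation from the ramification of
-- ψ_k at y = - h_k.
module Submission where

-- All losses in the second case must be polynomial in K, which shapes the argument. Fixing one of
-- up to K exponents row by row would cost K^r, with r as large as 3 log K. So a popular exponent q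
-- is chosen with weight 1/(q(q-1)), and r rows cost only q^(3r) ≤ K^12. The elimination uses K^5
-- points and the choice of a common q costs K²: this is 19 = 12 + 5 + 2 in the threshold 16 K^19,
-- and 16 covers residue classes. The bound K³ ≤ q^r has another source: an auxiliary combination
-- with coefficients 0, ±1 is found by pigeonhole once N² < q^r, where N is about K r, the bit size
-- of a monomial in the roots.
--
-- The prime 2 replaces the archimedean absolute value because the y have up to K bits and lie in no
-- short interval, whereas one class modulo 16 is a disc on which all the roots converge and which
-- keeps a sixteenth of the points. Even exponents are reduced to squares since the disc would
-- shrink with the power of 2 in q. The roots must be units there, so one odd element is kept
-- outside both blocks to correct the parity of h + y.

-- Formal power series over ℤ

module Series where

  open import Algebra.Bundles using (CommutativeRing)
  open import Algebra.Solver.Ring.AlmostCommutativeRing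
    using (AlmostCommutativeRing; fromCommutativeRing; _-Raw-AlmostCommutative⟶_)
  import Algebra.Solver.Ring
  open import Data.Integer using (ℤ; +_; 0ℤ; 1ℤ; _+_; _*_; -_; _≟_)
  import Data.Integer.Properties as ℤ
  open import Data.Integer.Tactic.RingSolver using (solve-∀)
  open import Data.Maybe using (Maybe; just; nothing)
  open import Data.Nat using (ℕ; zero; suc)
  open import Data.Product using (_,_)
  open import Data.Sum using (inj₁; inj₂)
  open import Level using (0ℓ)
  open import Relation.Binary.PropositionalEquality
  open import Relation.Nullary using (yes; no; contradiction)

  conv : (ℕ → ℤ) → (ℕ → ℤ) → ℕ → ℤ
  conv f g zero    = f 0 * g 0
  conv f g (suc n) = f 0 * g (suc n) + conv (λ k → f (suc k)) g n

  conv-cong : ∀ {f f′ g g′} → (∀ n → f n ≡ f′ n) → (∀ n → g n ≡ g′ n) → ∀ n → conv f g n ≡ conv f′ g′ n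
  conv-cong p q zero    = cong₂ _*_ (p 0) (q 0)
  conv-cong p q (suc n) = cong₂ _+_ (cong₂ _*_ (p 0) (q (suc n))) (conv-cong (λ k → p (suc k)) q n)

  private
    ring₀ : ∀ a b → 0ℤ * (a * b) ≡ 0ℤ * a * b + a * (0ℤ * b)
    ring₀ = solve-∀
    ring₁ : ∀ a b c d → a * b + c * d ≡ c * d + a * b
    ring₁ = solve-∀
    ring₂ : ∀ a b c → a + (b + c) ≡ b + (a + c)
    ring₂ = solve-∀
    ring₃ : ∀ a b c d e → (a + b) * c + (d + e) ≡ a * c + d + (b * c + e)
    ring₃ = solve-∀
    ring₄ : ∀ a b c d → a * b * c + a * d ≡ a * (b * c + d)
    ring₄ = solve-∀
    ring₅ : ∀ a b c d e → a * b * c + (a * d + e) ≡ a * (b * c + d) + e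
    ring₅ = solve-∀
    ring₆ : ∀ n a b c → (1ℤ + n) * (a * b + c) ≡ a * ((1ℤ + n) * b) + (n * c + c)
    ring₆ = solve-∀
    ring₇ : ∀ x a b c d → x + (a + b + c) ≡ (0ℤ * d + (a + c)) + (x + b)
    ring₇ = solve-∀
    zero-term : ∀ a b c → a * (0ℤ * b) + c ≡ c
    zero-term = solve-∀
    zero-term′ : ∀ a c → a * 0ℤ + c ≡ c
    zero-term′ = solve-∀
    ring₈ : ∀ n a → (1ℤ + n) * a ≡ n * a + a
    ring₈ = solve-∀

  conv-sucʳ : ∀ f g n → conv f g (suc n) ≡ f (suc n) * g 0 + conv f (λ k → g (suc k)) n
  conv-sucʳ f g zero    = ring₁ (f 0) (g 1) (f 1) (g 0)
  conv-sucʳ f g (suc n) = trans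
    (cong (λ x → f 0 * g (suc (suc n)) + x) (conv-sucʳ (λ k → f (suc k)) g n))
    (ring₂ (f 0 * g (suc (suc n))) (f (suc (suc n)) * g 0) _)

  conv-comm : ∀ f g n → conv f g n ≡ conv g f n
  conv-comm f g zero    = ℤ.*-comm (f 0) (g 0)
  conv-comm f g (suc n) = trans
    (cong₂ _+_ (ℤ.*-comm (f 0) (g (suc n))) (conv-comm (λ k → f (suc k)) g n))
    (sym (conv-sucʳ g f n))

  conv-distribʳ : ∀ f f′ g n → conv (λ k → f k + f′ k) g n ≡ conv f g n + conv f′ g n
  conv-distribʳ f f′ g zero    = ℤ.*-distribʳ-+ (g 0) (f 0) (f′ 0)
  conv-distribʳ f f′ g (suc n) = trans
    (cong (λ x → (f 0 + f′ 0) * g (suc n) + x) (conv-distribʳ (λ k → f (suc k)) (λ k → f′ (suc k)) g n))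
    (ring₃ (f 0) (f′ 0) (g (suc n)) _ _)

  conv-scale : ∀ c f g n → conv (λ k → c * f k) g n ≡ c * conv f g n
  conv-scale c f g zero    = ℤ.*-assoc c (f 0) (g 0)
  conv-scale c f g (suc n) = trans
    (cong (λ x → c * f 0 * g (suc n) + x) (conv-scale c (λ k → f (suc k)) g n))
    (ring₄ c (f 0) (g (suc n)) _)

  conv-zero : ∀ g n → conv (λ _ → 0ℤ) g n ≡ 0ℤ
  conv-zero g zero    = refl
  conv-zero g (suc n) = trans (ℤ.+-identityˡ _) (conv-zero g n)

  conv-assoc : ∀ f g h n → conv (conv f g) h n ≡ conv f (conv g h) n
  conv-assoc f g h zero    = ℤ.*-assoc (f 0) (g 0) (h 0)
  conv-assoc f g h (suc n) = trans
    (cong (λ x → f 0 * g 0 * h (suc n) + x) (trans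
      (conv-distribʳ (λ k → f 0 * g (suc k)) (conv (λ k → f (suc k)) g) h n)
      (cong₂ _+_ (conv-scale (f 0) (λ k → g (suc k)) h n) (conv-assoc (λ k → f (suc k)) g h n))))
    (ring₅ (f 0) (g 0) (h (suc n)) _ _)

  -- The index is additive along a convolution, so the Euler operator z d/dz, which multiplies
  -- coefficient n by n, is a derivation. Unlike `∂` it does not shift indices, which suits the
  -- recursion of `conv`; `∂-⊗` is read off at `suc n`.
  conv-θ : ∀ f g n → + n * conv f g n ≡ conv (λ k → + k * f k) g n + conv f (λ k → + k * g k) n
  conv-θ f g zero    = ring₀ (f 0) (g 0)
  conv-θ f g (suc n) = trans (ring₆ (+ n) (f 0) (g (suc n)) _) (trans
    (cong (λ x → f 0 * ((1ℤ + + n) * g (suc n)) + (x + conv tf g n)) (conv-θ tf g n)) (trans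
    (ring₇ (f 0 * ((1ℤ + + n) * g (suc n))) (conv (λ k → + k * tf k) g n) (conv tf (λ k → + k * g k) n) (conv tf g n) (g (suc n)))
    (cong (λ x → (0ℤ * g (suc n) + x) + (f 0 * ((1ℤ + + n) * g (suc n)) + conv tf (λ k → + k * g k) n)) (trans
      (sym (conv-distribʳ (λ k → + k * tf k) tf g n))
      (conv-cong (λ k → sym (ring₈ (+ k) (tf k))) (λ _ → refl) n)))))
    where
    tf : ℕ → ℤ
    tf k = f (suc k)

  -- The series form a record without η so that the operations below do not unfold.
  record Series : Set where
    no-eta-equality
    field coef : ℕ → ℤ
  open Series public

  infix 4 _≈_
  record _≈_ (f g : Series) : Set where
    constructor mk≈
    field at : ∀ n → coef f n ≡ coef g n
  open _≈_ public

  infixl 6 _⊕_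
  infixl 7 _⊗_
  infix  8 ⊖_

  _⊕_ _⊗_ : Series → Series → Series
  coef (f ⊕ g) n = coef f n + coef g n
  coef (f ⊗ g)   = conv (coef f) (coef g)

  ⊖_ ∂ tail : Series → Series
  coef (⊖ f) n    = - coef f n
  coef (∂ f) n    = + suc n * coef f (suc n)
  coef (tail f) n = coef f (suc n)

  con : ℤ → Series
  coef (con c) zero    = c
  coef (con c) (suc n) = 0ℤ

  z : Series
  coef z zero          = 0ℤ
  coef z (suc zero)    = 1ℤ
  coef z (suc (suc n)) = 0ℤ

  con⊗ : ∀ c f n → coef (con c ⊗ f) n ≡ c * coef f n
  con⊗ c f zero    = refl
  con⊗ c f (suc n) = trans (cong (λ x → c * coef f (suc n) + x)
    (trans (conv-cong (λ _ → refl) (λ _ → refl) n) (conv-zero (coef f) n))) (ℤ.+-identityʳ _)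

  z⊗-suc : ∀ f n → coef (z ⊗ f) (suc n) ≡ coef f n
  z⊗-suc f n = trans (ℤ.+-identityˡ _) (trans
    (conv-cong {f′ = coef (con 1ℤ)} (λ { zero → refl ; (suc k) → refl }) (λ _ → refl) n)
    (trans (con⊗ 1ℤ f n) (ℤ.*-identityˡ _)))

  ≈refl : ∀ {f} → f ≈ f
  at ≈refl n = refl

  ≈sym : ∀ {f g} → f ≈ g → g ≈ f
  at (≈sym p) n = sym (at p n)

  ≈trans : ∀ {f g h} → f ≈ g → g ≈ h → f ≈ h
  at (≈trans p q) n = trans (at p n) (at q n)

  ⊗-comm : ∀ f g → f ⊗ g ≈ g ⊗ f
  at (⊗-comm f g) = conv-comm (coef f) (coef g)

  ⊗-cong : ∀ {f f′ g g′} → f ≈ f′ → g ≈ g′ → f ⊗ g ≈ f′ ⊗ g′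
  at (⊗-cong p q) = conv-cong (at p) (at q)

  ⊕-cong : ∀ {f f′ g g′} → f ≈ f′ → g ≈ g′ → f ⊕ g ≈ f′ ⊕ g′
  at (⊕-cong p q) n = cong₂ _+_ (at p n) (at q n)

  ring : CommutativeRing 0ℓ 0ℓ
  ring = record
    { Carrier = Series ; _≈_ = _≈_ ; _+_ = _⊕_ ; _*_ = _⊗_ ; -_ = ⊖_ ; 0# = con 0ℤ ; 1# = con 1ℤ
    ; isCommutativeRing = record
      { isRing = record
        { +-isAbelianGroup = record
          { isGroup = record
            { isMonoid = record
              { isSemigroup = record
                { isMagma = record
                  { isEquivalence = record { refl = ≈refl ; sym = ≈sym ; trans = ≈trans }
                  ; ∙-cong = ⊕-cong }
                ; assoc = λ f g h → mk≈ λ n → ℤ.+-assoc (coef f n) (coef g n) (coef h n) }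
              ; identity = (λ f → mk≈ (0ˡ f)) , (λ f → mk≈ λ n → trans (ℤ.+-comm (coef f n) _) (0ˡ f n)) }
            ; inverse = (λ f → mk≈ λ n → trans (ℤ.+-inverseˡ (coef f n)) (sym (0n n)))
                      , (λ f → mk≈ λ n → trans (ℤ.+-inverseʳ (coef f n)) (sym (0n n)))
            ; ⁻¹-cong = λ p → mk≈ λ n → cong -_ (at p n) }
          ; comm = λ f g → mk≈ λ n → ℤ.+-comm (coef f n) (coef g n) }
        ; *-cong = ⊗-cong
        ; *-assoc = λ f g h → mk≈ (conv-assoc (coef f) (coef g) (coef h))
        ; *-identity = 1ˡ , λ f → ≈trans (⊗-comm f _) (1ˡ f)
        ; distrib = (λ f g h → ≈trans (⊗-comm f _) (≈trans (dʳ f g h) (⊕-cong (⊗-comm g f) (⊗-comm h f)))) , dʳ }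
      ; *-comm = ⊗-comm } }
    where
    0n : ∀ n → coef (con 0ℤ) n ≡ 0ℤ
    0n zero    = refl
    0n (suc n) = refl
    0ˡ : ∀ f n → coef (con 0ℤ ⊕ f) n ≡ coef f n
    0ˡ f n = trans (cong (λ x → x + coef f n) (0n n)) (ℤ.+-identityˡ _)
    1ˡ : ∀ f → con 1ℤ ⊗ f ≈ f
    at (1ˡ f) n = trans (con⊗ 1ℤ f n) (ℤ.*-identityˡ _)
    dʳ : ∀ f g h → (g ⊕ h) ⊗ f ≈ g ⊗ f ⊕ h ⊗ f
    at (dʳ f g h) = conv-distribʳ (coef g) (coef h) (coef f)

  ≡⇒≈ : ∀ {f g} → f ≡ g → f ≈ g
  ≡⇒≈ refl = ≈refl

  ⊖-cong : ∀ {f g} → f ≈ g → ⊖ f ≈ ⊖ g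
  at (⊖-cong p) n = cong -_ (at p n)

  acr : AlmostCommutativeRing 0ℓ 0ℓ
  acr = fromCommutativeRing ring

  con-⊕ : ∀ a b → con (a + b) ≈ con a ⊕ con b
  at (con-⊕ a b) zero    = refl
  at (con-⊕ a b) (suc n) = refl

  con-⊗ : ∀ a b → con (a * b) ≈ con a ⊗ con b
  at (con-⊗ a b) n = sym (trans (con⊗ a (con b) n) (lem n))
    where
    lem : ∀ n → a * coef (con b) n ≡ coef (con (a * b)) n
    lem zero    = refl
    lem (suc n) = ℤ.*-zeroʳ a

  con-⊖ : ∀ a → con (- a) ≈ ⊖ con a
  at (con-⊖ a) zero    = refl
  at (con-⊖ a) (suc n) = refl

  con-0 : ∀ n → coef (con 0ℤ) n ≡ 0ℤ
  con-0 zero    = refl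
  con-0 (suc n) = refl

  private
    morphism : AlmostCommutativeRing.rawRing (fromCommutativeRing ℤ.+-*-commutativeRing) -Raw-AlmostCommutative⟶ acr
    morphism = record { ⟦_⟧ = con ; +-homo = con-⊕ ; *-homo = con-⊗ ; -‿homo = con-⊖ ; 0-homo = ≈refl ; 1-homo = ≈refl }

    dec : ∀ a b → Maybe (con a ≈ con b)
    dec a b with a ≟ b
    ... | yes refl = just ≈refl
    ... | no _     = nothing

  module Solver = Algebra.Solver.Ring
    (AlmostCommutativeRing.rawRing (fromCommutativeRing ℤ.+-*-commutativeRing)) acr morphism dec

  ∂-⊕ : ∀ f g → ∂ (f ⊕ g) ≈ ∂ f ⊕ ∂ g
  at (∂-⊕ f g) n = ℤ.*-distribˡ-+ (+ suc n) (coef f (suc n)) _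

  ∂-⊗ : ∀ f g → ∂ (f ⊗ g) ≈ ∂ f ⊗ g ⊕ f ⊗ ∂ g
  at (∂-⊗ f g) n = trans (conv-θ (coef f) (coef g) (suc n)) (cong₂ _+_
    (ℤ.+-identityˡ (conv (coef (∂ f)) (coef g) n))
    (trans (conv-sucʳ (coef f) (λ k → + k * coef g k) n) (zero-term (coef f (suc n)) (coef g 0) (conv (coef f) (coef (∂ g)) n))))

  ∂-con : ∀ c → ∂ (con c) ≈ con 0ℤ
  at (∂-con c) n = trans (ℤ.*-zeroʳ (+ suc n)) (sym (con-0 n))

  ∂-z : ∂ z ≈ con 1ℤ
  at ∂-z zero    = refl
  at ∂-z (suc n) = ℤ.*-zeroʳ (+ suc (suc n))

  ∂-cong : ∀ {f g} → f ≈ g → ∂ f ≈ ∂ g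
  at (∂-cong p) n = cong (λ x → + suc n * x) (at p (suc n))

  ≈0⇒ : ∀ {f} → f ≈ con 0ℤ → ∀ n → coef f n ≡ 0ℤ
  ≈0⇒ p n = trans (at p n) (con-0 n)

  ⇒≈0 : ∀ {f} → (∀ n → coef f n ≡ 0ℤ) → f ≈ con 0ℤ
  at (⇒≈0 p) n = trans (p n) (sym (con-0 n))

  z⊗tail : ∀ f → coef f 0 ≡ 0ℤ → f ≈ z ⊗ tail f
  at (z⊗tail f p) zero    = p
  at (z⊗tail f p) (suc n) = sym (z⊗-suc (tail f) n)

  z-cancel : ∀ {f g} → z ⊗ f ≈ z ⊗ g → f ≈ g
  at (z-cancel {f} {g} p) n = trans (sym (z⊗-suc f n)) (trans (at p (suc n)) (z⊗-suc g n))

  -- Zero leading coefficients of f are stripped by `tail` until its constant term is nonzero; then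
  -- the coefficients of g vanish one after another. Giving a nonzero coefficient of f by its index
  -- makes the stripping structural.
  no-zero-divisors : ∀ a f g → f ⊗ g ≈ con 0ℤ → coef f a ≢ 0ℤ → ∀ n → coef g n ≡ 0ℤ
  no-zero-divisors zero f g p f≢0 = go g p
    where
    go : ∀ g → f ⊗ g ≈ con 0ℤ → ∀ n → coef g n ≡ 0ℤ
    g₀ : ∀ g → f ⊗ g ≈ con 0ℤ → coef g 0 ≡ 0ℤ
    g₀ g p with ℤ.i*j≡0⇒i≡0∨j≡0 (coef f 0) (at p 0)
    ... | inj₁ q = contradiction q f≢0
    ... | inj₂ q = q
    go g p zero    = g₀ g p
    go g p (suc n) = go (tail g) (⇒≈0 λ k → trans (sym (trans
      (trans (conv-sucʳ (coef f) (coef g) k) (cong (λ x → coef f (suc k) * x + coef (f ⊗ tail g) k) (g₀ g p)))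
      (zero-term′ (coef f (suc k)) (coef (f ⊗ tail g) k)))) (≈0⇒ p (suc k))) n
  no-zero-divisors (suc a) f g p f≢0 with coef f 0 ≟ 0ℤ
  ... | no f₀≢0 = no-zero-divisors zero f g p f₀≢0
  ... | yes f₀≡0 = no-zero-divisors a (tail f) g (⇒≈0 λ n → trans (sym (trans
          (cong (λ x → x * coef g (suc n) + coef (tail f ⊗ g) n) f₀≡0) (ℤ.+-identityˡ (coef (tail f ⊗ g) n)))) (≈0⇒ p (suc n))) f≢0

  open Solver public using (_:=_; _:+_; _:*_; :-_) renaming (solve to solveₛ; con to :c)

-- Integral q-th roots of power series

module Root where

  open Series
  open import Algebra.Bundles using (CommutativeRing)
  open import Algebra.Properties.Semiring.Exp (CommutativeRing.semiring ring) public using (_^_)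
  open import Data.Integer using (ℤ; +_; 0ℤ; 1ℤ; -_; _+_; _*_)
  import Data.Integer.Properties as ℤ
  open import Data.Nat using (ℕ; zero; suc; _≤_; _<_; z≤n; s≤s)
  import Data.Nat.Properties as ℕ
  open import Data.Product using (∃; _×_; _,_)
  open import Data.Sum using (inj₁; inj₂)
  open import Relation.Binary.PropositionalEquality

  -- Congruence modulo z^n: the metric in which a map with an outer factor z is a contraction.
  record Agree (n : ℕ) (f g : Series) : Set where
    constructor agree
    field below : ∀ k → k < n → coef f k ≡ coef g k
  open Agree

  agree-refl : ∀ {n f} → Agree n f f
  below agree-refl k _ = refl

  agree-⊕ : ∀ {n f f′ g g′} → Agree n f f′ → Agree n g g′ → Agree n (f ⊕ g) (f′ ⊕ g′)
  below (agree-⊕ p q) k k<n = cong₂ _+_ (below p k k<n) (below q k k<n)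

  agree-⊖ : ∀ {n f g} → Agree n f g → Agree n (⊖ f) (⊖ g)
  below (agree-⊖ p) k k<n = cong -_ (below p k k<n)

  agree-⊗ : ∀ {n f f′ g g′} → Agree n f f′ → Agree n g g′ → Agree n (f ⊗ g) (f′ ⊗ g′)
  below (agree-⊗ p q) k k<n = go k (λ j j≤k → below p j (ℕ.≤-<-trans j≤k k<n)) (λ j j≤k → below q j (ℕ.≤-<-trans j≤k k<n))
    where
    go : ∀ {f f′ g g′ : ℕ → ℤ} k → (∀ j → j ≤ k → f j ≡ f′ j) → (∀ j → j ≤ k → g j ≡ g′ j) → conv f g k ≡ conv f′ g′ k
    go zero    p q = cong₂ _*_ (p 0 z≤n) (q 0 z≤n)
    go (suc k) p q = cong₂ _+_ (cong₂ _*_ (p 0 z≤n) (q (suc k) ℕ.≤-refl))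
      (go k (λ j j≤k → p (suc j) (s≤s j≤k)) (λ j j≤k → q j (ℕ.m≤n⇒m≤1+n j≤k)))

  agree-z : ∀ {n f g} → Agree n f g → Agree (suc n) (z ⊗ f) (z ⊗ g)
  below (agree-z p) zero    _         = refl
  below (agree-z {f = f} {g} p) (suc k) (s≤s k<n) = trans (z⊗-suc f k) (trans (below p k k<n) (sym (z⊗-suc g k)))

  module FixedPoint (Φ : Series → Series) (contracts : ∀ {n f g} → Agree n f g → Agree (suc n) (Φ f) (Φ g)) where

    iterate : ℕ → Series
    iterate zero    = con 0ℤ
    iterate (suc n) = Φ (iterate n)

    -- The z-adic limit of the iterates: coefficient k is final from iterate k + 1 on.
    fixed : Series
    coef fixed k = coef (iterate (suc k)) k

    private
      stable : ∀ n → Agree n (iterate n) (iterate (suc n))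
      below (stable zero) k ()
      stable (suc n) = contracts (stable n)

      stable+ : ∀ n k → k < n → coef (iterate n) k ≡ coef (iterate (suc k)) k
      stable+ (suc n) k (s≤s k≤n) with ℕ.m≤n⇒m<n∨m≡n k≤n
      ... | inj₁ k<n = trans (sym (below (stable n) k k<n)) (stable+ n k k<n)
      ... | inj₂ refl = refl

    fixed-≈ : fixed ≈ Φ fixed
    at fixed-≈ k = below (contracts (agree (stable+ k))) k ℕ.≤-refl

  -- (1 + q z V)^m = 1 + m q z V + (q z V)² G, so that (1 + q z V)^q = 1 + q² a z reduces to V = a - z V² G.
  private
    tail-of-power : ℤ → ℕ → Series → Series
    tail-of-power q zero    V = con 0ℤ
    tail-of-power q (suc m) V = con (+ m) ⊕ tail-of-power q m V ⊕ con q ⊗ (z ⊗ V ⊗ tail-of-power q m V)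

    power-expansion : ∀ q m V → (con 1ℤ ⊕ con q ⊗ (z ⊗ V)) ^ m
      ≈ con 1ℤ ⊕ con (+ m) ⊗ con q ⊗ (z ⊗ V) ⊕ con q ⊗ con q ⊗ (z ⊗ (z ⊗ V ⊗ V ⊗ tail-of-power q m V))
    power-expansion q zero V = solveₛ 3 (λ q z V → :c 1ℤ :=
        :c 1ℤ :+ :c 0ℤ :* q :* (z :* V) :+ q :* q :* (z :* (z :* V :* V :* :c 0ℤ))) ≈refl (con q) z V
    power-expansion q (suc m) V = ≈trans (⊗-cong ≈refl (power-expansion q m V)) (≈trans
      (solveₛ 5 (λ q m z V G → (:c 1ℤ :+ q :* (z :* V)) :*
        (:c 1ℤ :+ m :* q :* (z :* V) :+ q :* q :* (z :* (z :* V :* V :* G))) :=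
        :c 1ℤ :+ (:c 1ℤ :+ m) :* q :* (z :* V) :+ q :* q :* (z :* (z :* V :* V :* (m :+ G :+ q :* (z :* V :* G)))))
        ≈refl (con q) (con (+ m)) z V (tail-of-power q m V))
      (⊕-cong (⊕-cong ≈refl (⊗-cong (⊗-cong (≈sym (con-⊕ 1ℤ (+ m))) ≈refl) ≈refl)) ≈refl))

    agree-tail-of-power : ∀ {n V V′} q m → Agree n V V′ → Agree n (tail-of-power q m V) (tail-of-power q m V′)
    agree-tail-of-power q zero    p = agree-refl
    agree-tail-of-power q (suc m) p = agree-⊕ (agree-⊕ agree-refl (agree-tail-of-power q m p))
      (agree-⊗ agree-refl (agree-⊗ (agree-⊗ agree-refl p) (agree-tail-of-power q m p)))

  -- A q-th root of 1 + c z has in general denominators built from the primes of q; the factor q²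
  -- removes them. The equation for `V` is solved by z-adic contraction.
  root : ∀ q a → ∃ λ S → coef S 0 ≡ 1ℤ × S ^ q ≈ con 1ℤ ⊕ con (+ q * + q * a) ⊗ z
  root q a = S , refl′ , ≈trans (power-expansion (+ q) q V) (≈trans
      (solveₛ 4 (λ q z V W → :c 1ℤ :+ q :* q :* (z :* V) :+ q :* q :* (z :* W) := :c 1ℤ :+ q :* q :* (V :+ W) :* z)
        ≈refl (con (+ q)) z V (z ⊗ V ⊗ V ⊗ tail-of-power (+ q) q V))
      (⊕-cong ≈refl (⊗-cong (≈trans (⊗-cong (≈sym (con-⊗ (+ q) (+ q))) V-equation) (≈sym (con-⊗ _ a))) ≈refl)))
    where
    Φ : Series → Series
    Φ V = con a ⊕ ⊖ (z ⊗ (V ⊗ V ⊗ tail-of-power (+ q) q V))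
    open FixedPoint Φ (λ p → agree-⊕ agree-refl (agree-⊖ (agree-z (agree-⊗ (agree-⊗ p p) (agree-tail-of-power (+ q) q p)))))
      renaming (fixed to V)
    S : Series
    S = con 1ℤ ⊕ con (+ q) ⊗ (z ⊗ V)
    refl′ : coef S 0 ≡ 1ℤ
    refl′ = cong (λ x → 1ℤ + x) (ℤ.*-zeroʳ (+ q))
    V-equation : V ⊕ z ⊗ V ⊗ V ⊗ tail-of-power (+ q) q V ≈ con a
    V-equation = ≈trans (⊕-cong fixed-≈ ≈refl) (solveₛ 4 (λ a z V G → a :+ (:- (z :* (V :* V :* G))) :+ z :* V :* V :* G := a)
      ≈refl (con a) z V (tail-of-power (+ q) q V))

-- Linear dependence over ℤ

module Dependence where

  open import Data.Fin using (Fin; zero; suc; punchIn)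
  open import Data.Fin.Properties using (any?)
  open import Data.Integer using (ℤ; 0ℤ; 1ℤ; _+_; _*_; -_; _-_; _≟_)
  import Data.Integer.Properties as ℤ
  open import Data.Integer.Tactic.RingSolver using (solve-∀)
  open import Data.Nat using (ℕ; zero; suc; _<_; s≤s)
  import Data.Nat.Properties as ℕ
  open import Data.Product using (∃; _×_; _,_; proj₁; proj₂)
  open import Data.Sum using (inj₁; inj₂)
  open import Data.Vec.Functional using (insertAt)
  open import Data.Vec.Functional.Properties using (insertAt-lookup; insertAt-punchIn)
  open import Algebra.Properties.CommutativeMonoid.Sum ℤ.+-0-commutativeMonoid public
    using (sum; sum-remove; sum-init-last; ∑-distrib-+; ∑-comm)
    renaming (sum-cong-≗ to sum-cong; sum-replicate-zero to sum-zeros)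
  open import Algebra.Properties.Semiring.Sum ℤ.+-*-semiring public
    using () renaming (*-distribˡ-sum to *-sum; *-distribʳ-sum to sum-*)
  open import Relation.Binary.PropositionalEquality
  open import Relation.Nullary using (yes; no; ¬?)
  open import Relation.Nullary.Decidable using (decidable-stable)

  sum≡0 : ∀ {n} {f : Fin n → ℤ} → (∀ i → f i ≡ 0ℤ) → sum f ≡ 0ℤ
  sum≡0 {n} p = trans (sum-cong p) (sum-zeros n)

  private
    ring₁ : ∀ a w h p c → c * (a * w + - (h * p)) ≡ a * c * w + c * h * - p
    ring₁ = solve-∀
    ring₂ : ∀ s p → - s * p ≡ s * - p
    ring₂ = solve-∀
    ring₃ : ∀ a h → a * h + - (h * a) ≡ 0ℤ
    ring₃ = solve-∀

  -- Fraction-free elimination keeps the relation over ℤ. If some row has a nonzero first coordinate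
  -- a, every other row is multiplied by a and corrected by the pivot row; the coefficient of the
  -- pivot row is then chosen so that the first coordinates cancel.
  dependent : ∀ m n (w : Fin n → Fin m → ℤ) → m < n →
    ∃ λ (c : Fin n → ℤ) → (∃ λ i → c i ≢ 0ℤ) × (∀ j → sum (λ i → c i * w i j) ≡ 0ℤ)
  dependent zero    (suc n) w _ = (λ _ → 1ℤ) , (zero , λ ()) , λ ()
  dependent (suc m) (suc n) w (s≤s m<n) with any? (λ i → ¬? (w i zero ≟ 0ℤ))
  ... | no all-zero = let c , c≢0 , rel = dependent m (suc n) (λ i j → w i (suc j)) (ℕ.m<n⇒m<1+n m<n) in
    c , c≢0 , λ where
      zero    → sum≡0 λ i → trans (cong (c i *_)
        (decidable-stable (w i zero ≟ 0ℤ) λ q → all-zero (i , q))) (ℤ.*-zeroʳ (c i))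
      (suc j) → rel j
  ... | yes (p , a≢0) = c , (punchIn p i , ci≢0) , rel′
    where
    a = w p zero
    others : Fin n → Fin (suc m) → ℤ
    others k = w (punchIn p k)
    IH = dependent m n (λ k j → a * others k (suc j) + - (others k zero * w p (suc j))) m<n
    c′ = proj₁ IH
    i = proj₁ (proj₁ (proj₂ IH))
    rel = proj₂ (proj₂ IH)
    s = sum (λ k → c′ k * others k zero)
    c : Fin (suc n) → ℤ
    c = insertAt (λ k → a * c′ k) p (- s)
    ci≢0 : c (punchIn p i) ≢ 0ℤ
    ci≢0 q with ℤ.i*j≡0⇒i≡0∨j≡0 a (trans (sym (insertAt-punchIn (λ k → a * c′ k) p (- s) i)) q)
    ... | inj₁ a≡0 = a≢0 a≡0
    ... | inj₂ e   = proj₂ (proj₁ (proj₂ IH)) e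
    expand : ∀ j → sum (λ i → c i * w i j) ≡ sum (λ k → c′ k * (a * others k j + - (others k zero * w p j)))
    expand j = trans (sum-remove {i = p} (λ i → c i * w i j)) (trans
      (cong₂ _+_
        (trans (cong (_* w p j) (insertAt-lookup (λ k → a * c′ k) p (- s))) (ring₂ s (w p j)))
        (sum-cong λ k → cong (_* others k j) (insertAt-punchIn (λ k → a * c′ k) p (- s) k)))
      (trans (ℤ.+-comm (s * - w p j) _) (trans
        (cong (sum (λ k → a * c′ k * others k j) +_) (sum-* (- w p j) (λ k → c′ k * others k zero)))
        (trans (sym (∑-distrib-+ (λ k → a * c′ k * others k j) (λ k → c′ k * others k zero * - w p j)))
          (sum-cong λ k → sym (ring₁ a (others k j) (others k zero) (w p j) (c′ k)))))))
    rel′ : ∀ j → sum (λ i → c i * w i j) ≡ 0ℤ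
    rel′ zero    = trans (expand zero) (sum≡0 λ k →
      trans (cong (c′ k *_) (ring₃ a (others k zero))) (ℤ.*-zeroʳ (c′ k)))
    rel′ (suc j) = trans (expand (suc j)) (rel j)

-- Polynomials in y and their values at power series

module Polynomial where

  open Series
  open Dependence using (sum)
  open import Algebra.Bundles using (CommutativeRing)
  import Algebra.Properties.Semiring.Sum
  open import Data.Fin using (Fin; zero; suc)
  open import Data.Fin.Properties using (suc-injective)
  open import Data.Integer using (ℤ; +_; 0ℤ; _+_; _*_; -_; _-_; _≟_)
  import Data.Integer.Properties as ℤ
  open import Data.Integer.Tactic.RingSolver using (solve-∀)
  open import Data.List using (List; []; _∷_; length)
  open import Data.List.Relation.Unary.All using (All; []; _∷_; all?)
  open import Data.Nat using (ℕ; zero; suc; _≤_; _<_; s≤s; z≤n)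
  import Data.Nat.Properties as ℕ
  open import Data.Sum using (inj₁; inj₂)
  open import Function using (Injective)
  open import Relation.Binary.PropositionalEquality
  open import Relation.Nullary using (Dec; contradiction)

  module Σs = Algebra.Properties.Semiring.Sum (CommutativeRing.semiring ring)

  Poly : Set
  Poly = List ℤ

  ev : Poly → Series → Series
  ev []      Y = con 0ℤ
  ev (a ∷ p) Y = con a ⊕ Y ⊗ ev p Y

  evℤ : Poly → ℤ → ℤ
  evℤ []      y = 0ℤ
  evℤ (a ∷ p) y = a + y * evℤ p y

  coefₚ : Poly → ℕ → ℤ
  coefₚ []      k       = 0ℤ
  coefₚ (a ∷ p) zero    = a
  coefₚ (a ∷ p) (suc k) = coefₚ p k

  -- Coefficient lists may end in zeros, so the zero polynomial has many representatives.
  Zero : Poly → Set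
  Zero = All (_≡ 0ℤ)

  zero? : ∀ p → Dec (Zero p)
  zero? = all? (_≟ 0ℤ)

  infixl 6 _+ₚ_
  infixl 7 _*ₚ_
  _+ₚ_ _*ₚ_ : Poly → Poly → Poly
  []      +ₚ q       = q
  (a ∷ p) +ₚ []      = a ∷ p
  (a ∷ p) +ₚ (b ∷ q) = a + b ∷ p +ₚ q

  scale : ℤ → Poly → Poly
  scale c []      = []
  scale c (a ∷ p) = c * a ∷ scale c p

  []      *ₚ q = []
  (a ∷ p) *ₚ q = scale a q +ₚ (0ℤ ∷ p *ₚ q)

  der : Poly → Poly
  der []      = []
  der (a ∷ p) = p +ₚ (0ℤ ∷ der p)

  timesLinear : ℤ → Poly → Poly
  timesLinear h p = scale h p +ₚ (0ℤ ∷ p)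

  combineₚ : ∀ {n} → (Fin n → ℤ) → (Fin n → Poly) → Poly
  combineₚ {zero}  c P = []
  combineₚ {suc n} c P = scale (c zero) (P zero) +ₚ combineₚ (λ i → c (suc i)) (λ i → P (suc i))

  ev-+ : ∀ p q Y → ev (p +ₚ q) Y ≈ ev p Y ⊕ ev q Y
  ev-+ [] q Y = solveₛ 1 (λ x → x := :c 0ℤ :+ x) ≈refl (ev q Y)
  ev-+ (a ∷ p) [] Y = solveₛ 1 (λ x → x := x :+ :c 0ℤ) ≈refl (ev (a ∷ p) Y)
  ev-+ (a ∷ p) (b ∷ q) Y = ≈trans (⊕-cong (con-⊕ a b) (⊗-cong ≈refl (ev-+ p q Y)))
    (solveₛ 5 (λ a b y p q → a :+ b :+ y :* (p :+ q) := a :+ y :* p :+ (b :+ y :* q)) ≈refl (con a) (con b) Y (ev p Y) (ev q Y))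

  ev-scale : ∀ c p Y → ev (scale c p) Y ≈ con c ⊗ ev p Y
  ev-scale c []      Y = solveₛ 1 (λ c → :c 0ℤ := c :* :c 0ℤ) ≈refl (con c)
  ev-scale c (a ∷ p) Y = ≈trans (⊕-cong (con-⊗ c a) (⊗-cong ≈refl (ev-scale c p Y)))
    (solveₛ 4 (λ c a y p → c :* a :+ y :* (c :* p) := c :* (a :+ y :* p)) ≈refl (con c) (con a) Y (ev p Y))

  ev-* : ∀ p q Y → ev (p *ₚ q) Y ≈ ev p Y ⊗ ev q Y
  ev-* []      q Y = solveₛ 1 (λ q → :c 0ℤ := :c 0ℤ :* q) ≈refl (ev q Y)
  ev-* (a ∷ p) q Y = ≈trans (ev-+ (scale a q) (0ℤ ∷ p *ₚ q) Y) (≈trans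
    (⊕-cong (ev-scale a q Y) (⊕-cong ≈refl (⊗-cong ≈refl (ev-* p q Y))))
    (solveₛ 4 (λ a y p q → a :* q :+ (:c 0ℤ :+ y :* (p :* q)) := (a :+ y :* p) :* q) ≈refl (con a) Y (ev p Y) (ev q Y)))

  ev-timesLinear : ∀ h p Y → ev (timesLinear h p) Y ≈ (Y ⊕ con h) ⊗ ev p Y
  ev-timesLinear h p Y = ≈trans (ev-+ (scale h p) (0ℤ ∷ p) Y) (≈trans (⊕-cong (ev-scale h p Y) ≈refl)
    (solveₛ 3 (λ h y p → h :* p :+ (:c 0ℤ :+ y :* p) := (y :+ h) :* p) ≈refl (con h) Y (ev p Y)))

  ∂-ev : ∀ p Y → ∂ (ev p Y) ≈ ∂ Y ⊗ ev (der p) Y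
  ∂-ev []      Y = ≈trans (∂-con 0ℤ) (solveₛ 1 (λ y → :c 0ℤ := y :* :c 0ℤ) ≈refl (∂ Y))
  ∂-ev (a ∷ p) Y = ≈trans (∂-⊕ (con a) (Y ⊗ ev p Y)) (≈trans
    (⊕-cong (∂-con a) (≈trans (∂-⊗ Y (ev p Y)) (⊕-cong ≈refl (⊗-cong ≈refl (∂-ev p Y)))))
    (≈trans
      (solveₛ 4 (λ y y′ p p′ → :c 0ℤ :+ (y′ :* p :+ y :* (y′ :* p′)) := y′ :* (p :+ (:c 0ℤ :+ y :* p′)))
        ≈refl Y (∂ Y) (ev p Y) (ev (der p) Y))
      (⊗-cong ≈refl (≈sym (ev-+ p (0ℤ ∷ der p) Y)))))

  ev-combine : ∀ {n} (c : Fin n → ℤ) P Y → ev (combineₚ c P) Y ≈ Σs.sum (λ i → con (c i) ⊗ ev (P i) Y)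
  ev-combine {zero}  c P Y = ≈refl
  ev-combine {suc n} c P Y = ≈trans (ev-+ (scale (c zero) (P zero)) (combineₚ (λ i → c (suc i)) (λ i → P (suc i))) Y)
    (⊕-cong (ev-scale (c zero) (P zero) Y) (ev-combine (λ i → c (suc i)) (λ i → P (suc i)) Y))

  ev-Zero : ∀ {p} Y → Zero p → ev p Y ≈ con 0ℤ
  ev-Zero Y []         = ≈refl
  ev-Zero Y (refl ∷ z) = ≈trans (⊕-cong ≈refl (⊗-cong ≈refl (ev-Zero Y z)))
    (solveₛ 1 (λ y → :c 0ℤ :+ y :* :c 0ℤ := :c 0ℤ) ≈refl Y)

  coef-ev-0 : ∀ p Y → coef (ev p Y) 0 ≡ evℤ p (coef Y 0)
  coef-ev-0 []      Y = refl
  coef-ev-0 (a ∷ p) Y = cong (λ x → a + coef Y 0 * x) (coef-ev-0 p Y)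

  coefₚ-+ : ∀ p q k → coefₚ (p +ₚ q) k ≡ coefₚ p k + coefₚ q k
  coefₚ-+ []      q       k       = sym (ℤ.+-identityˡ _)
  coefₚ-+ (a ∷ p) []      k       = sym (ℤ.+-identityʳ _)
  coefₚ-+ (a ∷ p) (b ∷ q) zero    = refl
  coefₚ-+ (a ∷ p) (b ∷ q) (suc k) = coefₚ-+ p q k

  coefₚ-scale : ∀ c p k → coefₚ (scale c p) k ≡ c * coefₚ p k
  coefₚ-scale c []      k       = sym (ℤ.*-zeroʳ c)
  coefₚ-scale c (a ∷ p) zero    = refl
  coefₚ-scale c (a ∷ p) (suc k) = coefₚ-scale c p k

  coefₚ-combine : ∀ {n} (c : Fin n → ℤ) P k → coefₚ (combineₚ c P) k ≡ sum (λ i → c i * coefₚ (P i) k)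
  coefₚ-combine {zero}  c P k = refl
  coefₚ-combine {suc n} c P k = trans (coefₚ-+ (scale (c zero) (P zero)) _ k)
    (cong₂ _+_ (coefₚ-scale (c zero) (P zero) k) (coefₚ-combine (λ i → c (suc i)) (λ i → P (suc i)) k))

  length-+ : ∀ p q {B} → length p ≤ B → length q ≤ B → length (p +ₚ q) ≤ B
  length-+ []      q       _       q≤      = q≤
  length-+ (a ∷ p) []      p≤      _       = p≤
  length-+ (a ∷ p) (b ∷ q) (s≤s p≤) (s≤s q≤) = s≤s (length-+ p q p≤ q≤)

  length-scale : ∀ c p → length (scale c p) ≡ length p
  length-scale c []      = refl
  length-scale c (a ∷ p) = cong suc (length-scale c p)

  length-combine : ∀ {n B} (c : Fin n → ℤ) P → (∀ i → length (P i) ≤ B) → length (combineₚ c P) ≤ B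
  length-combine {zero}  c P bound = z≤n
  length-combine {suc n} c P bound = length-+ (scale (c zero) (P zero)) _
    (subst (_≤ _) (sym (length-scale (c zero) (P zero))) (bound zero))
    (length-combine (λ i → c (suc i)) (λ i → P (suc i)) (λ i → bound (suc i)))

  length-timesLinear : ∀ h p → length (timesLinear h p) ≤ suc (length p)
  length-timesLinear h p = length-+ (scale h p) (0ℤ ∷ p)
    (subst (_≤ _) (sym (length-scale h p)) (ℕ.n≤1+n _)) ℕ.≤-refl

  Zero-coefₚ : ∀ p {B} → length p ≤ B → (∀ k → k < B → coefₚ p k ≡ 0ℤ) → Zero p
  Zero-coefₚ []      _        _ = []
  Zero-coefₚ (a ∷ p) (s≤s p≤) e = e 0 (s≤s z≤n) ∷ Zero-coefₚ p p≤ (λ k k<B → e (suc k) (s≤s k<B))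

  module _ (y₀ Q : ℤ) where

    private
      Y : Series
      Y = con y₀ ⊕ con Q ⊗ z

    coef-Y⊗ : ∀ f n → coef (Y ⊗ f) (suc n) ≡ y₀ * coef f (suc n) + Q * coef f n
    coef-Y⊗ f n = trans
      (at (solveₛ 4 (λ y q z f → (y :+ q :* z) :* f := y :* f :+ q :* (z :* f)) ≈refl (con y₀) (con Q) z f) (suc n))
      (cong₂ _+_ (con⊗ y₀ f (suc n)) (trans (con⊗ Q (z ⊗ f) (suc n)) (cong (Q *_) (z⊗-suc f n))))

    private
      degree : ∀ p n → length p ≤ n → coef (ev p Y) n ≡ 0ℤ
      degree []      n       _        = con-0 n
      degree (a ∷ p) (suc n) (s≤s p≤) = trans (ℤ.+-identityˡ _) (trans (coef-Y⊗ (ev p Y) n)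
        (trans (cong₂ (λ u v → y₀ * u + Q * v) (degree p (suc n) (ℕ.m≤n⇒m≤1+n p≤)) (degree p n p≤))
          (trans (cong₂ _+_ (ℤ.*-zeroʳ y₀) (ℤ.*-zeroʳ Q)) refl)))

      descend : Q ≢ 0ℤ → ∀ (G : ℕ → ℤ) L → (∀ n → y₀ * G (suc n) + Q * G n ≡ 0ℤ) → (∀ n → L ≤ n → G n ≡ 0ℤ) → ∀ n → G n ≡ 0ℤ
      descend Q≢0 G zero    rec top n = top n z≤n
      descend Q≢0 G (suc L) rec top   = descend Q≢0 G L rec top′
        where
        QG≡0 : Q * G L ≡ 0ℤ
        QG≡0 = trans (sym (trans (cong (_+ Q * G L) (trans (cong (y₀ *_) (top (suc L) ℕ.≤-refl)) (ℤ.*-zeroʳ y₀)))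
          (ℤ.+-identityˡ _))) (rec L)
        top′ : ∀ n → L ≤ n → G n ≡ 0ℤ
        top′ n L≤n with ℕ.m≤n⇒m<n∨m≡n L≤n
        ... | inj₁ L<n = top n L<n
        ... | inj₂ refl with ℤ.i*j≡0⇒i≡0∨j≡0 Q QG≡0
        ...   | inj₁ Q≡0 = contradiction Q≡0 Q≢0
        ...   | inj₂ e   = e

    -- For a + y p put G = p(Y). The hypothesis gives y₀ G_(n+1) + Q G_n = 0 for all n, and G_n = 0
    -- beyond the degree, so vanishing descends from the top coefficient to G_0 because Q ≠ 0.
    ev-injective : Q ≢ 0ℤ → ∀ p → ev p Y ≈ con 0ℤ → Zero p
    ev-injective Q≢0 []      _ = []
    ev-injective Q≢0 (a ∷ p) e = a≡0 ∷ ev-injective Q≢0 p (⇒≈0 G≡0)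
      where
      G≡0 : ∀ n → coef (ev p Y) n ≡ 0ℤ
      G≡0 = descend Q≢0 (coef (ev p Y)) (length p)
        (λ n → trans (sym (trans (ℤ.+-identityˡ _) (coef-Y⊗ (ev p Y) n))) (≈0⇒ e (suc n))) (degree p)
      a≡0 : a ≡ 0ℤ
      a≡0 = trans (sym (trans (cong (λ x → a + (y₀ + Q * 0ℤ) * x) (G≡0 0))
        (trans (cong (λ x → a + x) (ℤ.*-zeroʳ (y₀ + Q * 0ℤ))) (ℤ.+-identityʳ a)))) (at e 0)

  -- quotient p c is the quotient of a ∷ p, that is of a + y p, by y - c; it does not depend on a.
  private
    quotient : Poly → ℤ → Poly
    quotient []      c = []
    quotient (b ∷ p) c = evℤ (b ∷ p) c ∷ quotient p c

    length-quotient : ∀ p c → length (quotient p c) ≡ length p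
    length-quotient []      c = refl
    length-quotient (a ∷ p) c = cong suc (length-quotient p c)

    ring₁ : ∀ a y c d e → a + y * ((y - c) * d + e) ≡ (y - c) * (e + y * d) + (a + c * e)
    ring₁ = solve-∀
    ring₂ : ∀ a y c → a + y * 0ℤ ≡ (y - c) * 0ℤ + (a + c * 0ℤ)
    ring₂ = solve-∀

    division : ∀ a p c y → evℤ (a ∷ p) y ≡ (y - c) * evℤ (quotient p c) y + evℤ (a ∷ p) c
    division a []      c y = ring₂ a y c
    division a (b ∷ p) c y = trans (cong (λ x → a + y * x) (division b p c y))
      (ring₁ a y c (evℤ (quotient p c) y) (evℤ (b ∷ p) c))

    drop-zero : ∀ a c {x} → x ≡ 0ℤ → a + c * x ≡ 0ℤ → a ≡ 0ℤ
    drop-zero a c refl e = trans (sym (trans (cong (λ x → a + x) (ℤ.*-zeroʳ c)) (ℤ.+-identityʳ a))) e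

    Zero-quotient : ∀ a p c → Zero (quotient p c) → evℤ (a ∷ p) c ≡ 0ℤ → Zero (a ∷ p)
    Zero-quotient a []      c z       e = drop-zero a c refl e ∷ []
    Zero-quotient a (b ∷ p) c (e′ ∷ z) e = drop-zero a c e′ e ∷ Zero-quotient b p c z e′

  many-roots : ∀ {t} (T : Fin t → ℤ) → Injective _≡_ _≡_ T → ∀ p → length p ≤ t → (∀ i → evℤ p (T i) ≡ 0ℤ) → Zero p
  many-roots T inj [] _ _ = []
  many-roots {suc t} T inj (a ∷ p) (s≤s p≤) root = Zero-quotient a p c
    (many-roots (λ i → T (suc i)) (λ e → suc-injective (inj e)) (quotient p c)
      (subst (_≤ t) (sym (length-quotient p c)) p≤) root′) (root zero)
    where
    c = T zero
    root′ : ∀ i → evℤ (quotient p c) (T (suc i)) ≡ 0ℤ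
    root′ i with ℤ.i*j≡0⇒i≡0∨j≡0 (T (suc i) - c) (trans (sym (trans (division a p c (T (suc i)))
                  (trans (cong (λ x → (T (suc i) - c) * evℤ (quotient p c) (T (suc i)) + x) (root zero)) (ℤ.+-identityʳ _))))
                  (root (suc i)))
    ... | inj₁ e = contradiction (inj (ℤ.i-j≡0⇒i≡j (T (suc i)) c e)) λ ()
    ... | inj₂ e = e

-- Linear independence of products of roots, by ramification

module Independence where

  open Series
  open Root using (_^_)
  open Polynomial
  open import Data.Fin using (Fin; zero; suc)
  open import Data.Fin.Properties using (suc-injective; any?)
  open import Data.Integer using (ℤ; +_; 0ℤ; 1ℤ; _+_; _*_; -_; _-_; ∣_∣; _≟_)

  import Data.Integer.Properties as ℤ
  open import Data.Integer.Tactic.RingSolver using (solve-∀)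
  open import Data.List using ([]; _∷_)
  open import Data.Nat using (ℕ; zero; suc; _≤_; _<_; _⊔_; ≢-nonZero)
  import Data.Nat.Properties as ℕ
  import Data.Nat.Divisibility as ℕ
  open import Data.Product using (∃; _×_; _,_; proj₁; proj₂)
  open import Data.Sum using (inj₁; inj₂)
  open import Function using (Injective; _∘_)
  open import Relation.Binary.PropositionalEquality
  open import Relation.Nullary using (¬_; Dec; yes; no; contradiction; ¬?)
  open import Relation.Nullary.Decidable using (decidable-stable)

  *≢0 : ∀ {a b} → a ≢ 0ℤ → b ≢ 0ℤ → a * b ≢ 0ℤ
  *≢0 {a} a≢0 b≢0 e with ℤ.i*j≡0⇒i≡0∨j≡0 a e
  ... | inj₁ a≡0 = a≢0 a≡0
  ... | inj₂ b≡0 = b≢0 b≡0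

  module Ramification (q : ℕ) (N G : Series) (N₀≢0 : coef N 0 ≢ 0ℤ) where

    infix 5 _≢0mod-q
    _≢0mod-q : ℤ → Set
    κ ≢0mod-q = ∀ s → κ + + q * s ≢ 0ℤ

    -- Divided by N P R and with θ = z ∂, this reads q (θP/P - θR/R) + κ = z G / N. Its constant
    -- term expresses q (ord P - ord R) + κ = 0.
    Relation : ℤ → Series → Series → Set
    Relation κ P R = N ⊗ (con (+ q) ⊗ (R ⊗ (z ⊗ ∂ P) ⊕ ⊖ (P ⊗ (z ⊗ ∂ R))) ⊕ con κ ⊗ P ⊗ R) ≈ z ⊗ G ⊗ P ⊗ R

    private
      ring₁ : ∀ n q c x p y κ → n * (q * (c * (0ℤ * x) + - (p * (0ℤ * y))) + κ * p * c) ≡ n * (κ * (p * c))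
      ring₁ = solve-∀
      ring₂ : ∀ κ q s → κ + q + q * s ≡ κ + q * (1ℤ + s)
      ring₂ = solve-∀
      ring₃ : ∀ κ q s → κ + - q + q * s ≡ κ + q * (- 1ℤ + s)
      ring₃ = solve-∀

      ∂-z⊗ : ∀ A → ∂ (z ⊗ A) ≈ A ⊕ z ⊗ ∂ A
      ∂-z⊗ A = ≈trans (∂-⊗ z A) (≈trans (⊕-cong (⊗-cong ∂-z ≈refl) ≈refl)
        (solveₛ 3 (λ z A A′ → :c 1ℤ :* A :+ z :* A′ := A :+ z :* A′) ≈refl z A (∂ A)))

      Relation-cong : ∀ {κ P P′ R R′} → P ≈ P′ → R ≈ R′ → Relation κ P R → Relation κ P′ R′
      Relation-cong {κ} {P} {P′} {R} {R′} p r rel = ≈trans (≈sym (⊗-cong ≈refl (⊕-cong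
        (⊗-cong ≈refl (⊕-cong (⊗-cong r (⊗-cong ≈refl (∂-cong p))) (⊖-cong (⊗-cong p (⊗-cong ≈refl (∂-cong r))))))
        (⊗-cong (⊗-cong ≈refl p) r)))) (≈trans rel (⊗-cong (⊗-cong ≈refl p) r))

      shiftˡ : ∀ {κ A R} → Relation κ (z ⊗ A) R → Relation (κ + + q) A R
      shiftˡ {κ} {A} {R} rel = z-cancel (≈trans
        (≈trans (⊗-cong ≈refl (⊗-cong ≈refl (⊕-cong ≈refl (⊗-cong (⊗-cong (con-⊕ κ (+ q)) ≈refl) ≈refl))))
        (≈trans
          (solveₛ 8 (λ N q κ z A A′ R R′ →
            z :* (N :* (q :* (R :* (z :* A′) :+ :- (A :* (z :* R′))) :+ (κ :+ q) :* A :* R)) :=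
            N :* (q :* (R :* (z :* (A :+ z :* A′)) :+ :- (z :* A :* (z :* R′))) :+ κ :* (z :* A) :* R))
            ≈refl N (con (+ q)) (con κ) z A (∂ A) R (∂ R))
          (⊗-cong ≈refl (⊕-cong (⊗-cong ≈refl (⊕-cong (⊗-cong ≈refl (⊗-cong ≈refl (≈sym (∂-z⊗ A)))) ≈refl)) ≈refl))))
        (≈trans rel (solveₛ 4 (λ z G A R → z :* G :* (z :* A) :* R := z :* (z :* G :* A :* R)) ≈refl z G A R)))

      shiftʳ : ∀ {κ P B} → Relation κ P (z ⊗ B) → Relation (κ + - + q) P B
      shiftʳ {κ} {P} {B} rel = z-cancel (≈trans
        (≈trans (⊗-cong ≈refl (⊗-cong ≈refl (⊕-cong ≈refl (⊗-cong (⊗-cong (≈trans (con-⊕ κ (- + q)) (⊕-cong ≈refl (con-⊖ (+ q)))) ≈refl) ≈refl))))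
        (≈trans
          (solveₛ 8 (λ N q κ z P P′ B B′ →
            z :* (N :* (q :* (B :* (z :* P′) :+ :- (P :* (z :* B′))) :+ (κ :+ :- q) :* P :* B)) :=
            N :* (q :* (z :* B :* (z :* P′) :+ :- (P :* (z :* (B :+ z :* B′)))) :+ κ :* P :* (z :* B)))
            ≈refl N (con (+ q)) (con κ) z P (∂ P) B (∂ B))
          (⊗-cong ≈refl (⊕-cong (⊗-cong ≈refl (⊕-cong ≈refl (⊖-cong (⊗-cong ≈refl (⊗-cong ≈refl (≈sym (∂-z⊗ B))))))) ≈refl))))
        (≈trans rel (solveₛ 4 (λ z G P B → z :* G :* P :* (z :* B) := z :* (z :* G :* P :* B)) ≈refl z G P B)))

      constant-term : ∀ {κ P R} → Relation κ P R → coef N 0 * (κ * (coef P 0 * coef R 0)) ≡ 0ℤ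
      constant-term {κ} {P} {R} rel = trans
        (sym (ring₁ (coef N 0) (+ q) (coef R 0) (coef (∂ P) 0) (coef P 0) (coef (∂ R) 0) κ))
        (at rel 0)

    -- If P and R were both nonzero, then κ = q (ord R - ord P), which `κ ≢0mod-q` excludes. Factors
    -- z are stripped from R and then from P, each changing κ by q or - q; once R has a nonzero
    -- constant term, the constant term of the relation makes that of P vanish.
    vanish : ∀ a b {κ P R} → κ ≢0mod-q → Relation κ P R → coef R b ≢ 0ℤ → coef P a ≡ 0ℤ
    vanish a b {κ} {P} {R} κ≢0 rel Rb≢0 with coef R 0 ≟ 0ℤ
    vanish a zero    {κ} {P} {R} κ≢0 rel Rb≢0 | yes R₀≡0 = contradiction R₀≡0 Rb≢0
    vanish a (suc b) {κ} {P} {R} κ≢0 rel Rb≢0 | yes R₀≡0 =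
      vanish a b (λ s e → κ≢0 (- 1ℤ + s) (trans (sym (ring₃ κ (+ q) s)) e))
        (shiftʳ {κ} {P} {tail R} (Relation-cong {κ} {P} {P} {R} {z ⊗ tail R} ≈refl (z⊗tail R R₀≡0) rel)) Rb≢0
    vanish a b {κ} {P} {R} κ≢0 rel Rb≢0 | no R₀≢0 = go a
      where
      P₀≡0 : coef P 0 ≡ 0ℤ
      P₀≡0 = decidable-stable (coef P 0 ≟ 0ℤ) λ P₀≢0 →
        *≢0 N₀≢0 (*≢0 (λ e → κ≢0 0ℤ (trans (cong (λ x → κ + x) (ℤ.*-zeroʳ (+ q))) (trans (ℤ.+-identityʳ κ) e)))
          (*≢0 P₀≢0 R₀≢0)) (constant-term {κ} {P} {R} rel)
      go : ∀ a → coef P a ≡ 0ℤ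
      go zero    = P₀≡0
      go (suc a) = vanish a b (λ s e → κ≢0 (1ℤ + s) (trans (sym (ring₂ κ (+ q) s)) e))
        (shiftˡ {κ} {tail P} {R} (Relation-cong {κ} {P} {z ⊗ tail P} {R} {R} (z⊗tail P P₀≡0) ≈refl rel)) Rb≢0

  mono : ∀ {r} → (Fin r → Series) → (Fin r → ℕ) → Series
  mono {zero}  u e = con 1ℤ
  mono {suc r} u e = u zero ^ e zero ⊗ mono (u ∘ suc) (e ∘ suc)

  -- M = ∏ (y + hᵢ) and Λ e = ∑ eᵢ M / (y + hᵢ)
  M : ∀ {r} → (Fin r → ℤ) → Poly
  M {zero}  h = 1ℤ ∷ []
  M {suc r} h = timesLinear (h zero) (M (h ∘ suc))

  Λ : ∀ {r} → (Fin r → ℤ) → (Fin r → ℕ) → Poly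
  Λ {zero}  h e = []
  Λ {suc r} h e = scale (+ e zero) (M (h ∘ suc)) +ₚ timesLinear (h zero) (Λ (h ∘ suc) (e ∘ suc))

  ev-Λ : ∀ {r} h e Y → ev (Λ {suc r} h e) Y ≈ con (+ e zero) ⊗ ev (M (h ∘ suc)) Y ⊕ (Y ⊕ con (h zero)) ⊗ ev (Λ (h ∘ suc) (e ∘ suc)) Y
  ev-Λ h e Y = ≈trans (ev-+ (scale (+ e zero) (M (h ∘ suc))) (timesLinear (h zero) (Λ (h ∘ suc) (e ∘ suc))) Y)
    (⊕-cong (ev-scale (+ e zero) (M (h ∘ suc)) Y) (ev-timesLinear (h zero) (Λ (h ∘ suc) (e ∘ suc)) Y))

  cancel : ∀ a f {A B} → coef f a ≢ 0ℤ → f ⊗ A ≈ f ⊗ B → A ≈ B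
  at (cancel a f {A} {B} fa≢0 p) n = ℤ.i-j≡0⇒i≡j (coef A n) (coef B n) (no-zero-divisors a f (A ⊕ ⊖ B)
    (≈trans (solveₛ 3 (λ f A B → f :* (A :+ :- B) := f :* A :+ :- (f :* B)) ≈refl f A B)
      (⇒≈0 λ k → trans (cong (_- coef (f ⊗ B) k) (at p k)) (ℤ.+-inverseʳ (coef (f ⊗ B) k)))) fa≢0 n)

  -- Multiplied by f to avoid the exponent n - 1.
  ∂-^ : ∀ f n → ∂ (f ^ n) ⊗ f ≈ con (+ n) ⊗ (f ^ n ⊗ ∂ f)
  ∂-^ f zero    = ≈trans (⊗-cong (∂-con 1ℤ) ≈refl) (solveₛ 2 (λ f f′ → :c 0ℤ :* f := :c 0ℤ :* (:c 1ℤ :* f′)) ≈refl f (∂ f))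
  ∂-^ f (suc n) = ≈trans (⊗-cong (∂-⊗ f (f ^ n)) ≈refl) (≈trans
    (solveₛ 4 (λ f f′ g g′ → (f′ :* g :+ f :* g′) :* f := f′ :* g :* f :+ f :* (g′ :* f)) ≈refl f (∂ f) (f ^ n) (∂ (f ^ n)))
    (≈trans (⊕-cong ≈refl (⊗-cong ≈refl (∂-^ f n))) (≈trans
      (solveₛ 4 (λ n f f′ g → f′ :* g :* f :+ f :* (n :* (g :* f′)) := (:c 1ℤ :+ n) :* (f :* g :* f′)) ≈refl (con (+ n)) f (∂ f) (f ^ n))
      (⊗-cong (≈sym (con-⊕ 1ℤ (+ n))) ≈refl))))

  coef-^-0 : ∀ f n → coef f 0 ≢ 0ℤ → coef (f ^ n) 0 ≢ 0ℤ
  coef-^-0 f zero    f₀≢0 = λ ()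
  coef-^-0 f (suc n) f₀≢0 = *≢0 f₀≢0 (coef-^-0 f n f₀≢0)

  coef-mono-0 : ∀ {r} (u : Fin r → Series) e → (∀ i → coef (u i) 0 ≢ 0ℤ) → coef (mono u e) 0 ≢ 0ℤ
  coef-mono-0 {zero}  u e u₀≢0 = λ ()
  coef-mono-0 {suc r} u e u₀≢0 = *≢0 (coef-^-0 (u zero) (e zero) (u₀≢0 zero)) (coef-mono-0 (u ∘ suc) (e ∘ suc) (u₀≢0 ∘ suc))

  coef-M-0 : ∀ {r} (h : Fin r → ℤ) Y → (∀ j → coef Y 0 + h j ≢ 0ℤ) → coef (ev (M h) Y) 0 ≢ 0ℤ
  coef-M-0 {zero}  h Y Y+h≢0 e = case (trans (sym (trans (cong (λ x → 1ℤ + x) (ℤ.*-zeroʳ (coef Y 0))) refl)) e)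
    where
    case : 1ℤ ≢ 0ℤ
    case ()
  coef-M-0 {suc r} h Y Y+h≢0 e = *≢0 (Y+h≢0 zero) (coef-M-0 (h ∘ suc) Y (Y+h≢0 ∘ suc))
    (trans (sym (at (ev-timesLinear (h zero) (M (h ∘ suc)) Y) 0)) e)

  -- Near y = - h k, where z = y + h k.
  localise : ∀ {r} (h : Fin r → ℤ) → Injective _≡_ _≡_ h → ∀ k Y → Y ⊕ con (h k) ≈ z →
    ∃ λ N → coef N 0 ≢ 0ℤ × ev (M h) Y ≈ z ⊗ N × (∀ e → ∃ λ G → ev (Λ h e) Y ≈ con (+ e k) ⊗ N ⊕ z ⊗ G)
  localise {suc r} h inj zero Y Y+h≈z = ev (M (h ∘ suc)) Y
    , coef-M-0 (h ∘ suc) Y (λ j e → contradiction (inj (ℤ.i-j≡0⇒i≡j (h (suc j)) (h zero) (trans (lemma (h (suc j)) (h zero) (coef Y 0)) (trans (cong₂ _-_ e (at Y+h≈z 0)) refl)))) λ ())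
    , ≈trans (ev-timesLinear (h zero) (M (h ∘ suc)) Y) (⊗-cong Y+h≈z ≈refl)
    , λ e → ev (Λ (h ∘ suc) (e ∘ suc)) Y , ≈trans (ev-Λ h e Y) (⊕-cong ≈refl (⊗-cong Y+h≈z ≈refl))
    where
    lemma : ∀ a b y → a - b ≡ (y + a) - (y + b)
    lemma = solve-∀
  localise {suc r} h inj (suc k) Y Y+h≈z with localise (h ∘ suc) (λ e → suc-injective (inj e)) k Y Y+h≈z
  ... | N , N₀≢0 , M≈ , Λ≈ = (Y ⊕ con (h zero)) ⊗ N
    , *≢0 {coef Y 0 + h zero} (λ e → contradiction (inj (ℤ.i-j≡0⇒i≡j (h zero) (h (suc k)) (trans (lemma (h zero) (h (suc k)) (coef Y 0)) (trans (cong₂ _-_ e (at Y+h≈z 0)) refl)))) λ ()) N₀≢0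
    , ≈trans (ev-timesLinear (h zero) (M (h ∘ suc)) Y) (≈trans (⊗-cong ≈refl M≈)
        (solveₛ 3 (λ y z N → y :* (z :* N) := z :* (y :* N)) ≈refl (Y ⊕ con (h zero)) z N))
    , λ e → let G , Λ≈G = Λ≈ (e ∘ suc) in
        con (+ e zero) ⊗ N ⊕ (Y ⊕ con (h zero)) ⊗ G
        , ≈trans (ev-Λ h e Y) (≈trans (⊕-cong (⊗-cong ≈refl M≈) (⊗-cong ≈refl Λ≈G))
            (solveₛ 6 (λ e₀ eₖ y z N G → e₀ :* (z :* N) :+ y :* (eₖ :* N :+ z :* G) := eₖ :* (y :* N) :+ z :* (e₀ :* N :+ y :* G))
              ≈refl (con (+ e zero)) (con (+ e (suc k))) (Y ⊕ con (h zero)) z N G))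
    where
    lemma : ∀ a b y → a - b ≡ (y + a) - (y + b)
    lemma = solve-∀

  residues-differ : ∀ {a b q} → a < q → b < q → a ≢ b → ∀ s → (+ a - + b) + + q * s ≢ 0ℤ
  residues-differ {a} {b} {q} a<q b<q a≢b s e = ℕ.<⇒≱ small (ℕ.∣⇒≤ {{≢-nonZero diff≢0}} q∣diff)
    where
    small : ∣ + a - + b ∣ < q
    small = ℕ.≤-<-trans (subst (λ x → ∣ x ∣ ≤ a ⊔ b) (sym (ℤ.m-n≡m⊖n a b)) (ℤ.∣m⊝n∣≤m⊔n a b)) (ℕ.⊔-lub a<q b<q)
    diff≢0 : ∣ + a - + b ∣ ≢ 0
    diff≢0 p = a≢b (ℤ.+-injective (ℤ.i-j≡0⇒i≡j (+ a) (+ b) (ℤ.∣i∣≡0⇒i≡0 p)))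
    lemma : ∀ x y → x ≡ (x + y) + - y
    lemma = solve-∀
    q∣diff : q ℕ.∣ ∣ + a - + b ∣
    q∣diff = ℕ.divides ∣ s ∣ (trans (cong ∣_∣ (trans (lemma (+ a - + b) (+ q * s)) (cong (_+ - (+ q * s)) e)))
      (trans (cong ∣_∣ (ℤ.+-identityˡ (- (+ q * s)))) (trans (ℤ.∣-i∣≡∣i∣ (+ q * s)) (trans (ℤ.abs-* (+ q) s) (ℕ.*-comm q ∣ s ∣)))))

  ∂-linear : ∀ y Q → ∂ (con y ⊕ con Q ⊗ z) ≈ con Q
  ∂-linear y Q = ≈trans (∂-⊕ (con y) (con Q ⊗ z)) (≈trans
    (⊕-cong (∂-con y) (≈trans (∂-⊗ (con Q) z) (⊕-cong (⊗-cong (∂-con Q) ≈refl) (⊗-cong ≈refl ∂-z))))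
    (solveₛ 2 (λ Q z → :c 0ℤ :+ (:c 0ℤ :* z :+ Q :* :c 1ℤ) := Q) ≈refl (con Q) z))

  module Derivation (q : ℕ) (y₀ Q : ℤ) where

    Y : Series
    Y = con y₀ ⊕ con Q ⊗ z

    ∂-root : ∀ f h e → coef f 0 ≢ 0ℤ → f ^ q ≈ Y ⊕ con h →
      con (+ q) ⊗ (Y ⊕ con h) ⊗ ∂ (f ^ e) ≈ con Q ⊗ (con (+ e) ⊗ f ^ e)
    ∂-root f h e f₀≢0 fq = cancel 0 f f₀≢0 (≈trans
      (solveₛ 4 (λ q Y f g → f :* (q :* Y :* g) := q :* Y :* (g :* f)) ≈refl (con (+ q)) (Y ⊕ con h) f (∂ (f ^ e)))
      (≈trans (⊗-cong ≈refl (∂-^ f e)) (≈trans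
        (solveₛ 5 (λ q Y e f f′ → q :* Y :* (e :* (f :* f′)) := e :* f :* (q :* (Y :* f′))) ≈refl (con (+ q)) (Y ⊕ con h) (con (+ e)) (f ^ e) (∂ f))
        (≈trans (⊗-cong ≈refl Y∂f) (solveₛ 4 (λ e g Q f → e :* g :* (Q :* f) := f :* (Q :* (e :* g))) ≈refl (con (+ e)) (f ^ e) (con Q) f)))))
      where
      Y∂f : con (+ q) ⊗ ((Y ⊕ con h) ⊗ ∂ f) ≈ con Q ⊗ f
      Y∂f = ≈trans (⊗-cong ≈refl (⊗-cong (≈sym fq) ≈refl)) (≈trans (≈sym (∂-^ f q))
        (⊗-cong (≈trans (∂-cong fq) (≈trans (∂-⊕ Y (con h)) (≈trans (⊕-cong (∂-linear y₀ Q) (∂-con h))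
          (solveₛ 1 (λ Q → Q :+ :c 0ℤ := Q) ≈refl (con Q))))) ≈refl))

    -- Logarithmic differentiation: q ∂ψ_i / ψ_i = Q / (Y + h_i), summed with the weights e_i and
    -- multiplied by the common denominator M.
    ∂-mono : ∀ {r} (h : Fin r → ℤ) (ψ : Fin r → Series) e → (∀ i → coef (ψ i) 0 ≢ 0ℤ) → (∀ i → ψ i ^ q ≈ Y ⊕ con (h i)) →
      con (+ q) ⊗ ev (M h) Y ⊗ ∂ (mono ψ e) ≈ con Q ⊗ (ev (Λ h e) Y ⊗ mono ψ e)
    ∂-mono {zero}  h ψ e ψ₀≢0 ψq = ≈trans (⊗-cong ≈refl (∂-con 1ℤ)) (solveₛ 3 (λ q M Q → q :* M :* :c 0ℤ := Q :* (:c 0ℤ :* :c 1ℤ)) ≈refl (con (+ q)) (ev (M h) Y) (con Q))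
    ∂-mono {suc r} h ψ e ψ₀≢0 ψq = ≈trans (⊗-cong (⊗-cong ≈refl (ev-timesLinear (h zero) (M (h ∘ suc)) Y)) (∂-⊗ f rest)) (≈trans
      (solveₛ 7 (λ q Y M f f′ g g′ → q :* (Y :* M) :* (f′ :* g :+ f :* g′) := M :* g :* (q :* Y :* f′) :+ Y :* f :* (q :* M :* g′))
        ≈refl (con (+ q)) (Y ⊕ con (h zero)) (ev (M (h ∘ suc)) Y) f (∂ f) rest (∂ rest))
      (≈trans (⊕-cong (⊗-cong ≈refl (∂-root (ψ zero) (h zero) (e zero) (ψ₀≢0 zero) (ψq zero)))
          (⊗-cong ≈refl (∂-mono (h ∘ suc) (ψ ∘ suc) (e ∘ suc) (ψ₀≢0 ∘ suc) (ψq ∘ suc))))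
        (≈trans (solveₛ 7 (λ Q Y M e L f g → M :* g :* (Q :* (e :* f)) :+ Y :* f :* (Q :* (L :* g)) := Q :* ((e :* M :+ Y :* L) :* (f :* g)))
          ≈refl (con Q) (Y ⊕ con (h zero)) (ev (M (h ∘ suc)) Y) (con (+ e zero)) (ev (Λ (h ∘ suc) (e ∘ suc)) Y) f rest)
          (⊗-cong ≈refl (⊗-cong (≈sym (ev-Λ h e Y)) ≈refl)))))
      where
      f rest : Series
      f = ψ zero ^ e zero
      rest = mono (ψ ∘ suc) (e ∘ suc)

    module _ {r : ℕ} (h : Fin r → ℤ) (ψ : Fin r → Series) (ψ₀≢0 : ∀ i → coef (ψ i) 0 ≢ 0ℤ)
      (ψ-root : ∀ i → ψ i ^ q ≈ Y ⊕ con (h i)) where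

      total : ∀ {n} → (Fin n → Fin r → ℕ) → (Fin n → Poly) → Series
      total e p = Σs.sum (λ i → ev (p i) Y ⊗ mono ψ (e i))

      D : Series → Series
      D f = con (+ q) ⊗ ev (M h) Y ⊗ ∂ f

      -- Up to the factor Q, the coefficient of ψ^e in `D` (p ψ^e), see `D-term`. It is a polynomial
      -- independent of the point of expansion, so it may be inspected near y = - h k although ψ is
      -- expanded at y₀.
      W : (Fin r → ℕ) → Poly → Poly
      W e p = scale (+ q) (M h) *ₚ der p +ₚ Λ h e *ₚ p

      ev-W : ∀ e p X → ev (W e p) X ≈ con (+ q) ⊗ ev (M h) X ⊗ ev (der p) X ⊕ ev (Λ h e) X ⊗ ev p X
      ev-W e p X = ≈trans (ev-+ (scale (+ q) (M h) *ₚ der p) (Λ h e *ₚ p) X)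
        (⊕-cong (≈trans (ev-* (scale (+ q) (M h)) (der p) X) (⊗-cong (ev-scale (+ q) (M h) X) ≈refl)) (ev-* (Λ h e) p X))

      D-term : ∀ e p → D (ev p Y ⊗ mono ψ e) ≈ con Q ⊗ (ev (W e p) Y ⊗ mono ψ e)
      D-term e p = ≈trans (⊗-cong ≈refl (≈trans (∂-⊗ (ev p Y) μ) (⊕-cong (⊗-cong (≈trans (∂-ev p Y) (⊗-cong (∂-linear y₀ Q) ≈refl)) ≈refl) ≈refl)))
        (≈trans (solveₛ 7 (λ q M Q p′ μ p μ′ → q :* M :* (Q :* p′ :* μ :+ p :* μ′) := Q :* (q :* M :* p′ :* μ) :+ p :* (q :* M :* μ′))
            ≈refl (con (+ q)) (ev (M h) Y) (con Q) (ev (der p) Y) μ (ev p Y) (∂ μ))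
        (≈trans (⊕-cong ≈refl (⊗-cong ≈refl (∂-mono h ψ e ψ₀≢0 ψ-root)))
        (≈trans (solveₛ 7 (λ q M Q p′ μ p L → Q :* (q :* M :* p′ :* μ) :+ p :* (Q :* (L :* μ)) := Q :* ((q :* M :* p′ :+ L :* p) :* μ))
            ≈refl (con (+ q)) (ev (M h) Y) (con Q) (ev (der p) Y) μ (ev p Y) (ev (Λ h e) Y))
          (⊗-cong ≈refl (⊗-cong (≈sym (ev-W e p Y)) ≈refl)))))
        where
        μ = mono ψ e

      -- the combination p₀ D - (D p₀) kills the first of the terms p₀ ψ^e₀, p ψ^e
      reduce : (Fin r → ℕ) → Poly → (Fin r → ℕ) → Poly → Poly
      reduce e₀ p₀ e p = p₀ *ₚ W e p +ₚ scale (- 1ℤ) (p *ₚ W e₀ p₀)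

      ev-reduce : ∀ e₀ p₀ e p X → ev (reduce e₀ p₀ e p) X ≈ ev p₀ X ⊗ ev (W e p) X ⊕ ⊖ (ev p X ⊗ ev (W e₀ p₀) X)
      ev-reduce e₀ p₀ e p X = ≈trans (ev-+ (p₀ *ₚ W e p) _ X) (⊕-cong (ev-* p₀ (W e p) X)
        (≈trans (ev-scale (- 1ℤ) (p *ₚ W e₀ p₀) X) (≈trans (⊗-cong ≈refl (ev-* p (W e₀ p₀) X))
          (solveₛ 2 (λ p w → :c (- 1ℤ) :* (p :* w) := :- (p :* w)) ≈refl (ev p X) (ev (W e₀ p₀) X)))))

      total-reduce : ∀ {n} e₀ p₀ (e : Fin n → Fin r → ℕ) p →
        con Q ⊗ total e (λ i → reduce e₀ p₀ (e i) (p i)) ≈ ev p₀ Y ⊗ D (total e p) ⊕ ⊖ (con Q ⊗ ev (W e₀ p₀) Y ⊗ total e p)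
      total-reduce {zero}  e₀ p₀ e p = ≈trans
        (solveₛ 5 (λ Q P q M W → Q :* :c 0ℤ := P :* (q :* M :* :c 0ℤ) :+ :- (Q :* W :* :c 0ℤ)) ≈refl (con Q) (ev p₀ Y) (con (+ q)) (ev (M h) Y) (ev (W e₀ p₀) Y))
        (⊕-cong (⊗-cong ≈refl (⊗-cong ≈refl (≈sym (∂-con 0ℤ)))) ≈refl)
      total-reduce {suc n} e₀ p₀ e p = ≈trans
        (solveₛ 3 (λ Q a b → Q :* (a :+ b) := Q :* a :+ Q :* b) ≈refl (con Q) (ev (reduce e₀ p₀ (e zero) (p zero)) Y ⊗ μ) _)
        (≈trans (⊕-cong
          (≈trans (⊗-cong ≈refl (⊗-cong (ev-reduce e₀ p₀ (e zero) (p zero) Y) ≈refl))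
            (≈trans (solveₛ 6 (λ Q P₀ W P W₀ μ → Q :* ((P₀ :* W :+ :- (P :* W₀)) :* μ) := P₀ :* (Q :* (W :* μ)) :+ :- (Q :* W₀ :* (P :* μ)))
              ≈refl (con Q) (ev p₀ Y) (ev (W (e zero) (p zero)) Y) (ev (p zero) Y) (ev (W e₀ p₀) Y) μ)
              (⊕-cong (⊗-cong ≈refl (≈sym (D-term (e zero) (p zero)))) ≈refl)))
          (total-reduce e₀ p₀ (e ∘ suc) (p ∘ suc)))
        (≈trans (solveₛ 8 (λ P₀ q M a b W s t → (P₀ :* (q :* M :* a) :+ :- (W :* s)) :+ (P₀ :* (q :* M :* b) :+ :- (W :* t)) := P₀ :* (q :* M :* (a :+ b)) :+ :- (W :* (s :+ t)))
            ≈refl (ev p₀ Y) (con (+ q)) (ev (M h) Y) (∂ (ev (p zero) Y ⊗ μ)) (∂ (total (e ∘ suc) (p ∘ suc)))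
            (con Q ⊗ ev (W e₀ p₀) Y) (ev (p zero) Y ⊗ μ) (total (e ∘ suc) (p ∘ suc)))
          (⊕-cong (⊗-cong ≈refl (⊗-cong ≈refl (≈sym (∂-⊕ (ev (p zero) Y ⊗ μ) (total (e ∘ suc) (p ∘ suc)))))) ≈refl)))
        where
        μ = mono ψ (e zero)

      module _ (Q≢0 : Q ≢ 0ℤ) (h-injective : Injective _≡_ _≡_ h) where

        -- `reduce` is a Wronskian: if it vanishes, p ψ^e / (p₀ ψ^e₀) is constant. But at y = - h k
        -- the order of this quotient would be ord p - ord p₀ + (e k - e₀ k) / q, which is not an
        -- integer and so not 0. Only polynomials are expanded at this point, never the ramified
        -- root itself.
        reduce-Zero : ∀ {e₀ p₀ e p} k → e₀ k < q → e k < q → e₀ k ≢ e k → ¬ Zero p₀ → Zero (reduce e₀ p₀ e p) → Zero p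
        reduce-Zero {e₀} {p₀} {e} {p} k e₀<q e<q e₀≢e p₀≢0 red = ev-injective (- h k) 1ℤ (λ ()) p (⇒≈0 λ a →
          decidable-stable (coef P a ≟ 0ℤ) λ Pa≢0 → p₀≢0 (ev-injective (- h k) 1ℤ (λ ()) p₀ (⇒≈0 λ b →
            decidable-stable (coef P₀ b ≟ 0ℤ) λ P₀b≢0 → Pa≢0 (vanish a b {κ} {P} {P₀} κ≢0 relation P₀b≢0))))
          where
          X P P₀ : Series
          X  = con (- h k) ⊕ con 1ℤ ⊗ z
          P  = ev p X
          P₀ = ev p₀ X
          X+h≈z : X ⊕ con (h k) ≈ z
          X+h≈z = ≈trans (⊕-cong (⊕-cong (con-⊖ (h k)) ≈refl) ≈refl) (solveₛ 2 (λ h z → :- h :+ :c 1ℤ :* z :+ h := z) ≈refl (con (h k)) z)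
          ∂X : ∂ X ≈ con 1ℤ
          ∂X = ∂-linear (- h k) 1ℤ
          local = localise h h-injective k X X+h≈z
          N = proj₁ local
          M≈ = proj₁ (proj₂ (proj₂ local))
          G₁ = proj₁ (proj₂ (proj₂ (proj₂ local)) e)
          G₀ = proj₁ (proj₂ (proj₂ (proj₂ local)) e₀)
          Λ₁≈ = proj₂ (proj₂ (proj₂ (proj₂ local)) e)
          Λ₀≈ = proj₂ (proj₂ (proj₂ (proj₂ local)) e₀)
          κ : ℤ
          κ = + e k - + e₀ k
          open Ramification q N (G₀ ⊕ ⊖ G₁) (proj₁ (proj₂ local))
          κ≢0 : κ ≢0mod-q
          κ≢0 = residues-differ e<q e₀<q (λ eq → e₀≢e (sym eq))
          ∂P≈ : ∀ p → ∂ (ev p X) ≈ ev (der p) X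
          ∂P≈ p = ≈trans (∂-ev p X) (≈trans (⊗-cong ∂X ≈refl) (solveₛ 1 (λ x → :c 1ℤ :* x := x) ≈refl (ev (der p) X)))
          expanded : P₀ ⊗ (con (+ q) ⊗ (z ⊗ N) ⊗ ∂ P ⊕ (con (+ e k) ⊗ N ⊕ z ⊗ G₁) ⊗ P)
            ⊕ ⊖ (P ⊗ (con (+ q) ⊗ (z ⊗ N) ⊗ ∂ P₀ ⊕ (con (+ e₀ k) ⊗ N ⊕ z ⊗ G₀) ⊗ P₀)) ≈ con 0ℤ
          expanded = ≈trans (≈sym (≈trans (ev-reduce e₀ p₀ e p X) (⊕-cong
            (⊗-cong ≈refl (≈trans (ev-W e p X) (⊕-cong (⊗-cong (⊗-cong ≈refl M≈) (≈sym (∂P≈ p))) (⊗-cong Λ₁≈ ≈refl))))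
            (⊖-cong (⊗-cong ≈refl (≈trans (ev-W e₀ p₀ X) (⊕-cong (⊗-cong (⊗-cong ≈refl M≈) (≈sym (∂P≈ p₀))) (⊗-cong Λ₀≈ ≈refl))))))))
            (ev-Zero X red)
          relation : Relation κ P P₀
          relation = ≈trans
            (≈trans (⊗-cong ≈refl (⊕-cong ≈refl (⊗-cong (⊗-cong (≈trans (con-⊕ (+ e k) (- + e₀ k)) (⊕-cong ≈refl (con-⊖ (+ e₀ k)))) ≈refl) ≈refl)))
              (solveₛ 11 (λ N q P₀ z P′ P P₀′ e e₀ G₁ G₀ →
                N :* (q :* (P₀ :* (z :* P′) :+ :- (P :* (z :* P₀′))) :+ (e :+ :- e₀) :* P :* P₀) :=
                (P₀ :* (q :* (z :* N) :* P′ :+ (e :* N :+ z :* G₁) :* P) :+ :- (P :* (q :* (z :* N) :* P₀′ :+ (e₀ :* N :+ z :* G₀) :* P₀)))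
                  :+ z :* (G₀ :+ :- G₁) :* P :* P₀)
                ≈refl N (con (+ q)) P₀ z (∂ P) P (∂ P₀) (con (+ e k)) (con (+ e₀ k)) G₁ G₀))
            (≈trans (⊕-cong expanded ≈refl) (solveₛ 1 (λ x → :c 0ℤ :+ x := x) ≈refl _))

        -- Induction on the number of terms. The operator behind `reduce` removes the first term; by
        -- induction the reduced coefficients vanish, so by `reduce-Zero` the later coefficients
        -- vanish, and with them the first.
        independent : ∀ {n} (e : Fin n → Fin r → ℕ) p → (∀ i k → e i k < q) → (∀ {i j} → (∀ k → e i k ≡ e j k) → i ≡ j) →
          total e p ≈ con 0ℤ → ∀ i → Zero (p i)
        independent {suc n} e p e<q distinct rel = λ { zero → head-Zero ; (suc i) → tail-Zero i }
          where
          tail-independent : ∀ p → total (e ∘ suc) p ≈ con 0ℤ → ∀ i → Zero (p i)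
          tail-independent p = independent (e ∘ suc) p (e<q ∘ suc) (λ eq → suc-injective (distinct eq))
          tail-Zero : ∀ i → Zero (p (suc i))
          tail-Zero with zero? (p zero)
          ... | yes p₀≡0 = tail-independent (p ∘ suc) (≈trans (≈trans
              (solveₛ 2 (λ μ t → t := :c 0ℤ :* μ :+ t) ≈refl (mono ψ (e zero)) (total (e ∘ suc) (p ∘ suc)))
              (⊕-cong (⊗-cong (≈sym (ev-Zero Y p₀≡0)) ≈refl) ≈refl)) rel)
          ... | no p₀≢0 = λ i → differ i (any? (λ k → ¬? (e zero k ℕ.≟ e (suc i) k)))
            where
            reduced : Fin (suc n) → Poly
            reduced i = reduce (e zero) (p zero) (e i) (p i)
            total-reduced : total (e ∘ suc) (reduced ∘ suc) ≈ con 0ℤ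
            total-reduced = cancel 0 (con Q) Q≢0 (≈trans (≈trans
              (⊗-cong ≈refl (≈trans (solveₛ 3 (λ a μ t → t := (a :+ :- a) :* μ :+ t) ≈refl (ev (p zero) Y ⊗ ev (W (e zero) (p zero)) Y) (mono ψ (e zero)) _)
                (⊕-cong (⊗-cong (≈sym (ev-reduce (e zero) (p zero) (e zero) (p zero) Y)) ≈refl) ≈refl)))
              (total-reduce (e zero) (p zero) e p))
              (≈trans (⊕-cong (⊗-cong ≈refl (⊗-cong ≈refl (≈trans (∂-cong rel) (∂-con 0ℤ)))) (⊖-cong (⊗-cong ≈refl rel)))
                (solveₛ 5 (λ P q M Q W → P :* (q :* M :* :c 0ℤ) :+ :- (Q :* W :* :c 0ℤ) := Q :* :c 0ℤ) ≈refl
                  (ev (p zero) Y) (con (+ q)) (ev (M h) Y) (con Q) (ev (W (e zero) (p zero)) Y))))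
            differ : ∀ i → Dec (∃ λ k → e zero k ≢ e (suc i) k) → Zero (p (suc i))
            differ i (yes (k , e₀≢e)) = reduce-Zero {e₀ = e zero} {p zero} {e (suc i)} k (e<q zero k) (e<q (suc i) k) e₀≢e p₀≢0
              (tail-independent (reduced ∘ suc) total-reduced i)
            differ i (no same) = contradiction
              (distinct {zero} {suc i} (λ k → decidable-stable (e zero k ℕ.≟ e (suc i) k) (λ ne → same (k , ne)))) λ ()
          head-Zero : Zero (p zero)
          head-Zero = ev-injective y₀ Q Q≢0 (p zero) (cancel 0 (mono ψ (e zero)) (coef-mono-0 ψ (e zero) ψ₀≢0)
            (≈trans (≈trans (solveₛ 2 (λ a b → a :* b := b :* a :+ :c 0ℤ) ≈refl (mono ψ (e zero)) (ev (p zero) Y))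
              (⊕-cong ≈refl (≈sym tail-total)))
              (≈trans rel (solveₛ 1 (λ μ → :c 0ℤ := μ :* :c 0ℤ) ≈refl (mono ψ (e zero))))))
            where
            zeros : ∀ {n} (f : Fin n → Series) → (∀ i → f i ≈ con 0ℤ) → Σs.sum f ≈ con 0ℤ
            zeros {zero}  f z = ≈refl
            zeros {suc n} f z = ≈trans (⊕-cong (z zero) (zeros (f ∘ suc) (z ∘ suc))) (≈sym (con-⊕ 0ℤ 0ℤ))
            tail-total : total (e ∘ suc) (p ∘ suc) ≈ con 0ℤ
            tail-total = zeros _ λ i → ≈trans (⊗-cong (ev-Zero Y (tail-Zero i)) ≈refl)
              (solveₛ 1 (λ μ → :c 0ℤ :* μ := :c 0ℤ) ≈refl (mono ψ (e (suc i))))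

-- Elimination: from a relation between roots to a polynomial in y

module Elimination where

  open Series
  open Root using (_^_)
  open Polynomial
  open Independence

  open Dependence using (dependent) renaming (sum-cong to sumℤ-cong)
  open import Data.Fin using (Fin; zero; suc; toℕ; fromℕ<; join; splitAt; _↑ˡ_; _↑ʳ_; combine; remQuot; finToFun; funToFin)
  open import Data.Fin.Properties using (toℕ-fromℕ<; toℕ<n; toℕ-injective; splitAt-↑ˡ; splitAt-↑ʳ; remQuot-combine; combine-remQuot; join-splitAt; finToFun-funToFin)
  open import Data.Integer using (ℤ; +_; 0ℤ; 1ℤ; _+_; _*_; _≟_)
  import Data.Integer.Properties as ℤ
  open import Data.List using ([]; _∷_; length; tabulate; replicate; _++_)
  open import Data.List.Properties using (length-tabulate; length-++; length-replicate)
  open import Data.List.Relation.Unary.All using ([]; _∷_)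
  open import Data.List.Relation.Unary.All.Properties using (tabulate⁻)
  open import Data.Nat as ℕ using (ℕ; zero; suc; _≤_; _<_; s≤s; _∸_)
  import Data.Nat.Properties as ℕ
  open import Data.Product using (proj₁; proj₂)
  open import Data.Sum using (_⊎_; inj₁; inj₂)
  open import Function using (Injective; _∘_)
  open import Relation.Binary.PropositionalEquality
  open import Relation.Nullary using (¬_; yes; no)
  open import Relation.Nullary.Decidable using (decidable-stable)

  open Σs using (sum; sum-cong-≋; ∑-comm; *-distribˡ-sum; *-distribʳ-sum)

  finToFun-injective : ∀ {m n} (x y : Fin (n ℕ.^ m)) → (∀ i → finToFun {n} {m} x i ≡ finToFun y i) → x ≡ y
  finToFun-injective {zero}      zero zero _ = refl
  finToFun-injective {suc m} {n} x y p = trans (sym (combine-remQuot {n} (n ℕ.^ m) x))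
    (trans (cong₂ combine (p zero) (finToFun-injective _ _ (p ∘ suc))) (combine-remQuot {n} (n ℕ.^ m) y))

  sum-zeros : ∀ {n} (f : Fin n → Series) → (∀ i → f i ≈ con 0ℤ) → sum f ≈ con 0ℤ
  sum-zeros {zero}  f z = ≈refl
  sum-zeros {suc n} f z = ≈trans (⊕-cong (z zero) (sum-zeros (f ∘ suc) (z ∘ suc))) (≈sym (con-⊕ 0ℤ 0ℤ))

  sum-splitAt : ∀ a {b} (f : Fin (a ℕ.+ b) → Series) → sum f ≈ sum (λ i → f (i ↑ˡ b)) ⊕ sum (λ j → f (a ↑ʳ j))
  sum-splitAt zero    f = solveₛ 1 (λ s → s := :c 0ℤ :+ s) ≈refl (sum f)
  sum-splitAt (suc a) f = ≈trans (⊕-cong ≈refl (sum-splitAt a (f ∘ suc)))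
    (solveₛ 3 (λ x s t → x :+ (s :+ t) := x :+ s :+ t) ≈refl (f zero) _ _)

  sum-combine : ∀ a b (f : Fin (a ℕ.* b) → Series) → sum f ≈ sum (λ i → sum (λ j → f (combine {a} i j)))
  sum-combine zero    b f = ≈refl
  sum-combine (suc a) b f = ≈trans (sum-splitAt b f) (⊕-cong ≈refl (sum-combine a b (λ i → f (b ↑ʳ i))))

  pick : ∀ {n} → Fin n → Fin n → ℤ → ℤ
  pick zero    zero    c = c
  pick zero    (suc _) c = 0ℤ
  pick (suc _) zero    c = 0ℤ
  pick (suc i) (suc j) c = pick i j c

  sum-pick : ∀ {n} (i : Fin n) c (f : Fin n → Series) → sum (λ j → con (pick i j c) ⊗ f j) ≈ con c ⊗ f i
  sum-pick zero    c f = ≈trans (⊕-cong ≈refl (sum-zeros _ λ j → solveₛ 1 (λ x → :c 0ℤ :* x := :c 0ℤ) ≈refl (f (suc j))))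
    (solveₛ 1 (λ x → x :+ :c 0ℤ := x) ≈refl (con c ⊗ f zero))
  sum-pick (suc i) c f = ≈trans (⊕-cong ≈refl (sum-pick i c (f ∘ suc)))
    (solveₛ 2 (λ x y → :c 0ℤ :* y :+ x := x) ≈refl (con c ⊗ f (suc i)) (f zero))

  mono-cong : ∀ {r} (u : Fin r → Series) {e e′} → (∀ i → e i ≡ e′ i) → mono u e ≈ mono u e′
  mono-cong {zero}  u p = ≈refl
  mono-cong {suc r} u p = ⊗-cong (≡⇒≈ (cong (u zero ^_) (p zero))) (mono-cong (u ∘ suc) (p ∘ suc))

  mono-0 : ∀ {r} (u : Fin r → Series) e → (∀ i → e i ≡ 0) → mono u e ≈ con 1ℤ
  mono-0 {zero}  u e p = ≈refl
  mono-0 {suc r} u e p = ≈trans (⊗-cong (≡⇒≈ (cong (u zero ^_) (p zero))) (mono-0 (u ∘ suc) (e ∘ suc) (p ∘ suc)))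
    (≈sym (con-⊗ 1ℤ 1ℤ))

  ^-+ : ∀ f a b → f ^ a ⊗ f ^ b ≈ f ^ (a ℕ.+ b)
  ^-+ f zero    b = solveₛ 1 (λ x → :c 1ℤ :* x := x) ≈refl (f ^ b)
  ^-+ f (suc a) b = ≈trans (solveₛ 3 (λ f x y → f :* x :* y := f :* (x :* y)) ≈refl f (f ^ a) (f ^ b)) (⊗-cong ≈refl (^-+ f a b))

  shift : ℕ → Poly → Poly
  shift j p = replicate j 0ℤ ++ p

  ev-shift : ∀ j p Y → ev (shift j p) Y ≈ Y ^ j ⊗ ev p Y
  ev-shift zero    p Y = solveₛ 1 (λ x → x := :c 1ℤ :* x) ≈refl (ev p Y)
  ev-shift (suc j) p Y = ≈trans (⊕-cong ≈refl (⊗-cong ≈refl (ev-shift j p Y)))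
    (solveₛ 3 (λ y yʲ p → :c 0ℤ :+ y :* (yʲ :* p) := y :* yʲ :* p) ≈refl Y (Y ^ j) (ev p Y))

  ev-tabulate : ∀ {n} (f : Fin n → ℤ) Y → ev (tabulate f) Y ≈ sum (λ j → con (f j) ⊗ Y ^ toℕ j)
  ev-tabulate {zero}  f Y = ≈refl
  ev-tabulate {suc n} f Y = ⊕-cong (solveₛ 1 (λ x → x := x :* :c 1ℤ) ≈refl (con (f zero)))
    (≈trans (⊗-cong ≈refl (ev-tabulate (f ∘ suc) Y)) (≈trans (*-distribˡ-sum Y (λ j → con (f (suc j)) ⊗ Y ^ toℕ j))
      (sum-cong-≋ λ j → solveₛ 3 (λ y c p → y :* (c :* p) := c :* (y :* p)) ≈refl Y (con (f (suc j))) (Y ^ toℕ j))))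

  module Reduction (q : ℕ) where

    -- Addition of base-q digits. The second alternative is the one in which u^q = y + h is used and
    -- contributes a factor y + h.
    record Carry (a b : ℕ) : Set where
      constructor carries
      field
        digit : Fin q
        eq    : (a ℕ.+ b ≡ toℕ digit) ⊎ (a ℕ.+ b ≡ q ℕ.+ toℕ digit)
    open Carry

    carry : ∀ (a b : Fin q) → Carry (toℕ a) (toℕ b)
    carry a b with (toℕ a ℕ.+ toℕ b) ℕ.<? q
    ... | yes <q = carries (fromℕ< <q) (inj₁ (sym (toℕ-fromℕ< <q)))
    ... | no ≮q = carries (fromℕ< small) (inj₂ (trans (sym (ℕ.m+[n∸m]≡n (ℕ.≮⇒≥ ≮q))) (cong (q ℕ.+_) (sym (toℕ-fromℕ< small)))))
      where
      small : toℕ a ℕ.+ toℕ b ∸ q < q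
      small = ℕ.+-cancelˡ-< q _ _ (subst (_< q ℕ.+ q) (sym (ℕ.m+[n∸m]≡n (ℕ.≮⇒≥ ≮q))) (ℕ.+-mono-< (toℕ<n a) (toℕ<n b)))

    add : ∀ {r} → (Fin r → Fin q) → (Fin r → Fin q) → Fin r → Fin q
    add a b i = digit (carry (a i) (b i))

    times : ∀ {x y} → Carry x y → ℤ → Poly → Poly
    times c h p with eq c
    ... | inj₁ _ = p
    ... | inj₂ _ = timesLinear h p

    -- The cofactor that arises when ψ^a ψ^b is rewritten with all exponents below q. It has at most
    -- r linear factors, whence the excess r in the degree bounds below.
    carried : ∀ {r} → (Fin r → ℤ) → (Fin r → Fin q) → (Fin r → Fin q) → Poly
    carried {zero}  h a b = 1ℤ ∷ []
    carried {suc r} h a b = times (carry (a zero) (b zero)) (h zero) (carried (h ∘ suc) (a ∘ suc) (b ∘ suc))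

    length-carried : ∀ {r} h a b → length (carried {r} h a b) ≤ suc r
    length-carried {zero}  h a b = ℕ.≤-refl
    length-carried {suc r} h a b with eq (carry (a zero) (b zero))
    ... | inj₁ _ = ℕ.m≤n⇒m≤1+n (length-carried (h ∘ suc) (a ∘ suc) (b ∘ suc))
    ... | inj₂ _ = ℕ.≤-trans (length-timesLinear (h zero) (carried (h ∘ suc) (a ∘ suc) (b ∘ suc))) (s≤s (length-carried (h ∘ suc) (a ∘ suc) (b ∘ suc)))

    ev-times : ∀ {x y} (c : Carry x y) h p u Y → u ^ q ≈ Y ⊕ con h → u ^ (x ℕ.+ y) ⊗ ev p Y ≈ ev (times c h p) Y ⊗ u ^ toℕ (digit c)
    ev-times c h p u Y uq with eq c
    ... | inj₁ e = ≈trans (⊗-comm _ _) (⊗-cong ≈refl (≡⇒≈ (cong (u ^_) e)))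
    ... | inj₂ e = ≈trans (⊗-cong (≈trans (≡⇒≈ (cong (u ^_) e)) (≈trans (≈sym (^-+ u q (toℕ (digit c)))) (⊗-cong uq ≈refl))) ≈refl)
      (≈trans (solveₛ 3 (λ y v p → y :* v :* p := y :* p :* v) ≈refl (Y ⊕ con h) (u ^ toℕ (digit c)) (ev p Y))
        (⊗-cong (≈sym (ev-timesLinear h p Y)) ≈refl))

    mono-add : ∀ {r} h (u : Fin r → Series) Y a b → (∀ i → u i ^ q ≈ Y ⊕ con (h i)) →
      mono u (toℕ ∘ a) ⊗ mono u (toℕ ∘ b) ≈ ev (carried h a b) Y ⊗ mono u (toℕ ∘ add a b)
    mono-add {zero}  h u Y a b uq = solveₛ 1 (λ y → :c 1ℤ :* :c 1ℤ := (:c 1ℤ :+ y :* :c 0ℤ) :* :c 1ℤ) ≈refl Y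
    mono-add {suc r} h u Y a b uq = ≈trans
      (solveₛ 4 (λ x x′ y y′ → x :* x′ :* (y :* y′) := x :* y :* (x′ :* y′)) ≈refl _ _ _ _)
      (≈trans (⊗-cong (^-+ (u zero) (toℕ (a zero)) (toℕ (b zero))) (mono-add (h ∘ suc) (u ∘ suc) Y (a ∘ suc) (b ∘ suc) (uq ∘ suc)))
      (≈trans (solveₛ 3 (λ x y z → x :* (y :* z) := x :* y :* z) ≈refl _ _ _)
      (≈trans (⊗-cong (ev-times (carry (a zero) (b zero)) (h zero) _ (u zero) Y (uq zero)) ≈refl)
        (solveₛ 3 (λ x y z → x :* y :* z := x :* (y :* z)) ≈refl _ _ _))))

  -- A substitute for the norm of X = ∑ c_e ψ^e. Multipliers Z_f with F coefficients each and a
  -- polynomial P with F + r coefficients, subject to X ∑ Z_f ψ^f + P = 0, are D F + F + r unknowns;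
  -- comparing coefficients of each ψ^g gives D (F + r) linear conditions. The choice F = D r leaves
  -- r more unknowns than conditions.
  module Eliminate (q′ r : ℕ) (h : Fin r → ℤ) (c : Fin (suc q′ ℕ.^ r) → ℤ) where

    q D F : ℕ
    q = suc q′
    D = q ℕ.^ r
    F = D ℕ.* r

    open Reduction q

    digits : Fin D → Fin r → Fin q
    digits x = finToFun {q} {r} x

    expo : Fin D → Fin r → ℕ
    expo x i = toℕ (digits x i)

    expo<q : ∀ x i → expo x i < q
    expo<q x i = toℕ<n (digits x i)

    expo-injective : ∀ {x y} → (∀ i → expo x i ≡ expo y i) → x ≡ y
    expo-injective {x} {y} p = finToFun-injective {r} {q} x y (λ i → toℕ-injective (p i))

    X : (Fin r → Series) → Series
    X u = sum (λ e → con (c e) ⊗ mono u (expo e))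

    private
      index : Fin D → Fin D → Fin D
      index e f = funToFin {r} {q} (add (digits e) (digits f))

      m : Fin D → Fin D → Poly
      m e f = carried h (digits e) (digits f)

      g₀ : Fin D
      g₀ = funToFin {r} {q} (λ _ → zero)

      -- The coordinates of y^j ψ^f X with respect to the ψ^g, after reduction of the exponents;
      -- `row₂` holds those of y^k.
      row₁ : Fin D → Fin F → Fin D → Poly
      row₁ f j g = combineₚ (λ e → pick (index e f) g (c e)) (λ e → shift (toℕ j) (m e f))

      row₂ : Fin (F ℕ.+ r) → Fin D → Poly
      row₂ k g = scale (pick g₀ g 1ℤ) (shift (toℕ k) (1ℤ ∷ []))

      row : Fin (D ℕ.* F) ⊎ Fin (F ℕ.+ r) → Fin D → Poly
      row (inj₁ x) = row₁ (proj₁ (remQuot {D} F x)) (proj₂ (remQuot {D} F x))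
      row (inj₂ k) = row₂ k

      length-shift : ∀ j p → length (shift j p) ≡ j ℕ.+ length p
      length-shift j p = trans (length-++ (replicate j 0ℤ)) (cong (ℕ._+ length p) (length-replicate j))

      length-row : ∀ s g → length (row s g) ≤ F ℕ.+ r
      length-row (inj₁ x) g = length-combine (λ e → pick (index e f) g (c e)) (λ e → shift (toℕ j) (m e f)) (λ e →
        subst (_≤ F ℕ.+ r) (sym (length-shift (toℕ j) (m e f)))
          (ℕ.≤-trans (ℕ.+-monoʳ-≤ (toℕ j) (length-carried h (digits e) (digits f)))
            (subst (_≤ F ℕ.+ r) (sym (ℕ.+-suc (toℕ j) r)) (ℕ.+-monoˡ-≤ r (toℕ<n j)))))
        where
        f = proj₁ (remQuot {D} F x)
        j = proj₂ (remQuot {D} F x)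
      length-row (inj₂ k) g = subst (_≤ F ℕ.+ r)
        (sym (trans (length-scale (pick g₀ g 1ℤ) (shift (toℕ k) (1ℤ ∷ []))) (trans (length-shift (toℕ k) (1ℤ ∷ [])) (ℕ.+-comm (toℕ k) 1))))
        (toℕ<n k)

      vectors : Fin (D ℕ.* F ℕ.+ (F ℕ.+ r)) → Fin (D ℕ.* (F ℕ.+ r)) → ℤ
      vectors i col = coefₚ (row (splitAt (D ℕ.* F) i) (proj₁ (remQuot {D} (F ℕ.+ r) col))) (toℕ (proj₂ (remQuot {D} (F ℕ.+ r) col)))

    module _ (1≤r : 1 ≤ r) where

      private
        enough-rows : D ℕ.* (F ℕ.+ r) < D ℕ.* F ℕ.+ (F ℕ.+ r)
        enough-rows = subst (_< D ℕ.* F ℕ.+ (F ℕ.+ r)) (sym (ℕ.*-distribˡ-+ D F r))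
          (ℕ.+-monoʳ-< (D ℕ.* F) (ℕ.m<m+n (D ℕ.* r) 1≤r))

        relation = dependent (D ℕ.* (F ℕ.+ r)) (D ℕ.* F ℕ.+ (F ℕ.+ r)) vectors enough-rows
        d = proj₁ relation

        d₁ : Fin D → Fin F → ℤ
        d₁ f j = d (combine f j ↑ˡ (F ℕ.+ r))
        d₂ : Fin (F ℕ.+ r) → ℤ
        d₂ k = d ((D ℕ.* F) ↑ʳ k)

      Z : Fin D → Poly
      Z f = tabulate (d₁ f)

      P : Poly
      P = tabulate d₂

      length-P : length P ≡ F ℕ.+ r
      length-P = length-tabulate d₂

      -- The coefficients of all Z and of P together are the nontrivial solution d. Hence P can only
      -- vanish if the multiplier does not.
      nontrivial : (∀ f → Zero (Z f)) → ¬ Zero P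
      nontrivial Z≡0 P≡0 = proj₂ (proj₁ (proj₂ relation)) (subst (λ x → d x ≡ 0ℤ) (join-splitAt (D ℕ.* F) (F ℕ.+ r) i) (all-zero (splitAt (D ℕ.* F) i)))
        where
        i = proj₁ (proj₁ (proj₂ relation))
        all-zero : ∀ s → d (join (D ℕ.* F) (F ℕ.+ r) s) ≡ 0ℤ
        all-zero (inj₁ x) = subst (λ y → d (y ↑ˡ (F ℕ.+ r)) ≡ 0ℤ) (combine-remQuot {D} F x)
          (tabulate⁻ (Z≡0 (proj₁ (remQuot {D} F x))) (proj₂ (remQuot {D} F x)))
        all-zero (inj₂ k) = tabulate⁻ P≡0 k

      private
        combination-Zero : ∀ g → Zero (combineₚ d (λ i → row (splitAt (D ℕ.* F) i) g))
        combination-Zero g = Zero-coefₚ _ (length-combine d _ (λ i → length-row (splitAt (D ℕ.* F) i) g)) λ k k< →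
          trans (coefₚ-combine d (λ i → row (splitAt (D ℕ.* F) i) g) k)
            (trans (sumℤ-cong λ i → cong (d i *_) (sym (entry i k k<)))
              (proj₂ (proj₂ relation) (combine g (fromℕ< k<))))
          where
          entry : ∀ i k (k< : k < F ℕ.+ r) → vectors i (combine g (fromℕ< k<)) ≡ coefₚ (row (splitAt (D ℕ.* F) i) g) k
          entry i k k< = trans (cong (λ x → coefₚ (row (splitAt (D ℕ.* F) i) (proj₁ x)) (toℕ (proj₂ x))) (remQuot-combine g (fromℕ< k<)))
            (cong (coefₚ (row (splitAt (D ℕ.* F) i) g)) (toℕ-fromℕ< k<))

      module _ (u : Fin r → Series) (Y : Series) (u-root : ∀ i → u i ^ q ≈ Y ⊕ con (h i)) where

        private
          μ : Fin D → Series
          μ g = mono u (expo g)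

          E : (Fin D → Poly) → Series
          E w = sum (λ g → ev (w g) Y ⊗ μ g)

          μ-index : ∀ e f → ev (m e f) Y ⊗ μ (index e f) ≈ μ e ⊗ μ f
          μ-index e f = ≈trans (⊗-cong ≈refl (mono-cong u (λ i → cong toℕ (finToFun-funToFin {r} {q} (add (digits e) (digits f)) i))))
            (≈sym (mono-add h u Y (digits e) (digits f) u-root))

          E-row₁ : ∀ f j → E (row₁ f j) ≈ X u ⊗ (Y ^ toℕ j ⊗ μ f)
          E-row₁ f j = ≈trans (sum-cong-≋ λ g → ≈trans (⊗-cong (ev-combine (λ e → pick (index e f) g (c e)) sh Y) ≈refl)
              (≈trans (*-distribʳ-sum (μ g) (λ e → con (pick (index e f) g (c e)) ⊗ ev (sh e) Y))
                (sum-cong-≋ λ e → solveₛ 3 (λ a b c → a :* b :* c := a :* (b :* c)) ≈refl (con (pick (index e f) g (c e))) (ev (sh e) Y) (μ g))))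
            (≈trans (∑-comm (λ g e → con (pick (index e f) g (c e)) ⊗ (ev (sh e) Y ⊗ μ g)))
            (≈trans (sum-cong-≋ λ e → ≈trans (sum-pick (index e f) (c e) (λ g → ev (sh e) Y ⊗ μ g))
                (≈trans (⊗-cong ≈refl (⊗-cong (ev-shift (toℕ j) (m e f) Y) ≈refl))
                (≈trans (solveₛ 4 (λ c y m g → c :* (y :* m :* g) := c :* y :* (m :* g)) ≈refl (con (c e)) (Y ^ toℕ j) (ev (m e f) Y) (μ (index e f)))
                (≈trans (⊗-cong ≈refl (μ-index e f))
                  (solveₛ 4 (λ c y e f → c :* y :* (e :* f) := c :* e :* (y :* f)) ≈refl (con (c e)) (Y ^ toℕ j) (μ e) (μ f))))))
              (≈sym (*-distribʳ-sum (Y ^ toℕ j ⊗ μ f) (λ e → con (c e) ⊗ μ e)))))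
            where
            sh : Fin D → Poly
            sh e = shift (toℕ j) (m e f)

          E-row₂ : ∀ k → E (row₂ k) ≈ Y ^ toℕ k
          E-row₂ k = ≈trans (sum-cong-≋ λ g → ≈trans (⊗-cong (ev-scale (pick g₀ g 1ℤ) (shift (toℕ k) (1ℤ ∷ [])) Y) ≈refl)
              (solveₛ 3 (λ a b c → a :* b :* c := a :* (b :* c)) ≈refl (con (pick g₀ g 1ℤ)) (ev (shift (toℕ k) (1ℤ ∷ [])) Y) (μ g)))
            (≈trans (sum-pick g₀ 1ℤ (λ g → ev (shift (toℕ k) (1ℤ ∷ [])) Y ⊗ μ g))
            (≈trans (⊗-cong ≈refl (⊗-cong (ev-shift (toℕ k) (1ℤ ∷ []) Y) (mono-0 u (expo g₀) λ i → cong toℕ (finToFun-funToFin {r} {q} (λ _ → zero) i))))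
              (solveₛ 2 (λ y yᵏ → :c 1ℤ :* (yᵏ :* (:c 1ℤ :+ y :* :c 0ℤ) :* :c 1ℤ) := yᵏ) ≈refl Y (Y ^ toℕ k))))

          E-combination : sum (λ i → con (d i) ⊗ E (row (splitAt (D ℕ.* F) i))) ≈ con 0ℤ
          E-combination = ≈trans (sum-cong-≋ λ i → ≈trans (*-distribˡ-sum (con (d i)) (λ g → ev (R i g) Y ⊗ μ g))
              (sum-cong-≋ λ g → solveₛ 3 (λ a b c → a :* (b :* c) := a :* b :* c) ≈refl (con (d i)) (ev (R i g) Y) (μ g)))
            (≈trans (∑-comm (λ i g → con (d i) ⊗ ev (R i g) Y ⊗ μ g))
            (sum-zeros _ λ g → ≈trans (≈sym (*-distribʳ-sum (μ g) (λ i → con (d i) ⊗ ev (R i g) Y)))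
              (≈trans (⊗-cong (≈trans (≈sym (ev-combine d (λ i → R i g) Y)) (ev-Zero Y (combination-Zero g))) ≈refl)
                (solveₛ 1 (λ x → :c 0ℤ :* x := :c 0ℤ) ≈refl (μ g)))))
            where
            R : Fin (D ℕ.* F ℕ.+ (F ℕ.+ r)) → Fin D → Poly
            R i = row (splitAt (D ℕ.* F) i)

        -- Z and P were computed from u_i^q = Y + h_i alone, so the identity holds for every choice
        -- of roots over every Y. It is applied both to integer roots at the points and to the power
        -- series ψ.
        eliminated : X u ⊗ sum (λ f → ev (Z f) Y ⊗ μ f) ⊕ ev P Y ≈ con 0ℤ
        eliminated = ≈trans (≈sym (≈trans (sum-splitAt (D ℕ.* F) (λ i → con (d i) ⊗ E (row (splitAt (D ℕ.* F) i))))
            (⊕-cong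
              (≈trans (sum-combine D F (λ x → con (d (x ↑ˡ (F ℕ.+ r))) ⊗ E (row (splitAt (D ℕ.* F) (x ↑ˡ (F ℕ.+ r))))))
              (≈trans (sum-cong-≋ λ f → ≈trans (sum-cong-≋ λ j → part₁ f j)
                  (≈trans (≈sym (*-distribˡ-sum (X u) (λ j → con (d₁ f j) ⊗ Y ^ toℕ j ⊗ μ f)))
                    (⊗-cong ≈refl (≈trans (≈sym (*-distribʳ-sum (μ f) (λ j → con (d₁ f j) ⊗ Y ^ toℕ j)))
                      (⊗-cong (≈sym (ev-tabulate (d₁ f) Y)) ≈refl)))))
                (≈sym (*-distribˡ-sum (X u) (λ f → ev (Z f) Y ⊗ μ f)))))
              (≈trans (sum-cong-≋ part₂) (≈sym (ev-tabulate d₂ Y))))))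
          E-combination
          where
          part₁ : ∀ f j → con (d₁ f j) ⊗ E (row (splitAt (D ℕ.* F) (combine f j ↑ˡ (F ℕ.+ r)))) ≈ X u ⊗ (con (d₁ f j) ⊗ Y ^ toℕ j ⊗ μ f)
          part₁ f j = ≈trans (⊗-cong ≈refl (≈trans
              (≡⇒≈ (trans (cong (λ s → E (row s)) (splitAt-↑ˡ (D ℕ.* F) (combine f j) (F ℕ.+ r)))
                (cong (λ x → E (row₁ (proj₁ x) (proj₂ x))) (remQuot-combine f j)))) (E-row₁ f j)))
            (solveₛ 4 (λ d x y f → d :* (x :* (y :* f)) := x :* (d :* y :* f)) ≈refl (con (d₁ f j)) (X u) (Y ^ toℕ j) (μ f))
          part₂ : ∀ k → con (d ((D ℕ.* F) ↑ʳ k)) ⊗ E (row (splitAt (D ℕ.* F) ((D ℕ.* F) ↑ʳ k))) ≈ con (d₂ k) ⊗ Y ^ toℕ k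
          part₂ k = ⊗-cong ≈refl (≈trans (≡⇒≈ (cong (λ s → E (row s)) (splitAt-↑ʳ (D ℕ.* F) (F ℕ.+ r) k))) (E-row₂ k))

      -- The norm-like polynomial P vanishes on T, hence identically; then X Z = 0 contradicts the independence of the monomials.
      no-relation : ∀ {t} (T : Fin t → ℤ) → Injective _≡_ _≡_ T → F ℕ.+ r ≤ t → (μ : Fin t → Fin r → Series) →
        (∀ i k → μ i k ^ q ≈ con (T i) ⊕ con (h k)) → (∀ i → X (μ i) ≈ con 0ℤ) →
        ∀ y₀ Q → Q ≢ 0ℤ → Injective _≡_ _≡_ h → (ψ : Fin r → Series) → (∀ i → coef (ψ i) 0 ≢ 0ℤ) →
        (∀ i → ψ i ^ q ≈ con y₀ ⊕ con Q ⊗ z ⊕ con (h i)) → ∀ e → c e ≡ 0ℤ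
      no-relation T T-inj F≤t μ μ-root Xμ≈0 y₀ Q Q≢0 h-inj ψ ψ₀≢0 ψ-root e = singleton (independent-ψ (λ e → c e ∷ [])
        (≈trans (sum-cong-≋ λ e → solveₛ 3 (λ c y m → (c :+ y :* :c 0ℤ) :* m := c :* m) ≈refl (con (c e)) Y (mono ψ (expo e))) Xψ≈0) e)
        where
        Y : Series
        Y = con y₀ ⊕ con Q ⊗ z
        singleton : ∀ {a} → Zero (a ∷ []) → a ≡ 0ℤ
        singleton (a≡0 ∷ []) = a≡0
        independent-ψ : ∀ p → sum (λ f → ev (p f) Y ⊗ mono ψ (expo f)) ≈ con 0ℤ → ∀ f → Zero (p f)
        independent-ψ p = Derivation.independent q y₀ Q h ψ ψ₀≢0 ψ-root Q≢0 h-inj expo p expo<q expo-injective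
        P-Zero : Zero P
        P-Zero = many-roots T T-inj P (subst (_≤ _) (sym length-P) F≤t) λ i →
          trans (sym (coef-ev-0 P (con (T i)))) (≈0⇒ (≈trans
            (≈trans (solveₛ 2 (λ p s → p := :c 0ℤ :* s :+ p) ≈refl (ev P (con (T i))) (sum (λ f → ev (Z f) (con (T i)) ⊗ mono (μ i) (expo f))))
              (⊕-cong (⊗-cong (≈sym (Xμ≈0 i)) ≈refl) ≈refl))
            (eliminated (μ i) (con (T i)) (μ-root i))) 0)
        Zψ : Series
        Zψ = sum (λ f → ev (Z f) Y ⊗ mono ψ (expo f))
        XZ≈0 : X ψ ⊗ Zψ ≈ con 0ℤ
        XZ≈0 = ≈trans (≈trans (solveₛ 1 (λ x → x := x :+ :c 0ℤ) ≈refl (X ψ ⊗ Zψ)) (⊕-cong ≈refl (≈sym (ev-Zero Y P-Zero))))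
          (eliminated ψ Y ψ-root)
        Xψ≈0 : X ψ ≈ con 0ℤ
        Xψ≈0 = ⇒≈0 λ a → decidable-stable (coef (X ψ) a ≟ 0ℤ) λ Xa≢0 →
          nontrivial (independent-ψ Z (⇒≈0 (no-zero-divisors a (X ψ) Zψ XZ≈0 Xa≢0))) P-Zero

-- Congruences modulo powers of 2 and 2-adic evaluation

module TwoAdic where

  open Series
  open Root using (_^_)
  open import Data.Integer using (ℤ; +_; 0ℤ; 1ℤ; _+_; _*_; -_; _-_)
    renaming (_^_ to _^ℤ_)
  import Data.Integer.Properties as ℤ
  open import Data.Integer.DivMod using (_%ℕ_; _/ℕ_; a≡a%ℕn+[a/ℕn]*n; n%ℕd<d)
  open import Data.Integer.Tactic.RingSolver using (solve-∀)
  open import Data.Nat as ℕ using (ℕ; zero; suc; _<_; s≤s; z≤n)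
  import Data.Nat.Properties as ℕ
  open import Data.Product using (∃; _,_; proj₁; proj₂)
  open import Data.Sum using (_⊎_; inj₁; inj₂)
  open import Relation.Binary.PropositionalEquality

  infix 4 _≡_[mod_]
  record _≡_[mod_] (a b m : ℤ) : Set where
    constructor by
    field
      multiple : ℤ
      equation : a ≡ b + multiple * m
  open _≡_[mod_] public

  private
    ring₁ : ∀ b m → b ≡ b + 0ℤ * m
    ring₁ = solve-∀
    ring₂ : ∀ b k m → b ≡ b + k * m + - k * m
    ring₂ = solve-∀
    ring₃ : ∀ c k l m → c + l * m + k * m ≡ c + (k + l) * m
    ring₃ = solve-∀
    ring₄ : ∀ a b k l m → (a + k * m) + (b + l * m) ≡ a + b + (k + l) * m
    ring₄ = solve-∀
    ring₅ : ∀ a b k l m → (a + k * m) * (b + l * m) ≡ a * b + (k * b + a * l + k * l * m) * m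
    ring₅ = solve-∀
    ring₆ : ∀ b k s m → b + k * (s * m) ≡ b + k * s * m
    ring₆ = solve-∀
    ring₇ : ∀ t b k m → t * (b + k * m) ≡ t * b + k * (t * m)
    ring₇ = solve-∀

  modrefl : ∀ {a m} → a ≡ a [mod m ]
  modrefl {a} {m} = by 0ℤ (ring₁ a m)

  ≡⇒mod : ∀ {a b m} → a ≡ b → a ≡ b [mod m ]
  ≡⇒mod refl = modrefl

  modsym : ∀ {a b m} → a ≡ b [mod m ] → b ≡ a [mod m ]
  modsym {b = b} {m} (by k refl) = by (- k) (ring₂ b k m)

  modtrans : ∀ {a b c m} → a ≡ b [mod m ] → b ≡ c [mod m ] → a ≡ c [mod m ]
  modtrans {c = c} {m} (by k refl) (by l refl) = by (k + l) (ring₃ c k l m)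

  mod+ : ∀ {a a′ b b′ m} → a ≡ a′ [mod m ] → b ≡ b′ [mod m ] → a + b ≡ a′ + b′ [mod m ]
  mod+ {a′ = a} {b′ = b} {m} (by k refl) (by l refl) = by (k + l) (ring₄ a b k l m)

  mod* : ∀ {a a′ b b′ m} → a ≡ a′ [mod m ] → b ≡ b′ [mod m ] → a * b ≡ a′ * b′ [mod m ]
  mod* {a′ = a} {b′ = b} {m} (by k refl) (by l refl) = by (k * b + a * l + k * l * m) (ring₅ a b k l m)

  mod*ˡ : ∀ c {a b m} → a ≡ b [mod m ] → c * a ≡ c * b [mod m ]
  mod*ˡ c p = mod* (modrefl {c}) p

  mod+ˡ : ∀ c {a b m} → a ≡ b [mod m ] → c + a ≡ c + b [mod m ]
  mod+ˡ c p = mod+ (modrefl {c}) p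

  mod^ : ∀ {a a′ m} k → a ≡ a′ [mod m ] → a ^ℤ k ≡ a′ ^ℤ k [mod m ]
  mod^ zero    p = modrefl
  mod^ (suc k) p = mod* p (mod^ k p)

  mod-weaken : ∀ {a b s m} → a ≡ b [mod s * m ] → a ≡ b [mod m ]
  mod-weaken {b = b} {s} {m} (by k refl) = by (k * s) (ring₆ b k s m)

  mod-times : ∀ t {a b m} → a ≡ b [mod m ] → t * a ≡ t * b [mod t * m ]
  mod-times t {b = b} {m} (by k refl) = by k (ring₇ t b k m)

  -- The partial sum of n terms. At an even t it gives the 2-adic value modulo 2^n.
  evaluate : ℕ → Series → ℤ → ℤ
  evaluate zero    f t = 0ℤ
  evaluate (suc n) f t = coef f 0 + t * evaluate n (tail f) t

  private
    ring₈ : ∀ a b t x y → a + b + t * (x + y) ≡ a + t * x + (b + t * y)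
    ring₈ = solve-∀
    ring₉ : ∀ c a t x → c * a + t * (c * x) ≡ c * (a + t * x)
    ring₉ = solve-∀
    ring₁₀ : ∀ a b t x y → a * b + t * (a * x + y) ≡ a * (b + t * x) + t * y
    ring₁₀ = solve-∀
    ring₁₁ : ∀ a t x y → a * y + t * (x * y) ≡ (a + t * x) * y
    ring₁₁ = solve-∀
    ring₁₂ : ∀ a t → a ≡ a + t * 0ℤ
    ring₁₂ = solve-∀
    ring₁₃ : ∀ n m → n ≡ m + (n - m) * 1ℤ
    ring₁₃ = solve-∀

  evaluate-cong : ∀ n {f g} t → f ≈ g → evaluate n f t ≡ evaluate n g t
  evaluate-cong zero    t p = refl
  evaluate-cong (suc n) t p = cong₂ (λ a x → a + t * x) (at p 0) (evaluate-cong n t (mk≈ λ k → at p (suc k)))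

  evaluate-⊕ : ∀ n f g t → evaluate n (f ⊕ g) t ≡ evaluate n f t + evaluate n g t
  evaluate-⊕ zero    f g t = refl
  evaluate-⊕ (suc n) f g t = trans
    (cong (λ x → coef f 0 + coef g 0 + t * x) (trans (evaluate-cong n t (mk≈ λ _ → refl)) (evaluate-⊕ n (tail f) (tail g) t)))
    (ring₈ (coef f 0) (coef g 0) t _ _)

  evaluate-scale : ∀ n c f t → evaluate n (con c ⊗ f) t ≡ c * evaluate n f t
  evaluate-scale zero    c f t = sym (ℤ.*-zeroʳ c)
  evaluate-scale (suc n) c f t = trans
    (cong (λ x → c * coef f 0 + t * x) (trans (evaluate-cong n t (mk≈ λ k → trans (con⊗ c f (suc k)) (sym (con⊗ c (tail f) k)))) (evaluate-scale n c (tail f) t)))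
    (ring₉ c (coef f 0) t _)

  evaluate-0 : ∀ n t → evaluate n (con 0ℤ) t ≡ 0ℤ
  evaluate-0 zero    t = refl
  evaluate-0 (suc n) t = trans (cong (λ x → 0ℤ + t * x) (trans (evaluate-cong n t (mk≈ λ k → sym (con-0 k))) (evaluate-0 n t)))
    (trans (ℤ.+-identityˡ (t * 0ℤ)) (ℤ.*-zeroʳ t))

  evaluate-con : ∀ n c t → evaluate (suc n) (con c) t ≡ c
  evaluate-con n c t = trans (cong (λ x → c + t * x) (trans (evaluate-cong n t (mk≈ λ k → sym (con-0 k))) (evaluate-0 n t))) (sym (ring₁₂ c t))

  evaluate-linear : ∀ n a Q t → evaluate (suc (suc n)) (con a ⊕ con Q ⊗ z) t ≡ a + Q * t
  evaluate-linear n a Q t = trans (evaluate-⊕ (suc (suc n)) (con a) (con Q ⊗ z) t) (cong₂ _+_ (evaluate-con (suc n) a t)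
    (trans (evaluate-scale (suc (suc n)) Q z t) (cong (Q *_) (trans (ℤ.+-identityˡ _)
      (trans (cong (t *_) (trans (evaluate-cong (suc n) {tail z} {con 1ℤ} t (mk≈ λ { zero → refl ; (suc k) → refl })) (evaluate-con n 1ℤ t))) (ℤ.*-identityʳ t))))))

  evaluate-suc : ∀ n f t → evaluate n f t ≡ evaluate (suc n) f t [mod t ^ℤ n ]
  evaluate-suc zero    f t = by (0ℤ - evaluate 1 f t) (ring₁₃ 0ℤ (evaluate 1 f t))
  evaluate-suc (suc n) f t = mod+ˡ (coef f 0) (mod-times t (evaluate-suc n (tail f) t))

  evaluate-⊗ : ∀ n f g t → evaluate n (f ⊗ g) t ≡ evaluate n f t * evaluate n g t [mod t ^ℤ n ]
  evaluate-⊗ zero    f g t = modrefl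
  evaluate-⊗ (suc n) f g t = modtrans (≡⇒mod (trans
      (cong (λ x → coef f 0 * coef g 0 + t * x) (trans (evaluate-cong n {g = con (coef f 0) ⊗ tail g ⊕ tail f ⊗ g} t
          (mk≈ λ k → cong (_+ coef (tail f ⊗ g) k) (sym (con⊗ (coef f 0) (tail g) k))))
        (trans (evaluate-⊕ n (con (coef f 0) ⊗ tail g) (tail f ⊗ g) t) (cong (_+ evaluate n (tail f ⊗ g) t) (evaluate-scale n (coef f 0) (tail g) t)))))
      (ring₁₀ (coef f 0) (coef g 0) t (evaluate n (tail g) t) (evaluate n (tail f ⊗ g) t))))
    (modtrans (mod+ˡ (coef f 0 * evaluate (suc n) g t) (mod-times t (modtrans (evaluate-⊗ n (tail f) g t) (mod*ˡ (evaluate n (tail f) t) (evaluate-suc n g t)))))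
      (≡⇒mod (ring₁₁ (coef f 0) t (evaluate n (tail f) t) (evaluate (suc n) g t))))

  evaluate-^ : ∀ n f k t → evaluate (suc n) (f ^ k) t ≡ evaluate (suc n) f t ^ℤ k [mod t ^ℤ suc n ]
  evaluate-^ n f zero    t = ≡⇒mod (evaluate-con n 1ℤ t)
  evaluate-^ n f (suc k) t = modtrans (evaluate-⊗ (suc n) f (f ^ k) t) (mod*ˡ (evaluate (suc n) f t) (evaluate-^ n f k t))

  evaluate-vanishing : ∀ n f t m → (∀ k → k < n → coef f k ≡ 0ℤ [mod m ]) → evaluate n f t ≡ 0ℤ [mod m ]
  evaluate-vanishing zero    f t m p = modrefl
  evaluate-vanishing (suc n) f t m p = modtrans
    (mod+ (p 0 (s≤s z≤n)) (mod* (modrefl {t}) (evaluate-vanishing n (tail f) t m (λ k k<n → p (suc k) (s≤s k<n)))))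
    (≡⇒mod (sym (ring₁₂ 0ℤ t)))

  pow2 : ℕ → ℤ
  pow2 n = (+ 2) ^ℤ n

  Odd : ℤ → Set
  Odd a = ∃ λ k → a ≡ 1ℤ + + 2 * k

  private
    ring₁₄ : ∀ a b → (1ℤ + + 2 * a) * (1ℤ + + 2 * b) ≡ 1ℤ + + 2 * (a + b + + 2 * a * b)
    ring₁₄ = solve-∀
    ring₁₅ : ∀ j p → 1ℤ + (+ 2 * j) * p ≡ 1ℤ + j * (+ 2 * p)
    ring₁₅ = solve-∀
    ring₁₆ : ∀ m v p j → (1ℤ + + 2 * m) * v ≡ 1ℤ + (1ℤ + + 2 * j) * p →
      (1ℤ + + 2 * m) * (v + p) ≡ 1ℤ + (1ℤ + j + m) * (+ 2 * p)
    ring₁₆ m v p j e = trans (lem₁ m v p) (trans (cong (_+ (1ℤ + + 2 * m) * p) e) (lem₂ m p j))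
      where
      lem₁ : ∀ m v p → (1ℤ + + 2 * m) * (v + p) ≡ (1ℤ + + 2 * m) * v + (1ℤ + + 2 * m) * p
      lem₁ = solve-∀
      lem₂ : ∀ m p j → 1ℤ + (1ℤ + + 2 * j) * p + (1ℤ + + 2 * m) * p ≡ 1ℤ + (1ℤ + j + m) * (+ 2 * p)
      lem₂ = solve-∀

  parity : ∀ k → (∃ λ j → k ≡ + 2 * j) ⊎ Odd k
  parity k with k %ℕ 2 | n%ℕd<d k 2 | a≡a%ℕn+[a/ℕn]*n k 2
  ... | 0 | _ | e = inj₁ (k /ℕ 2 , trans e (trans (ℤ.+-identityˡ _) (ℤ.*-comm (k /ℕ 2) (+ 2))))
  ... | 1 | _ | e = inj₂ (k /ℕ 2 , trans e (cong (λ x → 1ℤ + x) (ℤ.*-comm (k /ℕ 2) (+ 2))))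
  ... | suc (suc _) | s≤s (s≤s ()) | _

  odd-* : ∀ {a b} → Odd a → Odd b → Odd (a * b)
  odd-* (k , refl) (l , refl) = k + l + + 2 * k * l , ring₁₄ k l

  odd-^ : ∀ {a} n → Odd a → Odd (a ^ℤ n)
  odd-^ zero    o = 0ℤ , refl
  odd-^ (suc n) o = odd-* o (odd-^ n o)

  -- One binary digit at a time: if a v = 1 + k 2^n with k odd, replacing v by v + 2^n adds another
  -- odd multiple of 2^n.
  inverse : ∀ n {a} → Odd a → ∃ λ v → a * v ≡ 1ℤ [mod pow2 n ]
  inverse zero    {a} _ = 0ℤ , by (a * 0ℤ - 1ℤ) (ring₁₃ (a * 0ℤ) 1ℤ)
  inverse (suc n) (m , refl) with inverse n (m , refl)
  ... | v , by k e with parity k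
  ...   | inj₁ (j , refl) = v , by j (trans e (ring₁₅ j (pow2 n)))
  ...   | inj₂ (j , refl) = v + pow2 n , by (1ℤ + j + m) (ring₁₆ m v (pow2 n) j e)

  odd-cancel : ∀ n {a o} → Odd o → a * o ≡ 0ℤ [mod pow2 n ] → a ≡ 0ℤ [mod pow2 n ]
  odd-cancel n {a} {o} odd p with inverse n odd
  ... | v , v-inverse = modtrans (≡⇒mod (sym (ℤ.*-identityʳ a))) (modtrans (mod* (modrefl {a}) (modsym v-inverse))
    (modtrans (≡⇒mod (sym (ℤ.*-assoc a o v))) (modtrans (mod* p (modrefl {v})) (≡⇒mod refl))))

  geometric : ℕ → ℤ → ℤ → ℤ
  geometric zero    a b = 0ℤ
  geometric (suc q) a b = a * geometric q a b + b ^ℤ q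

  geometric-eq : ∀ q a b → a ^ℤ q - b ^ℤ q ≡ (a - b) * geometric q a b
  geometric-eq zero    a b = sym (ℤ.*-zeroʳ (a - b))
  geometric-eq (suc q) a b = trans (lem₁ a b (a ^ℤ q) (b ^ℤ q)) (trans (cong (λ x → a * x + (a - b) * b ^ℤ q) (geometric-eq q a b))
    (lem₂ a b (geometric q a b) (b ^ℤ q)))
    where
    lem₁ : ∀ a b x y → a * x - b * y ≡ a * (x - y) + (a - b) * y
    lem₁ = solve-∀
    lem₂ : ∀ a b g y → a * ((a - b) * g) + (a - b) * y ≡ (a - b) * (a * g + y)
    lem₂ = solve-∀

  -- The sum has q terms, all odd.
  geometric-parity : ∀ q {a b} → Odd a → Odd b → geometric q a b ≡ + q [mod + 2 ]
  geometric-parity zero    _ _ = modrefl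
  geometric-parity (suc q) {a} {b} oa ob = modtrans
    (mod+ (mod* (odd⇒mod oa) (geometric-parity q oa ob)) (odd⇒mod (odd-^ q ob))) (≡⇒mod (lem (+ q)))
    where
    odd⇒mod : ∀ {a} → Odd a → a ≡ 1ℤ [mod + 2 ]
    odd⇒mod (k , e) = by k (trans e (cong (λ x → 1ℤ + x) (ℤ.*-comm (+ 2) k)))
    lem : ∀ q → 1ℤ * q + 1ℤ ≡ 1ℤ + q
    lem = solve-∀

  private
    ring₂₀ : ∀ k l → 1ℤ + + 2 * k + l * + 2 ≡ 1ℤ + + 2 * (k + l)
    ring₂₀ = solve-∀
    ring₂₁ : ∀ b x → b + x - b ≡ 0ℤ + x
    ring₂₁ = solve-∀
    ring₂₂ : ∀ b k → (b + k * + 4) * ((b + k * + 4) * 0ℤ + 1ℤ) + b * 1ℤ ≡ + 2 * (b + + 2 * k)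
    ring₂₂ = solve-∀
    ring₂₃ : ∀ m k → 1ℤ + + 2 * m + + 2 * k ≡ 1ℤ + + 2 * (m + k)
    ring₂₃ = solve-∀
    ring₂₄ : ∀ x h → + 2 * (x * h) ≡ x * (+ 2 * h)
    ring₂₄ = solve-∀
    ring₂₅ : ∀ k p → 0ℤ + k * (+ 2 * p) ≡ + 2 * (0ℤ + k * p)
    ring₂₅ = solve-∀
    ring₂₆ : ∀ a b → a ≡ (a - b) + b
    ring₂₆ = solve-∀

  mod-difference : ∀ {a b m} → a ≡ b [mod m ] → a - b ≡ 0ℤ [mod m ]
  mod-difference {b = b} {m} (by k refl) = by k (ring₂₁ b (k * m))

  mod-difference⁻ : ∀ {a b m} → a - b ≡ 0ℤ [mod m ] → a ≡ b [mod m ]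
  mod-difference⁻ {a} {b} p = modtrans (≡⇒mod (ring₂₆ a b)) (modtrans (mod+ p (modrefl {b})) (≡⇒mod (ℤ.+-identityˡ b)))

  -- For odd q the cofactor of a - b in a^q - b^q is odd and cancels. For q = 2 it is a + b, which
  -- is twice an odd number because a ≡ b modulo 4; this costs the one digit between the two moduli.
  root-unique : ∀ n q {a b} → q ≡ 2 ⊎ Odd (+ q) → Odd a → Odd b → a ≡ b [mod + 4 ] →
    a ^ℤ q ≡ b ^ℤ q [mod pow2 (suc n) ] → a ≡ b [mod pow2 n ]
  root-unique n q {a} {b} (inj₂ (k , q≡)) oa ob a≡b p = mod-difference⁻ (mod-weaken {s = + 2} {pow2 n}
    (odd-cancel (suc n) (k + l , trans (equation parity-q) (trans (cong (_+ l * + 2) q≡) (ring₂₀ k l)))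
      (modtrans (≡⇒mod (sym (geometric-eq q a b))) (mod-difference p))))
    where
    parity-q = geometric-parity q oa ob
    l = multiple parity-q
  root-unique n .2 {a} {b} (inj₁ refl) oa ob a≡b p = mod-difference⁻ (odd-cancel n odd-half (by (multiple product)
    (ℤ.*-cancelˡ-≡ (+ 2) _ _ (trans (ring₂₄ (a - b) half) (trans (cong ((a - b) *_) (sym geometric-2))
      (trans (equation product) (ring₂₅ (multiple product) (pow2 n))))))))
    where
    product : (a - b) * geometric 2 a b ≡ 0ℤ [mod pow2 (suc n) ]
    product = modtrans (≡⇒mod (sym (geometric-eq 2 a b))) (mod-difference p)
    k = multiple a≡b
    half = b + + 2 * k
    odd-half : Odd half
    odd-half = proj₁ ob + k , trans (cong (_+ + 2 * k) (proj₂ ob)) (ring₂₃ (proj₁ ob) k)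
    geometric-2 : geometric 2 a b ≡ + 2 * half
    geometric-2 = trans (cong (λ a → a * (a * 0ℤ + 1ℤ) + b * 1ℤ) (equation a≡b)) (ring₂₂ b k)

-- The 2-adic Bombieri-Pila argument

module Points where

  open Series
  open Root using (_^_; root)
  open Polynomial using (module Σs)
  open Independence using (mono; *≢0)
  open Dependence renaming (sum to sumℤ)
  open Elimination using (module Eliminate; finToFun-injective)
  open TwoAdic
  open import Algebra.Bundles using (CommutativeRing)
  open import Algebra.Properties.CommutativeSemiring.Exp (CommutativeRing.commutativeSemiring ring) using (^-distrib-*)
  open import Data.Empty using (⊥)
  open import Data.Fin using (Fin; zero; suc; toℕ; fromℕ<; finToFun; funToFin)
  open import Data.Fin.Properties using (pigeonhole; finToFun-funToFin; toℕ-fromℕ<; toℕ<n; toℕ-injective; any?; <⇒≢)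
  open import Data.Integer using (ℤ; +_; 0ℤ; 1ℤ; _+_; _*_; -_; _-_; ∣_∣; _≟_) renaming (_^_ to _^ℤ_)
  import Data.Integer.Properties as ℤ
  open import Data.Integer.DivMod using (_%ℕ_; _/ℕ_; a≡a%ℕn+[a/ℕn]*n; n%ℕd<d)
  open import Data.Integer.Tactic.RingSolver using (solve-∀)
  open import Data.Nat as ℕ using (ℕ; zero; suc; _≤_; _<_; s≤s; z≤n; NonZero)
  import Data.Nat.Properties as ℕ
  import Data.Nat.Divisibility as ℕ
  open import Data.Product using (∃; _×_; _,_; proj₁; proj₂)
  open import Data.Sum using (_⊎_; inj₁; inj₂)
  open import Function using (Injective; _∘_)
  open import Relation.Binary.PropositionalEquality
  open import Relation.Nullary using (yes; no; contradiction; ¬?)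
  open import Relation.Nullary.Decidable using (decidable-stable)

  open Σs using (sum; sum-cong-≋)

  ∣^∣ : ∀ a n → ∣ a ^ℤ n ∣ ≡ ∣ a ∣ ℕ.^ n
  ∣^∣ a zero    = refl
  ∣^∣ a (suc n) = trans (ℤ.abs-* a (a ^ℤ n)) (cong (∣ a ∣ ℕ.*_) (∣^∣ a n))

  pow2≡ : ∀ n → pow2 n ≡ + (2 ℕ.^ n)
  pow2≡ zero    = refl
  pow2≡ (suc n) = trans (cong (+ 2 *_) (pow2≡ n)) (sym (ℤ.pos-* 2 (2 ℕ.^ n)))

  small-multiple : ∀ {v n} → v ≡ 0ℤ [mod pow2 n ] → ∣ v ∣ < 2 ℕ.^ n → v ≡ 0ℤ
  small-multiple {v} {n} (by k e) v< = decidable-stable (v ≟ 0ℤ) λ v≢0 →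
    ℕ.<⇒≱ v< (ℕ.∣⇒≤ {{ℕ.≢-nonZero (v≢0 ∘ ℤ.∣i∣≡0⇒i≡0)}} (ℕ.divides ∣ k ∣
      (trans (cong ∣_∣ (trans e (trans (ℤ.+-identityˡ (k * pow2 n)) (cong (k *_) (pow2≡ n))))) (ℤ.abs-* k (+ (2 ℕ.^ n))))))

  monoℤ : ∀ {r} → (Fin r → ℤ) → (Fin r → ℕ) → ℤ
  monoℤ {zero}  u e = 1ℤ
  monoℤ {suc r} u e = u zero ^ℤ e zero * monoℤ (u ∘ suc) (e ∘ suc)

  con-^ : ∀ a k → con a ^ k ≈ con (a ^ℤ k)
  con-^ a zero    = ≈refl
  con-^ a (suc k) = ≈trans (⊗-cong ≈refl (con-^ a k)) (≈sym (con-⊗ a (a ^ℤ k)))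

  mono-con : ∀ {r} (u : Fin r → ℤ) e → mono (con ∘ u) e ≈ con (monoℤ u e)
  mono-con {zero}  u e = ≈refl
  mono-con {suc r} u e = ≈trans (⊗-cong (con-^ (u zero) (e zero)) (mono-con (u ∘ suc) (e ∘ suc))) (≈sym (con-⊗ (u zero ^ℤ e zero) (monoℤ (u ∘ suc) (e ∘ suc))))

  -- As e i < q, each factor is at most the full q-th power, hence at most 2^K. The bound of K r
  -- bits is thus uniform in q.
  monoℤ-bound : ∀ {r} q K (u : Fin r → ℤ) e → (∀ i → u i ≢ 0ℤ) → (∀ i → e i < q) → (∀ i → ∣ u i ^ℤ q ∣ ≤ 2 ℕ.^ K) →
    ∣ monoℤ u e ∣ ≤ (2 ℕ.^ K) ℕ.^ r
  monoℤ-bound {zero}  q K u e _ _ _ = ℕ.≤-refl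
  monoℤ-bound {suc r} q K u e u≢0 e<q bound = subst (_≤ (2 ℕ.^ K) ℕ.^ suc r) (sym (ℤ.abs-* (u zero ^ℤ e zero) (monoℤ (u ∘ suc) (e ∘ suc))))
    (ℕ.*-mono-≤ (ℕ.≤-trans (subst₂ _≤_ (sym (∣^∣ (u zero) (e zero))) (sym (∣^∣ (u zero) q))
        (ℕ.^-monoʳ-≤ ∣ u zero ∣ {{ℕ.≢-nonZero (u≢0 zero ∘ ℤ.∣i∣≡0⇒i≡0)}} (ℕ.<⇒≤ (e<q zero)))) (bound zero))
      (monoℤ-bound q K (u ∘ suc) (e ∘ suc) (u≢0 ∘ suc) (e<q ∘ suc) (bound ∘ suc)))

  sum-con : ∀ {n} (f : Fin n → ℤ) → sum (λ i → con (f i)) ≈ con (sumℤ f)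
  sum-con {zero}  f = ≈refl
  sum-con {suc n} f = ≈trans (⊕-cong ≈refl (sum-con (f ∘ suc))) (≈sym (con-⊕ (f zero) (sumℤ (f ∘ suc))))

  sumℤ-bound : ∀ {n} (f : Fin n → ℤ) B → (∀ i → ∣ f i ∣ ≤ B) → ∣ sumℤ f ∣ ≤ n ℕ.* B
  sumℤ-bound {zero}  f B _ = z≤n
  sumℤ-bound {suc n} f B bound = ℕ.≤-trans (ℤ.∣i+j∣≤∣i∣+∣j∣ (f zero) (sumℤ (f ∘ suc)))
    (ℕ.+-mono-≤ (bound zero) (sumℤ-bound (f ∘ suc) B (bound ∘ suc)))

  residue-injective : ∀ m .{{_ : NonZero m}} {a b} → a %ℕ m ≡ b %ℕ m → a ≡ b [mod + m ]
  residue-injective m {a} {b} e = by (a /ℕ m - b /ℕ m) (trans (a≡a%ℕn+[a/ℕn]*n a m) (trans (cong (λ x → + x + a /ℕ m * + m) e)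
    (trans (lem (+ (b %ℕ m)) (a /ℕ m) (b /ℕ m) (+ m)) (cong (_+ (a /ℕ m - b /ℕ m) * + m) (sym (a≡a%ℕn+[a/ℕn]*n b m))))))
    where
    lem : ∀ x u v m → x + u * m ≡ x + v * m + (u - v) * m
    lem = solve-∀

  -- Siegel's lemma
  module Pigeonhole {D} (M : ℕ) .{{_ : NonZero M}} (N : ℕ) (f : Fin D → Series) (M^N<2^D : M ℕ.^ N < 2 ℕ.^ D) where

    value : (Fin D → ℤ) → Series
    value c = sum (λ e → con (c e) ⊗ f e)

    private
      digits : Fin (2 ℕ.^ D) → Fin D → ℤ
      digits b e = + toℕ (finToFun {2} {D} b e)
      residue : ℤ → Fin M
      residue a = fromℕ< (n%ℕd<d a M)
      residues : Fin (2 ℕ.^ D) → Fin N → Fin M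
      residues b k = residue (coef (value (digits b)) (toℕ k))
      code : Fin (2 ℕ.^ D) → Fin (M ℕ.^ N)
      code b = funToFin {N} {M} (residues b)
      collision = pigeonhole M^N<2^D code
      i = proj₁ collision
      j = proj₁ (proj₂ collision)

    c : Fin D → ℤ
    c e = digits i e - digits j e

    ∣c∣≤1 : ∀ e → ∣ c e ∣ ≤ 1
    ∣c∣≤1 e = bound (finToFun {2} {D} i e) (finToFun {2} {D} j e)
      where
      bound : ∀ (a b : Fin 2) → ∣ + toℕ a - + toℕ b ∣ ≤ 1
      bound zero       zero       = z≤n
      bound zero       (suc zero) = ℕ.≤-refl
      bound (suc zero) zero       = ℕ.≤-refl
      bound (suc zero) (suc zero) = z≤n

    c≢0 : ∃ λ e → c e ≢ 0ℤ
    c≢0 with any? (λ e → ¬? (c e ≟ 0ℤ))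
    ... | yes p = p
    ... | no ¬p = contradiction (finToFun-injective {D} {2} i j λ e → toℕ-injective (ℤ.+-injective
            (ℤ.i-j≡0⇒i≡j (digits i e) (digits j e) (decidable-stable (c e ≟ 0ℤ) λ ne → ¬p (e , ne)))))
            (<⇒≢ (proj₁ (proj₂ (proj₂ collision))))

    private
      difference : ∀ {n} (a b : Fin n → ℤ) (f : Fin n → Series) →
        sum (λ e → con (a e - b e) ⊗ f e) ≈ sum (λ e → con (a e) ⊗ f e) ⊕ ⊖ sum (λ e → con (b e) ⊗ f e)
      difference {zero}  a b f = solveₛ 0 (:c 0ℤ := :c 0ℤ :+ :- :c 0ℤ) ≈refl
      difference {suc n} a b f = ≈trans (⊕-cong (⊗-cong (≈trans (con-⊕ (a zero) (- b zero)) (⊕-cong ≈refl (con-⊖ (b zero)))) ≈refl) (difference (a ∘ suc) (b ∘ suc) (f ∘ suc)))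
        (solveₛ 5 (λ a b f s t → (a :+ :- b) :* f :+ (s :+ :- t) := (a :* f :+ s) :+ :- (b :* f :+ t)) ≈refl (con (a zero)) (con (b zero)) (f zero)
          (sum (λ e → con (a (suc e)) ⊗ f (suc e))) (sum (λ e → con (b (suc e)) ⊗ f (suc e))))

      residue-eq : ∀ a b → residue a ≡ residue b → a ≡ b [mod + M ]
      residue-eq a b e = residue-injective M (trans (sym (toℕ-fromℕ< (n%ℕd<d a M))) (trans (cong toℕ e) (toℕ-fromℕ< (n%ℕd<d b M))))

      same-residues : ∀ k → residues i k ≡ residues j k
      same-residues k = trans (sym (finToFun-funToFin {N} {M} (residues i) k))
        (trans (cong (λ x → finToFun {M} {N} x k) (proj₂ (proj₂ (proj₂ collision)))) (finToFun-funToFin {N} {M} (residues j) k))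

    vanishes : ∀ k → k < N → coef (value c) k ≡ 0ℤ [mod + M ]
    vanishes k k<N = subst (λ k → coef (value c) k ≡ 0ℤ [mod + M ]) (toℕ-fromℕ< k<N)
      (modtrans (≡⇒mod (at (difference (digits i) (digits j) f) (toℕ (fromℕ< k<N))))
        (mod-difference (residue-eq (coef (value (digits i)) (toℕ (fromℕ< k<N))) (coef (value (digits j)) (toℕ (fromℕ< k<N))) (same-residues (fromℕ< k<N)))))

  -- There are 2^D vectors with entries 0 and 1, but only 2^(N N) possibilities for N coefficients
  -- modulo 2^N. The difference of two colliding vectors has entries 0 and ±1, so the combination
  -- adds only a factor D to the size estimate.
  small-combination : ∀ {D} N (f : Fin D → Series) → N ℕ.* N < D → ∃ λ (c : Fin D → ℤ) →
    (∃ λ e → c e ≢ 0ℤ) × (∀ e → ∣ c e ∣ ≤ 1) × (∀ k → k < N → coef (sum (λ e → con (c e) ⊗ f e)) k ≡ 0ℤ [mod pow2 N ])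
  small-combination {D} N f N*N<D = c , c≢0 , ∣c∣≤1 , λ k k<N →
    subst (coef (value c) k ≡ 0ℤ [mod_]) (sym (pow2≡ N)) (vanishes k k<N)
    where
    open Pigeonhole (2 ℕ.^ N) {{ℕ.m^n≢0 2 N}} N f
      (subst (_< 2 ℕ.^ D) (sym (ℕ.^-*-assoc 2 N N)) (ℕ.^-monoʳ-< 2 (s≤s (s≤s z≤n)) N*N<D))

  product : ∀ {r} → (Fin r → ℤ) → ℤ
  product {zero}  f = 1ℤ
  product {suc r} f = f zero * product (f ∘ suc)

  cofactor : ∀ {r} (f : Fin r → ℤ) i → ∃ λ Q → f i * Q ≡ product f
  cofactor f zero    = product (f ∘ suc) , refl
  cofactor f (suc i) with cofactor (f ∘ suc) i
  ... | Q , e = f zero * Q , trans (lem (f (suc i)) (f zero) Q) (cong (f zero *_) e)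
    where
    lem : ∀ a b c → a * (b * c) ≡ b * (a * c)
    lem = solve-∀

  odd-product : ∀ {r} (f : Fin r → ℤ) → (∀ i → Odd (f i)) → Odd (product f)
  odd-product {zero}  f o = 0ℤ , refl
  odd-product {suc r} f o = odd-* (o zero) (odd-product (f ∘ suc) (o ∘ suc))

  odd≢0 : ∀ {a} → Odd a → a ≢ 0ℤ
  odd≢0 (k , e) refl = contradiction (ℕ.∣1⇒≡1 (ℕ.divides ∣ - k ∣ (trans (cong ∣_∣ (lem k e)) (trans (ℤ.abs-* (+ 2) (- k)) (ℕ.*-comm 2 ∣ - k ∣))))) λ ()
    where
    lem₂ : ∀ k → 1ℤ ≡ (1ℤ + + 2 * k) + + 2 * (- k)
    lem₂ = solve-∀
    lem : ∀ k → 0ℤ ≡ 1ℤ + + 2 * k → 1ℤ ≡ + 2 * (- k)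
    lem k e = trans (lem₂ k) (trans (cong (_+ + 2 * - k) (sym e)) (ℤ.+-identityˡ (+ 2 * - k)))

  -- the parameter t = 4 s of the point y = y₀ + q² P t ≡ y₀ + 16 w
  parameter : ∀ {q P} N w → q ≡ 2 ⊎ Odd (+ q) → Odd P → ∃ λ s → (+ q * + q * P) * (+ 4 * s) ≡ w * + 16 [mod pow2 N ]
  parameter {P = P} N w (inj₁ refl) odd-P with inverse N odd-P
  ... | v , by k e = v * w , by (+ 16 * w * k) (trans (lem₁ P v w) (trans (cong (λ x → + 16 * w * x) e) (lem₂ w k (pow2 N))))
    where
    lem₁ : ∀ P v w → (+ 2 * + 2 * P) * (+ 4 * (v * w)) ≡ + 16 * w * (P * v)
    lem₁ = solve-∀
    lem₂ : ∀ w k p → + 16 * w * (1ℤ + k * p) ≡ w * + 16 + + 16 * w * k * p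
    lem₂ = solve-∀
  parameter {q} {P} N w (inj₂ odd-q) odd-P with inverse N (odd-* (odd-* odd-q odd-q) odd-P)
  ... | v , by k e = + 4 * (v * w) , by (+ 16 * w * k) (trans (lem₁ (+ q * + q * P) v w) (trans (cong (λ x → + 16 * w * x) e) (lem₂ w k (pow2 N))))
    where
    lem₁ : ∀ o v w → o * (+ 4 * (+ 4 * (v * w))) ≡ + 16 * w * (o * v)
    lem₁ = solve-∀
    lem₂ : ∀ w k p → + 16 * w * (1ℤ + k * p) ≡ w * + 16 + + 16 * w * k * p
    lem₂ = solve-∀

  evaluate-mono : ∀ {r} n m t (f : Fin r → Series) (u : Fin r → ℤ) (e : Fin r → ℕ) → (∀ {a b} → a ≡ b [mod t ^ℤ suc n ] → a ≡ b [mod m ]) →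
    (∀ i → evaluate (suc n) (f i) t ≡ u i [mod m ]) → evaluate (suc n) (mono f e) t ≡ monoℤ u e [mod m ]
  evaluate-mono {zero}  n m t f u e weaken p = ≡⇒mod (evaluate-con n 1ℤ t)
  evaluate-mono {suc r} n m t f u e weaken p = modtrans (weaken (evaluate-⊗ (suc n) (f zero ^ e zero) (mono (f ∘ suc) (e ∘ suc)) t))
    (mod* (modtrans (weaken (evaluate-^ n (f zero) (e zero) t)) (mod^ (e zero) (p zero)))
      (evaluate-mono n m t (f ∘ suc) (u ∘ suc) (e ∘ suc) weaken (p ∘ suc)))

  evaluate-sum : ∀ {D} n m t (c : Fin D → ℤ) (f : Fin D → Series) (v : Fin D → ℤ) → (∀ e → evaluate n (f e) t ≡ v e [mod m ]) →
    evaluate n (sum (λ e → con (c e) ⊗ f e)) t ≡ sumℤ (λ e → c e * v e) [mod m ]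
  evaluate-sum {zero}  n m t c f v p = ≡⇒mod (evaluate-0 n t)
  evaluate-sum {suc D} n m t c f v p = modtrans (≡⇒mod (evaluate-⊕ n (con (c zero) ⊗ f zero) (sum (λ e → con (c (suc e)) ⊗ f (suc e))) t))
    (mod+ (modtrans (≡⇒mod (evaluate-scale n (c zero) (f zero) t)) (mod*ˡ (c zero) (p zero)))
      (evaluate-sum n m t (c ∘ suc) (f ∘ suc) (v ∘ suc) (p ∘ suc)))

  ^ℤ-distrib-* : ∀ a b n → (a * b) ^ℤ n ≡ a ^ℤ n * b ^ℤ n
  ^ℤ-distrib-* a b zero    = refl
  ^ℤ-distrib-* a b (suc n) = trans (cong (a * b *_) (^ℤ-distrib-* a b n)) (lem a b (a ^ℤ n) (b ^ℤ n))
    where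
    lem : ∀ a b x y → a * b * (x * y) ≡ a * x * (b * y)
    lem = solve-∀

  -- The T i lie in one class modulo 16, so each is congruent modulo 2^N to the value of y₀ + Q z at
  -- a multiple of 4. There the combination of `small-combination` is divisible by 2^(n+1), while
  -- `size` puts its absolute value below 2^(n+1). So it vanishes at all points, and `no-relation`
  -- applies.
  module TooManyPoints (q′ r K n t : ℕ) (1≤r : 1 ≤ r) (h : Fin r → ℤ) (h-injective : Injective _≡_ _≡_ h)
    (q-case : suc q′ ≡ 2 ⊎ Odd (+ suc q′))
    (N²<D : suc (suc n) ℕ.* suc (suc n) < suc q′ ℕ.^ r) (size : suc q′ ℕ.^ r ℕ.* (2 ℕ.^ K) ℕ.^ r < 2 ℕ.^ suc n)
    (T : Fin (suc t) → ℤ) (T-injective : Injective _≡_ _≡_ T) (many : suc q′ ℕ.^ r ℕ.* r ℕ.+ r ≤ suc t)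
    (μ : Fin (suc t) → Fin r → ℤ) (μ-root : ∀ i k → μ i k ^ℤ suc q′ ≡ T i + h k) (μ-odd : ∀ i k → Odd (μ i k))
    (μ-mod : ∀ i k → μ i k ≡ μ zero k [mod + 4 ]) (T-mod : ∀ i → T i ≡ T zero [mod + 16 ])
    (bounded : ∀ i k → ∣ T i + h k ∣ ≤ 2 ℕ.^ K) where

    private
      q N D : ℕ
      q = suc q′
      N = suc (suc n)
      D = q ℕ.^ r

      expo : Fin D → Fin r → ℕ
      expo x i = toℕ (finToFun x i)

      y₀ P Q : ℤ
      y₀ = T zero
      P = product (λ k → μ zero k ^ℤ q)
      -- One parameter for all k: y₀ + Q z + h k = (y₀ + h k)(1 + q² Q_k z), where Q_k is the
      -- product of the other y₀ + h j. So `root` applies to every k.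
      Q = + q * + q * P

      odd-P : Odd P
      odd-P = odd-product (λ k → μ zero k ^ℤ q) (λ k → odd-^ q (μ-odd zero k))

      Q≢0 : Q ≢ 0ℤ
      Q≢0 = *≢0 {+ q * + q} {P} (*≢0 {+ q} {+ q} (λ ()) (λ ())) (odd≢0 odd-P)

      S : Fin r → Series
      S k = proj₁ (root q (proj₁ (cofactor (λ k → μ zero k ^ℤ q) k)))

      ψ : Fin r → Series
      ψ k = con (μ zero k) ⊗ S k

      ψ-0 : ∀ k → coef (ψ k) 0 ≡ μ zero k
      ψ-0 k = trans (cong (μ zero k *_) (proj₁ (proj₂ (root q (proj₁ (cofactor (λ k → μ zero k ^ℤ q) k)))))) (ℤ.*-identityʳ (μ zero k))

      ψ-root : ∀ k → ψ k ^ q ≈ con y₀ ⊕ con Q ⊗ z ⊕ con (h k)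
      ψ-root k = ≈trans (^-distrib-* (con (μ zero k)) (S k) q)
        (≈trans (⊗-cong (con-^ (μ zero k) q) (proj₂ (proj₂ (root q Qk))))
        (≈trans (solveₛ 3 (λ m b z → m :* (:c 1ℤ :+ b :* z) := m :+ m :* b :* z) ≈refl (con (μ zero k ^ℤ q)) (con (+ q * + q * Qk)) z)
        (≈trans (⊕-cong (≈trans (≡⇒≈ (cong con (μ-root zero k))) (con-⊕ y₀ (h k)))
            (⊗-cong (≈trans (≈sym (con-⊗ (μ zero k ^ℤ q) (+ q * + q * Qk))) (≡⇒≈ (cong con (trans (lem (μ zero k ^ℤ q) (+ q) Qk) (cong (+ q * + q *_) (proj₂ (cofactor (λ k → μ zero k ^ℤ q) k))))))) ≈refl))
          (solveₛ 3 (λ y h x → y :+ h :+ x := y :+ x :+ h) ≈refl (con y₀) (con (h k)) (con Q ⊗ z)))))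
        where
        Qk = proj₁ (cofactor (λ k → μ zero k ^ℤ q) k)
        lem : ∀ m q Q → m * (q * q * Q) ≡ q * q * (m * Q)
        lem = solve-∀

      siegel = small-combination N (λ e → mono ψ (expo e)) N²<D
      c : Fin D → ℤ
      c = proj₁ siegel

      module At (i : Fin (suc t)) where

        w = multiple (T-mod i)
        parameter-s = parameter {q} {P} N w q-case odd-P
        s = proj₁ parameter-s
        τ : ℤ
        τ = + 4 * s

        -- τ is even, so errors of truncation, multiples of τ^N, are divisible by 2^N.
        weaken : ∀ {a b} → a ≡ b [mod τ ^ℤ N ] → a ≡ b [mod pow2 N ]
        weaken {a} {b} p = mod-weaken {s = (+ 2 * s) ^ℤ N} {pow2 N} (subst (a ≡ b [mod_])
          (trans (cong (_^ℤ N) (lem s)) (^ℤ-distrib-* (+ 2 * s) (+ 2) N)) p)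
          where
          lem : ∀ s → + 4 * s ≡ (+ 2 * s) * + 2
          lem = solve-∀

        -- N = n + 2 exceeds n + 1 by the digit lost in `root-unique`.
        halve : ∀ {a b} → a ≡ b [mod pow2 N ] → a ≡ b [mod pow2 (suc n) ]
        halve = mod-weaken {s = + 2} {pow2 (suc n)}

        value : Fin r → ℤ
        value k = evaluate N (ψ k) τ

        value≡ : ∀ k → value k ≡ μ zero k + τ * evaluate (suc n) (tail (ψ k)) τ
        value≡ k = cong (λ x → x + τ * evaluate (suc n) (tail (ψ k)) τ) (ψ-0 k)

        value-mod-4 : ∀ k → value k ≡ μ i k [mod + 4 ]
        value-mod-4 k = modtrans (by (s * evaluate (suc n) (tail (ψ k)) τ) (trans (value≡ k) (cong (λ x → μ zero k + x) (lem s _)))) (modsym (μ-mod i k))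
          where
          lem : ∀ s x → + 4 * s * x ≡ s * x * + 4
          lem = solve-∀

        value-odd : ∀ k → Odd (value k)
        value-odd k = proj₁ (μ-odd zero k) + + 2 * (s * x) , trans (value≡ k) (trans (cong (_+ τ * x) (proj₂ (μ-odd zero k))) (lem (proj₁ (μ-odd zero k)) s x))
          where
          x = evaluate (suc n) (tail (ψ k)) τ
          lem : ∀ m s x → 1ℤ + + 2 * m + + 4 * s * x ≡ 1ℤ + + 2 * (m + + 2 * (s * x))
          lem = solve-∀

        value-root : ∀ k → value k ^ℤ q ≡ μ i k ^ℤ q [mod pow2 N ]
        value-root k = modtrans (modsym (weaken (evaluate-^ (suc n) (ψ k) q τ)))
          (modtrans (≡⇒mod (trans (evaluate-cong N τ (ψ-root k)) (trans (evaluate-⊕ N (con y₀ ⊕ con Q ⊗ z) (con (h k)) τ)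
              (cong₂ _+_ (evaluate-linear n y₀ Q τ) (evaluate-con (suc n) (h k) τ)))))
          (modtrans (mod+ (mod+ˡ y₀ (proj₂ parameter-s)) (modrefl {h k}))
            (≡⇒mod (trans (cong (_+ h k) (sym (equation (T-mod i)))) (sym (μ-root i k))))))

        value-mod : ∀ k → value k ≡ μ i k [mod pow2 (suc n) ]
        value-mod k = root-unique (suc n) q q-case (value-odd k) (μ-odd i k) (value-mod-4 k) (value-root k)

        total : ℤ
        total = sumℤ (λ e → c e * monoℤ (μ i) (expo e))

        total-mod : total ≡ 0ℤ [mod pow2 (suc n) ]
        total-mod = modtrans (modsym (evaluate-sum N (pow2 (suc n)) τ c (λ e → mono ψ (expo e)) (λ e → monoℤ (μ i) (expo e))
            (λ e → evaluate-mono (suc n) (pow2 (suc n)) τ ψ (μ i) (expo e) (λ p → halve (weaken p)) value-mod)))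
          (halve (evaluate-vanishing N (sum (λ e → con (c e) ⊗ mono ψ (expo e))) τ (pow2 N) (proj₂ (proj₂ (proj₂ siegel)))))

        total-small : ∣ total ∣ < 2 ℕ.^ suc n
        total-small = ℕ.≤-<-trans (sumℤ-bound (λ e → c e * monoℤ (μ i) (expo e)) ((2 ℕ.^ K) ℕ.^ r) λ e →
          subst (_≤ (2 ℕ.^ K) ℕ.^ r) (sym (ℤ.abs-* (c e) (monoℤ (μ i) (expo e))))
            (ℕ.≤-trans (ℕ.*-monoˡ-≤ _ (proj₁ (proj₂ (proj₂ siegel)) e)) (ℕ.≤-trans (ℕ.≤-reflexive (ℕ.*-identityˡ _))
              (monoℤ-bound q K (μ i) (expo e) (λ k → odd≢0 (μ-odd i k)) (λ k → toℕ<n (finToFun e k))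
                (λ k → subst (λ x → ∣ x ∣ ≤ 2 ℕ.^ K) (sym (μ-root i k)) (bounded i k)))))) size

        X≈0 : sum (λ e → con (c e) ⊗ mono (con ∘ μ i) (expo e)) ≈ con 0ℤ
        X≈0 = ≈trans (sum-cong-≋ λ e → ≈trans (⊗-cong ≈refl (mono-con (μ i) (expo e))) (≈sym (con-⊗ (c e) (monoℤ (μ i) (expo e)))))
          (≈trans (sum-con (λ e → c e * monoℤ (μ i) (expo e))) (≡⇒≈ (cong con (small-multiple {total} {suc n} total-mod total-small))))

    impossible : ⊥
    impossible = proj₂ (proj₁ (proj₂ siegel)) (Eliminate.no-relation q′ r h c 1≤r T T-injective many (λ i → con ∘ μ i)
      (λ i k → ≈trans (con-^ (μ i k) q) (≈trans (≡⇒≈ (cong con (μ-root i k))) (con-⊕ (T i) (h k))))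
      At.X≈0 y₀ Q Q≢0 h-injective ψ (λ k e → odd≢0 (μ-odd zero k) (trans (sym (ψ-0 k)) e)) ψ-root (proj₁ (proj₁ (proj₂ siegel))))

-- Pigeonhole principles and double counting

module Counting where

  open import Data.Fin using (Fin; zero; suc; inject≤)
  open import Data.Fin.Properties using (inject≤-injective)
  open import Data.List using (List; []; _∷_; length; filter; map; lookup; allFin)
  open import Data.List.Properties using (filter-all; filter-none; length-filter; length-tabulate)
  open import Data.List.Membership.Propositional using (_∈_)
  open import Data.List.Membership.Propositional.Properties using (∈-filter⁻; ∈-lookup)
  open import Data.List.Relation.Unary.All as All using (All; []; _∷_)
  import Data.List.Relation.Unary.All.Properties as All
  open import Data.List.Relation.Unary.Any using (here; there)
  open import Data.List.Relation.Unary.AllPairs using ([]; _∷_)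
  open import Data.List.Relation.Unary.Unique.Propositional using (Unique)
  import Data.List.Relation.Unary.Unique.Propositional.Properties as Unique
  open import Data.Nat
  open import Data.Nat.ListAction using (sum)
  open import Data.Nat.Properties
  open import Data.Nat.Tactic.RingSolver using (solve-∀)
  open import Data.Product using (∃; _×_; _,_; proj₁; proj₂)
  open import Data.Sum using (_⊎_; inj₁; inj₂; map₁)
  open import Function using (Injective)
  open import Relation.Binary using (DecidableEquality)
  open import Relation.Binary.PropositionalEquality
  open import Relation.Nullary using (¬_; Dec; yes; no; contradiction; ¬?)
  open import Relation.Nullary.Decidable using (_×-dec_)
  open import Relation.Unary using (Pred; Decidable)
  open import Level using (0ℓ)

  private variable
    A B : Set

  count : {P : Pred A 0ℓ} → Decidable P → List A → ℕ
  count P? xs = length (filter P? xs)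

  module _ {P : Pred A 0ℓ} (P? : Decidable P) where

    count-complement : ∀ xs → count P? xs + count (λ x → ¬? (P? x)) xs ≡ length xs
    count-complement []       = refl
    count-complement (x ∷ xs) with P? x
    ... | yes _ = cong suc (count-complement xs)
    ... | no _  = trans (+-suc (count P? xs) _) (cong suc (count-complement xs))

    count-filter : {Q : Pred A 0ℓ} (Q? : Decidable Q) → ∀ xs → count P? (filter Q? xs) ≤ count P? xs
    count-filter Q? []       = z≤n
    count-filter Q? (x ∷ xs) with Q? x
    ... | yes _ with P? x
    ...   | yes _ = s≤s (count-filter Q? xs)
    ...   | no _  = count-filter Q? xs
    count-filter Q? (x ∷ xs) | no _ with P? x
    ...   | yes _ = m≤n⇒m≤1+n (count-filter Q? xs)
    ...   | no _  = count-filter Q? xs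

    count-remove : (_≟_ : DecidableEquality A) → ∀ h xs → Unique xs → count P? xs ≤ suc (count P? (filter (λ x → ¬? (x ≟ h)) xs))
    count-remove _≟_ h []       []        = z≤n
    count-remove _≟_ h (x ∷ xs) (x∉ ∷ u) with x ≟ h
    ... | yes refl = subst (λ ys → count P? (x ∷ xs) ≤ suc (count P? ys))
          (sym (filter-all (λ y → ¬? (y ≟ h)) (All.map (λ x≢y y≡x → x≢y (sym y≡x)) x∉))) step
      where
      step : count P? (x ∷ xs) ≤ suc (count P? xs)
      step with P? x
      ... | yes _ = ≤-refl
      ... | no _  = n≤1+n _
    ... | no _ with P? x
    ...   | yes _ = s≤s (count-remove _≟_ h xs u)
    ...   | no _  = count-remove _≟_ h xs u

  count-union : {P Q R : Pred A 0ℓ} (P? : Decidable P) (Q? : Decidable Q) (R? : Decidable R) →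
    (∀ {x} → P x → Q x ⊎ R x) → (∀ {x} → Q x → P x) → (∀ {x} → R x → P x) → (∀ {x} → Q x → ¬ R x) →
    ∀ xs → count P? xs ≡ count Q? xs + count R? xs
  count-union P? Q? R? p q r disjoint [] = refl
  count-union P? Q? R? p q r disjoint (x ∷ xs) with P? x | Q? x | R? x
  ... | yes _  | yes _ | no _  = cong suc (count-union P? Q? R? p q r disjoint xs)
  ... | yes _  | no _  | yes _ = trans (cong suc (count-union P? Q? R? p q r disjoint xs)) (sym (+-suc _ _))
  ... | no _   | no _  | no _  = count-union P? Q? R? p q r disjoint xs
  ... | _      | yes a | yes b = contradiction b (disjoint a)
  ... | no ¬a  | yes b | no _  = contradiction (q b) ¬a
  ... | no ¬a  | no _  | yes b = contradiction (r b) ¬a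
  ... | yes a  | no ¬b | no ¬c with p a
  ...   | inj₁ b = contradiction b ¬b
  ...   | inj₂ c = contradiction c ¬c

  popular : ∀ C T (f : A → ℕ) (xs : List A) → All (λ x → f x < C) xs → C * T < length xs →
    ∃ λ c → c < C × T < count (λ x → f x ≟ c) xs
  popular zero    T f []       _        ()
  popular zero    T f (x ∷ xs) (() ∷ _) _
  popular (suc C) T f xs bound long with T <? count (λ x → f x ≟ C) xs
  ... | yes T< = C , ≤-refl , T<
  ... | no T≮ = let c , c<C , T< = popular C T f ys ys-bound ys-long in c , m<n⇒m<1+n c<C , <-≤-trans T< (count-filter (λ x → f x ≟ c) (λ x → ¬? (f x ≟ C)) xs)
    where
    ys = filter (λ x → ¬? (f x ≟ C)) xs
    ys-bound : All (λ x → f x < C) ys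
    ys-bound = All.zipWith (λ { (ne , s≤s le) → ≤∧≢⇒< le ne }) (All.all-filter (λ x → ¬? (f x ≟ C)) xs , All.filter⁺ (λ x → ¬? (f x ≟ C)) bound)
    ys-long : C * T < length ys
    ys-long = +-cancelˡ-< T (C * T) (length ys) (<-≤-trans long (subst (_≤ T + length ys) (count-complement (λ x → f x ≟ C) xs)
      (+-monoˡ-≤ (length ys) (≮⇒≥ T≮))))

  lookup-injective : {xs : List A} → Unique xs → ∀ i j → lookup xs i ≡ lookup xs j → i ≡ j
  lookup-injective (_ ∷ u)  zero    zero    _ = refl
  lookup-injective (x∉ ∷ _) zero    (suc j) e = contradiction e (All.lookup x∉ (∈-lookup j))
  lookup-injective (x∉ ∷ _) (suc i) zero    e = contradiction (sym e) (All.lookup x∉ (∈-lookup i))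
  lookup-injective (_ ∷ u)  (suc i) (suc j) e = cong suc (lookup-injective u i j e)

  popular-class : ∀ {K} C T (f : Fin K → ℕ) → (∀ i → f i < C) → C * T < K →
    ∃ λ (g : Fin (suc T) → Fin K) → Injective _≡_ _≡_ g × (∀ i j → f (g i) ≡ f (g j))
  popular-class {K} C T f bound long with popular C T f (allFin K) (All.tabulate⁺ bound) (subst (C * T <_) (sym (length-tabulate (λ (i : Fin K) → i))) long)
  ... | c , _ , T< = g , g-injective , λ i j → trans (class i) (sym (class j))
    where
    ys = filter (λ x → f x ≟ c) (allFin K)
    g : Fin (suc T) → Fin K
    g i = lookup ys (inject≤ i T<)
    g-injective : Injective _≡_ _≡_ g
    g-injective {i} {j} e = inject≤-injective T< T< i j (lookup-injective (Unique.filter⁺ (λ x → f x ≟ c) (Unique.allFin⁺ K)) (inject≤ i T<) (inject≤ j T<) e)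
    class : ∀ i → f (g i) ≡ c
    class i = proj₂ (∈-filter⁻ (λ x → f x ≟ c) {xs = allFin K} (∈-lookup (inject≤ i T<)))

  private
    arith₁ : ∀ i s c → suc i * (suc (suc i) * (s + c)) ≡ suc (suc i) * (suc i * s) + suc i * (suc (suc i) * c)
    arith₁ = solve-∀
    arith₂ : ∀ i n → suc (suc i) * (i * n) + n ≡ suc i * (suc i * n)
    arith₂ = solve-∀

  -- The weights 1/(q(q-1)) = 1/(q-1) - 1/q sum to less than 1 over 2 ≤ q ≤ Q.
  weighted-popular : ∀ Q (f : A → ℕ) (xs : List A) → All (λ x → 2 ≤ f x) xs → All (λ x → f x ≤ Q) xs → 0 < length xs →
    ∃ λ q → 2 ≤ q × q ≤ Q × length xs ≤ pred q * (q * count (λ x → f x ≟ q) xs)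
  weighted-popular {A} Q f xs low high nonempty with anyUpTo? (λ q → (2 ≤? q) ×-dec (length xs ≤? pred q * (q * count (λ x → f x ≟ q) xs))) (suc Q)
  ... | yes (q , s≤s q≤Q , 2≤q , big) = q , 2≤q , q≤Q , big
  ... | no none = contradiction nonempty (<-irrefl (sym (n≡0 Q refl)))
    where
    n = length xs
    cumulative : ℕ → ℕ
    cumulative j = count (λ x → f x ≤? j) xs
    cumulative-suc : ∀ j → cumulative (suc j) ≡ cumulative j + count (λ x → f x ≟ suc j) xs
    cumulative-suc j = count-union (λ x → f x ≤? suc j) (λ x → f x ≤? j) (λ x → f x ≟ suc j)
      (λ le → map₁ s≤s⁻¹ (m≤n⇒m<n∨m≡n le)) m≤n⇒m≤1+n ≤-reflexive (λ le e → 1+n≰n (subst (_≤ j) e le)) xs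
    -- If no q is popular, the value q takes less than the share 1/(q-1) - 1/q of the list. The
    -- shares telescope to 1 - 1/(i+1).
    claim : ∀ i → suc i ≤ Q → suc i * cumulative (suc i) ≤ i * n
    claim zero _ = ≤-reflexive (trans (*-identityˡ (cumulative 1)) (cong length (filter-none (λ x → f x ≤? 1) (All.map (λ 2≤ ≤1 → <⇒≱ 2≤ ≤1) low))))
    claim (suc i) i<Q = *-cancelˡ-≤ (suc i) (subst (λ s → suc i * (suc (suc i) * s) ≤ suc i * (suc i * n)) (sym (cumulative-suc (suc i)))
      (≤-trans (≤-reflexive (arith₁ i (cumulative (suc i)) c)) (≤-trans (+-mono-≤ (*-monoʳ-≤ (suc (suc i)) (claim i (<⇒≤ i<Q))) small)
        (≤-reflexive (arith₂ i n)))))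
      where
      c = count (λ x → f x ≟ suc (suc i)) xs
      small : suc i * (suc (suc i) * c) ≤ n
      small = <⇒≤ (≰⇒> λ big → none (suc (suc i) , s≤s i<Q , s≤s (s≤s z≤n) , big))
    all-counted : cumulative Q ≡ n
    all-counted = cong length (filter-all (λ x → f x ≤? Q) high)
    n≡0 : ∀ Q′ → Q ≡ Q′ → n ≡ 0
    n≡0 zero     e = empty low (subst (λ Q → All (λ x → f x ≤ Q) xs) e high)
      where
      empty : ∀ {xs} → All (λ x → 2 ≤ f x) xs → All (λ x → f x ≤ 0) xs → length xs ≡ 0
      empty [] [] = refl
      empty (2≤ ∷ _) (≤0 ∷ _) = contradiction (≤-trans 2≤ ≤0) λ ()
    n≡0 (suc Q′) e = n≤0⇒n≡0 (+-cancelʳ-≤ (Q′ * n) n 0 (subst (λ s → suc Q′ * s ≤ Q′ * n) (subst (λ Q → cumulative Q ≡ n) e all-counted) (claim Q′ (≤-reflexive (sym e)))))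

  sum-bound : (f : A → ℕ) → ∀ t xs → All (λ x → t ≤ f x) xs → length xs * t ≤ sum (map f xs)
  sum-bound f t []       []        = z≤n
  sum-bound f t (x ∷ xs) (t≤ ∷ ts) = +-mono-≤ t≤ (sum-bound f t xs ts)

  maximum : (f : A → ℕ) → ∀ x xs → ∃ λ h → h ∈ (x ∷ xs) × sum (map f (x ∷ xs)) ≤ length (x ∷ xs) * f h
  maximum f x []       = x , here refl , ≤-refl
  maximum f x (y ∷ xs) with maximum f y xs
  ... | h , h∈ , max with f x ≤? f h
  ...   | yes fx≤ = h , there h∈ , +-mono-≤ fx≤ max
  ...   | no fx≰  = x , here refl , +-monoʳ-≤ (f x) (≤-trans max (*-monoʳ-≤ (length (y ∷ xs)) (<⇒≤ (≰⇒> fx≰))))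

  module _ {R : A → B → Set} (R? : ∀ x y → Dec (R x y)) where

    double-count : ∀ xs ys → sum (map (λ x → count (R? x) ys) xs) ≡ sum (map (λ y → count (λ x → R? x y) xs) ys)
    double-count []       ys = sym (zeros ys)
      where
      zeros : ∀ ys → sum (map (λ y → 0) ys) ≡ 0
      zeros []       = refl
      zeros (y ∷ ys) = zeros ys
    double-count (x ∷ xs) ys = trans (cong (count (R? x) ys +_) (double-count xs ys)) (go ys)
      where
      go : ∀ ys → count (R? x) ys + sum (map (λ y → count (λ x → R? x y) xs) ys) ≡ sum (map (λ y → count (λ x → R? x y) (x ∷ xs)) ys)
      go []       = refl
      go (y ∷ ys) with R? x y
      ... | yes _ = cong suc (trans (lem (count (R? x) ys) c s) (cong (c +_) (go ys)))
        where
        c = count (λ x → R? x y) xs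
        s = sum (map (λ y → count (λ x → R? x y) xs) ys)
        lem : ∀ a b c → a + (b + c) ≡ b + (a + c)
        lem = solve-∀
      ... | no _  = trans (lem (count (R? x) ys) c s) (cong (c +_) (go ys))
        where
        c = count (λ x → R? x y) xs
        s = sum (map (λ y → count (λ x → R? x y) xs) ys)
        lem : ∀ a b c → a + (b + c) ≡ b + (a + c)
        lem = solve-∀

    -- greedy choice of r rows: each step keeps a proportion t / n of the columns
    biclique : DecidableEquality A → ∀ n t r xs ys → length xs ≤ n → Unique xs → Unique ys → 0 < length ys → 0 < t →
      All (λ y → t + r ≤ count (λ x → R? x y) xs) ys →
      ∃ λ (h : Fin r → A) → Injective _≡_ _≡_ h × (∀ i → h i ∈ xs) ×
      ∃ λ zs → Unique zs × (∀ {y} → y ∈ zs → y ∈ ys × (∀ i → R (h i) y)) × length ys * t ^ r ≤ n ^ r * length zs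
    biclique _≟A_ n t zero xs ys _ _ u-ys _ _ _ = (λ ()) , (λ { {()} }) , (λ ()) , ys , u-ys , (λ y∈ → y∈ , λ ()) , ≤-reflexive (trans (*-identityʳ (length ys)) (sym (*-identityˡ (length ys))))
    biclique _≟A_ n t (suc r) [] (y ∷ ys) _ _ _ _ 0<t (bad ∷ _) = contradiction (≤-trans (≤-trans 0<t (m≤m+n t (suc r))) bad) λ ()
    biclique _≟A_ n t (suc r) (x ∷ xs) ys ≤n u-xs u-ys 0<ys 0<t rows = h′ , h′-injective , h′∈ , zs , u-zs , good , bound
      where
      all-rows = x ∷ xs
      best = maximum (λ x → count (R? x) ys) x xs
      h = proj₁ best
      h∈ = proj₁ (proj₂ best)
      ys₁ = filter (R? h) ys
      xs₁ = filter (λ x → ¬? (x ≟A h)) all-rows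
      -- The best row meets at least the average number of columns, a proportion t / n.
      kept : length ys * t ≤ n * length ys₁
      kept = ≤-trans (sum-bound (λ y → count (λ x → R? x y) all-rows) t ys (All.map (≤-trans (m≤m+n t (suc r))) rows))
        (≤-trans (≤-reflexive (sym (double-count all-rows ys))) (≤-trans (proj₂ (proj₂ best)) (*-monoˡ-≤ (length ys₁) ≤n)))
      0<ys₁ : 0 < length ys₁
      0<ys₁ with length ys₁ in e
      ... | suc _ = s≤s z≤n
      ... | zero  = contradiction (≤-trans (*-mono-≤ 0<ys 0<t) (subst (λ l → length ys * t ≤ n * l) e kept)) (<⇒≱ (s≤s (≤-reflexive (*-zeroʳ n))))
      -- Discarding the row h lowers each column count by at most 1; the summand r in `t + r` pays
      -- for r such steps.
      rows₁ : All (λ y → t + r ≤ count (λ x → R? x y) xs₁) ys₁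
      rows₁ = All.filter⁺ (R? h) (All.map (λ {y} le → s≤s⁻¹ (≤-trans (≤-reflexive (sym (+-suc t r))) (≤-trans le (count-remove (λ x → R? x y) _≟A_ h all-rows u-xs)))) rows)
      IH = biclique _≟A_ n t r xs₁ ys₁ (≤-trans (length-filter (λ x → ¬? (x ≟A h)) all-rows) ≤n) (Unique.filter⁺ (λ x → ¬? (x ≟A h)) u-xs)
        (Unique.filter⁺ (R? h) u-ys) 0<ys₁ 0<t rows₁
      g = proj₁ IH
      g-injective = proj₁ (proj₂ IH)
      g∈ = proj₁ (proj₂ (proj₂ IH))
      zs = proj₁ (proj₂ (proj₂ (proj₂ IH)))
      u-zs = proj₁ (proj₂ (proj₂ (proj₂ (proj₂ IH))))
      good₁ = proj₁ (proj₂ (proj₂ (proj₂ (proj₂ (proj₂ IH)))))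
      bound₁ = proj₂ (proj₂ (proj₂ (proj₂ (proj₂ (proj₂ IH)))))
      h′ : Fin (suc r) → A
      h′ zero    = h
      h′ (suc i) = g i
      g≢h : ∀ i → g i ≢ h
      g≢h i = proj₂ (∈-filter⁻ (λ x → ¬? (x ≟A h)) {xs = all-rows} (g∈ i))
      h′-injective : Injective _≡_ _≡_ h′
      h′-injective {zero}  {zero}  _ = refl
      h′-injective {zero}  {suc j} e = contradiction (sym e) (g≢h j)
      h′-injective {suc i} {zero}  e = contradiction e (g≢h i)
      h′-injective {suc i} {suc j} e = cong suc (g-injective e)
      h′∈ : ∀ i → h′ i ∈ all-rows
      h′∈ zero    = h∈
      h′∈ (suc i) = proj₁ (∈-filter⁻ (λ x → ¬? (x ≟A h)) {xs = all-rows} (g∈ i))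
      good : ∀ {y} → y ∈ zs → y ∈ ys × (∀ i → R (h′ i) y)
      good y∈ with good₁ y∈
      ... | y∈ys₁ , Rg = proj₁ (∈-filter⁻ (R? h) {xs = ys} y∈ys₁) , λ { zero → proj₂ (∈-filter⁻ (R? h) {xs = ys} y∈ys₁) ; (suc i) → Rg i }
      bound : length ys * t ^ suc r ≤ n ^ suc r * length zs
      bound = ≤-trans (≤-reflexive (sym (*-assoc (length ys) t (t ^ r)))) (≤-trans (*-monoˡ-≤ (t ^ r) kept)
        (≤-trans (≤-reflexive (*-assoc n (length ys₁) (t ^ r))) (≤-trans (*-monoʳ-≤ n bound₁) (≤-reflexive (sym (*-assoc n (n ^ r) (length zs)))))))

  count-mono : {P Q : Pred A 0ℓ} (P? : Decidable P) (Q? : Decidable Q) → (∀ {x} → P x → Q x) → ∀ xs → count P? xs ≤ count Q? xs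
  count-mono P? Q? p [] = z≤n
  count-mono P? Q? p (x ∷ xs) with P? x | Q? x
  ... | yes _ | yes _ = s≤s (count-mono P? Q? p xs)
  ... | yes a | no ¬b = contradiction (p a) ¬b
  ... | no _  | yes _ = m≤n⇒m≤1+n (count-mono P? Q? p xs)
  ... | no _  | no _  = count-mono P? Q? p xs

-- Few subset sums: the rank bound and the binary counter

module Cyclic where

  open Dependence
  open Counting using (popular-class)
  open Elimination using (finToFun-injective)
  open import Data.Bool using (Bool; true; false; not; _∧_; _∨_; _xor_; if_then_else_)
  open import Data.Fin using (Fin; zero; suc; toℕ; fromℕ; fromℕ<; inject₁; combine; remQuot; punchIn; finToFun; funToFin)
  open import Data.Fin.Properties using (_≟_; any?; all?; remQuot-combine; punchInᵢ≢i; toℕ-fromℕ<; toℕ<n; toℕ-injective; finToFun-funToFin)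
  open import Data.Fin.Relation.Unary.Top using (view; ‵fromℕ; ‵inject₁)
  open import Data.Integer using (ℤ; 0ℤ; 1ℤ; _+_; _*_; -_; _-_)
  import Data.Integer.Properties as ℤ
  open import Data.Integer.Tactic.RingSolver using (solve-∀)
  open import Data.Nat as ℕ using (ℕ; zero; suc; _≤_; _<_; s≤s)
  import Data.Nat.Properties as ℕ
  open import Data.Nat.Tactic.RingSolver using () renaming (solve-∀ to solveℕ-∀)
  open import Data.Product using (∃; ∃₂; _×_; _,_; proj₁; proj₂)
  open import Data.Sum using (_⊎_; inj₁; inj₂)
  open import Data.Vec using (Vec; []; _∷_; head; tail; lookup; replicate)
  open import Function using (_∘_)
  open import Relation.Binary.PropositionalEquality
  open import Relation.Nullary using (yes; no; contradiction; ¬?; does)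
  open import Relation.Nullary.Decidable using (_×-dec_; _⊎-dec_; dec-false; decidable-stable)

  private
    ring₁ : ∀ c e v w → c * (e * (v * w)) ≡ c * (e * v * w)
    ring₁ = solve-∀
    ring₂ : ∀ a b → a + (0ℤ - b) ≡ a - b
    ring₂ = solve-∀

  δ : ∀ {n} → Fin n → Fin n → ℤ
  δ zero    zero    = 1ℤ
  δ zero    (suc _) = 0ℤ
  δ (suc _) zero    = 0ℤ
  δ (suc i) (suc j) = δ i j

  δ-refl : ∀ {n} (i : Fin n) → δ i i ≡ 1ℤ
  δ-refl zero    = refl
  δ-refl (suc i) = δ-refl i

  δ-≢ : ∀ {n} {i j : Fin n} → i ≢ j → δ i j ≡ 0ℤ
  δ-≢ {i = zero}  {zero}  ne = contradiction refl ne
  δ-≢ {i = zero}  {suc j} ne = refl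
  δ-≢ {i = suc i} {zero}  ne = refl
  δ-≢ {i = suc i} {suc j} ne = δ-≢ (λ e → ne (cong suc e))

  sum-δ : ∀ {n} (i : Fin n) → sum (δ i) ≡ 1ℤ
  sum-δ {suc n} zero    = cong (λ x → 1ℤ + x) (sum-zeros n)
  sum-δ {suc n} (suc i) = trans (ℤ.+-identityˡ _) (sum-δ i)

  -- Labels 0, …, B with a fixed-point free map next. The vectors δ c - δ (next c) have coordinate sum 0,
  -- hence lie in a space of dimension B; their tensor powers lie in a space of dimension B^n.
  module Tensor {B : ℕ} (next : Fin (suc B) → Fin (suc B)) (next≢ : ∀ c → next c ≢ c) where

    N : Fin (suc B) → Fin (suc B) → ℤ
    N c d = δ c d - δ (next c) d

    N-refl : ∀ c → N c c ≡ 1ℤ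
    N-refl c = cong₂ _-_ (δ-refl c) (δ-≢ (next≢ c))

    N-support : ∀ c d → N c d ≡ 0ℤ ⊎ (d ≡ c ⊎ d ≡ next c)
    N-support c d with d ≟ c | d ≟ next c
    ... | yes e | _     = inj₂ (inj₁ e)
    ... | no _  | yes e = inj₂ (inj₂ e)
    ... | no ne | no ne′ = inj₁ (cong₂ _-_ (δ-≢ (ne ∘ sym)) (δ-≢ (ne′ ∘ sym)))

    N-last : ∀ c → N c (fromℕ B) ≡ - sum (λ b → N c (inject₁ b))
    N-last c = trans (lem (sum (λ b → N c (inject₁ b))) (N c (fromℕ B))) (trans (cong (λ x → - sum (λ b → N c (inject₁ b)) + x)
        (trans (sym (sum-init-last (N c))) (trans (∑-distrib-+ (δ c) (λ d → - δ (next c) d))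
          (cong₂ _+_ (sum-δ c) (trans (sum-neg (δ (next c))) (cong -_ (sum-δ (next c))))))))
      (ℤ.+-identityʳ (- sum (λ b → N c (inject₁ b)))))
      where
      lem : ∀ s l → l ≡ - s + (s + l)
      lem = solve-∀
      sum-neg : ∀ {n} (f : Fin n → ℤ) → sum (λ i → - f i) ≡ - sum f
      sum-neg {zero}  f = refl
      sum-neg {suc n} f = trans (cong (λ x → - f zero + x) (sum-neg (f ∘ suc))) (sym (ℤ.neg-distrib-+ (f zero) (sum (f ∘ suc))))

    V : ∀ {n} → (Fin n → Fin (suc B)) → (Fin n → Fin (suc B)) → ℤ
    V {zero}  φ ψ = 1ℤ
    V {suc n} φ ψ = N (φ zero) (ψ zero) * V (φ ∘ suc) (ψ ∘ suc)

    V-refl : ∀ {n} (φ : Fin n → Fin (suc B)) → V φ φ ≡ 1ℤ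
    V-refl {zero}  φ = refl
    V-refl {suc n} φ = cong₂ _*_ (N-refl (φ zero)) (V-refl (φ ∘ suc))

    Follows : ∀ {n} → (Fin n → Fin (suc B)) → (Fin n → Fin (suc B)) → Set
    Follows φ ψ = ∀ a → ψ a ≡ φ a ⊎ ψ a ≡ next (φ a)

    V-support : ∀ {n} (φ ψ : Fin n → Fin (suc B)) → V φ ψ ≡ 0ℤ ⊎ Follows φ ψ
    V-support {zero}  φ ψ = inj₂ λ ()
    V-support {suc n} φ ψ with N-support (φ zero) (ψ zero) | V-support (φ ∘ suc) (ψ ∘ suc)
    ... | inj₁ e | _      = inj₁ (cong (_* V (φ ∘ suc) (ψ ∘ suc)) e)
    ... | inj₂ _ | inj₁ e = inj₁ (trans (cong (N (φ zero) (ψ zero) *_) e) (ℤ.*-zeroʳ (N (φ zero) (ψ zero))))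
    ... | inj₂ s | inj₂ f = inj₂ λ { zero → s ; (suc a) → f a }

    -- The weights e collect the tensor factors already split off. Each step absorbs the first B
    -- coordinates of one factor into e, so m grows to m B, until ordinary dependence applies. The
    -- omitted last coordinate follows from the others by `N-last`.
    tensor-dependent : ∀ n m k (e : Fin k → Fin m → ℤ) (φ : Fin k → Fin n → Fin (suc B)) → m ℕ.* B ℕ.^ n < k →
      ∃ λ (c : Fin k → ℤ) → (∃ λ i → c i ≢ 0ℤ) × (∀ (j : Fin m) (ψ : Fin n → Fin (suc B)) → sum (λ i → c i * (e i j * V (φ i) ψ)) ≡ 0ℤ)
    tensor-dependent zero    m k e φ m<k =
      let c , c≢0 , rel = dependent m k e (subst (_< k) (ℕ.*-identityʳ m) m<k) in
      c , c≢0 , λ j ψ → trans (sum-cong λ i → cong (c i *_) (ℤ.*-identityʳ (e i j))) (rel j)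
    tensor-dependent (suc n) m k e φ m<k = c , c≢0 , rel
      where
      e′ : Fin k → Fin (m ℕ.* B) → ℤ
      e′ i x = e i (proj₁ (remQuot {m} B x)) * N (φ i zero) (inject₁ (proj₂ (remQuot {m} B x)))
      IH = tensor-dependent n (m ℕ.* B) k e′ (λ i → φ i ∘ suc) (subst (_< k) (sym (ℕ.*-assoc m B (B ℕ.^ n))) m<k)
      c = proj₁ IH
      c≢0 = proj₁ (proj₂ IH)
      T : Fin m → (Fin n → Fin (suc B)) → Fin k → Fin B → ℤ
      T j ψ i b = c i * (e i j * (N (φ i zero) (inject₁ b) * V (φ i ∘ suc) ψ))
      first : ∀ j b ψ → sum (λ i → T j ψ i b) ≡ 0ℤ
      first j b ψ = trans (sum-cong expand) (proj₂ (proj₂ IH) (combine j b) ψ)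
        where
        expand : ∀ i → T j ψ i b ≡ c i * (e′ i (combine j b) * V (φ i ∘ suc) ψ)
        expand i = trans (ring₁ (c i) (e i j) (N (φ i zero) (inject₁ b)) (V (φ i ∘ suc) ψ))
          (cong (λ x → c i * (e i (proj₁ x) * N (φ i zero) (inject₁ (proj₂ x)) * V (φ i ∘ suc) ψ)) (sym (remQuot-combine {m} {B} j b)))
      last : ∀ j ψ → sum (λ i → c i * (e i j * (N (φ i zero) (fromℕ B) * V (φ i ∘ suc) ψ))) ≡ 0ℤ
      last j ψ = trans (sum-cong expand) (trans (∑-comm (λ i b → - 1ℤ * T j ψ i b))
        (sum≡0 {f = λ b → sum (λ i → - 1ℤ * T j ψ i b)} λ b →
          trans (sym (*-sum (- 1ℤ) (λ i → T j ψ i b))) (cong (- 1ℤ *_) (first j b ψ))))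
        where
        lem : ∀ c e s v → c * (e * (- s * v)) ≡ - (c * e * v) * s
        lem = solve-∀
        lem′ : ∀ c e n v → - (c * e * v) * n ≡ - 1ℤ * (c * (e * (n * v)))
        lem′ = solve-∀
        expand : ∀ i → c i * (e i j * (N (φ i zero) (fromℕ B) * V (φ i ∘ suc) ψ)) ≡ sum (λ b → - 1ℤ * T j ψ i b)
        expand i = trans (cong (λ x → c i * (e i j * (x * V (φ i ∘ suc) ψ))) (N-last (φ i zero)))
          (trans (lem (c i) (e i j) (sum (λ b → N (φ i zero) (inject₁ b))) (V (φ i ∘ suc) ψ))
            (trans (*-sum (- (c i * e i j * V (φ i ∘ suc) ψ)) (λ b → N (φ i zero) (inject₁ b)))
              (sum-cong λ b → lem′ (c i) (e i j) (N (φ i zero) (inject₁ b)) (V (φ i ∘ suc) ψ))))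
      rel : ∀ j ψ → sum (λ i → c i * (e i j * V (φ i) ψ)) ≡ 0ℤ
      rel j ψ with ψ zero | view (ψ zero)
      ... | _ | ‵fromℕ     = last j (ψ ∘ suc)
      ... | _ | ‵inject₁ b = first j b (ψ ∘ suc)

    -- Take a linear relation among the tensors with c j ≠ 0 and read it at the coordinate φ j.
    -- There `V (φ i)` vanishes unless φ j follows φ i; if that held for i = j only, the relation
    -- would say c j = 0.
    following-pair : ∀ {n k} (φ : Fin k → Fin n → Fin (suc B)) → B ℕ.^ n < k → ∃₂ λ i j → i ≢ j × Follows (φ i) (φ j)
    following-pair {n} {suc k} φ B^n<k with tensor-dependent n 1 (suc k) (λ _ _ → 1ℤ) φ (subst (_< suc k) (sym (ℕ.*-identityˡ (B ℕ.^ n))) B^n<k)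
    ... | c , (j , cj≢0) , rel with any? (λ i → ¬? (i ≟ j) ×-dec all? (λ a → (φ j a ≟ φ i a) ⊎-dec (φ j a ≟ next (φ i a))))
    ...   | yes (i , i≢j , f) = i , j , i≢j , f
    ...   | no none = contradiction cj≡0 cj≢0
      where
      term : Fin (suc k) → ℤ
      term i = c i * (1ℤ * V (φ i) (φ j))
      other : ∀ i → i ≢ j → term i ≡ 0ℤ
      other i i≢j with V-support (φ i) (φ j)
      ... | inj₁ e = trans (cong (λ x → c i * (1ℤ * x)) e) (ℤ.*-zeroʳ (c i))
      ... | inj₂ f = contradiction (i , i≢j , f) none
      cj≡0 : c j ≡ 0ℤ
      cj≡0 = trans (sym (trans (sum-remove {i = j} term) (trans (cong₂ _+_
          (trans (cong (λ x → c j * (1ℤ * x)) (V-refl (φ j))) (ℤ.*-identityʳ (c j)))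
          (sum≡0 {f = λ i → term (punchIn j i)} λ i → other (punchIn j i) (punchInᵢ≢i j i)))
        (ℤ.+-identityʳ (c j))))) (rel zero (φ j))

  -- The lowest bit comes first and the last carry is dropped, so that counting modulo 2^m matches
  -- the cyclic `next`, see `bits-next`.
  inc : ∀ {m} → Vec Bool m → Vec Bool m
  inc []          = []
  inc (false ∷ v) = true ∷ v
  inc (true ∷ v)  = false ∷ inc v

  bits : ∀ m → ℕ → Vec Bool m
  bits m zero    = replicate m false
  bits m (suc k) = inc (bits m k)

  bits-double : ∀ m k → bits (suc m) (k ℕ.+ k) ≡ false ∷ bits m k
  bits-double m zero    = refl
  bits-double m (suc k) = trans (cong (λ x → inc (bits (suc m) x)) (ℕ.+-suc k k)) (cong (inc ∘ inc) (bits-double m k))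

  bits-wrap : ∀ m → bits m (2 ℕ.^ m) ≡ bits m 0
  bits-wrap zero    = refl
  bits-wrap (suc m) = trans (cong (λ x → bits (suc m) (2 ℕ.^ m ℕ.+ x)) (ℕ.+-identityʳ (2 ℕ.^ m)))
    (trans (bits-double m (2 ℕ.^ m)) (cong (false ∷_) (bits-wrap m)))

  module _ {B : ℕ} where

    next : Fin (suc B) → Fin (suc B)
    next c with suc (toℕ c) ℕ.<? suc B
    ... | yes <B = fromℕ< <B
    ... | no _   = zero

    next≢ : 1 ≤ B → ∀ c → next c ≢ c
    next≢ 1≤B c e with suc (toℕ c) ℕ.<? suc B
    ... | yes <B = ℕ.1+n≢n (trans (sym (toℕ-fromℕ< <B)) (cong toℕ e))
    next≢ 1≤B .zero refl | no ≮B = ≮B (s≤s 1≤B)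

    bits-next : ∀ m → 2 ℕ.^ m ≡ suc B → ∀ c → bits m (toℕ (next c)) ≡ inc (bits m (toℕ c))
    bits-next m 2^m≡ c with suc (toℕ c) ℕ.<? suc B
    ... | yes <B = cong (bits m) (toℕ-fromℕ< <B)
    ... | no ≮B  = trans (sym (bits-wrap m)) (cong (bits m) (trans 2^m≡ (ℕ.≤-antisym (ℕ.≮⇒≥ ≮B) (toℕ<n c))))

  val : Bool → ℕ
  val false = 0
  val true  = 1

  total : ∀ {n} → (Fin n → ℕ) → (Fin n → Bool) → ℕ
  total {zero}  A p = 0
  total {suc n} A p = val (p zero) ℕ.* A zero ℕ.+ total (A ∘ suc) (p ∘ suc)

  module MaskSums {n : ℕ} (A : Fin n → ℕ) where

    S : (Fin n → Bool) → ℕ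
    S = total A

    private
      arith : ∀ p q x y u v r s → (p ℕ.+ q ≡ u ℕ.+ v) → (x ℕ.+ y ≡ r ℕ.+ s) → ∀ a →
        (p ℕ.* a ℕ.+ x) ℕ.+ (q ℕ.* a ℕ.+ y) ≡ (u ℕ.* a ℕ.+ r) ℕ.+ (v ℕ.* a ℕ.+ s)
      arith p q x y u v r s e f a = trans (lem p q x y a) (trans (cong₂ (λ g h → g ℕ.* a ℕ.+ h) e f) (sym (lem u v r s a)))
        where
        lem : ∀ p q x y a → (p ℕ.* a ℕ.+ x) ℕ.+ (q ℕ.* a ℕ.+ y) ≡ (p ℕ.+ q) ℕ.* a ℕ.+ (x ℕ.+ y)
        lem = solveℕ-∀

    -- Identities between sums over masks reduce to a truth table at each element.
    balance : ∀ {p q r s : Fin n → Bool} → (∀ a → val (p a) ℕ.+ val (q a) ≡ val (r a) ℕ.+ val (s a)) → S p ℕ.+ S q ≡ S r ℕ.+ S s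
    balance {p} {q} {r} {s} = go A p q r s
      where
      go : ∀ {n} A (p q r s : Fin n → Bool) → (∀ a → val (p a) ℕ.+ val (q a) ≡ val (r a) ℕ.+ val (s a)) → total A p ℕ.+ total A q ≡ total A r ℕ.+ total A s
      go {zero}  A p q r s e = refl
      go {suc n} A p q r s e = arith (val (p zero)) (val (q zero)) _ _ (val (r zero)) (val (s zero)) _ _ (e zero)
        (go (A ∘ suc) (p ∘ suc) (q ∘ suc) (r ∘ suc) (s ∘ suc) (e ∘ suc)) (A zero)

    S-cong : ∀ {p q} → (∀ a → p a ≡ q a) → S p ≡ S q
    S-cong {p} {q} = go A p q
      where
      go : ∀ {n} A (p q : Fin n → Bool) → (∀ a → p a ≡ q a) → total A p ≡ total A q
      go {zero}  A p q e = refl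
      go {suc n} A p q e = cong₂ (λ b x → val b ℕ.* A zero ℕ.+ x) (e zero) (go (A ∘ suc) (p ∘ suc) (q ∘ suc) (e ∘ suc))

    S-empty : S (λ _ → false) ≡ 0
    S-empty = go A
      where
      go : ∀ {n} A → total {n} A (λ _ → false) ≡ 0
      go {zero}  A = refl
      go {suc n} A = go (A ∘ suc)

    -- The elements whose counter overflows its lowest bit have the same sum as the other moved elements,
    -- since the sum of the elements with lowest bit 1 does not change.
    multiples : ∀ m (v v′ : Fin n → Vec Bool m) (moved : Fin n → Bool) →
      (∀ a → v′ a ≡ (if moved a then inc (v a) else v a)) →
      (∀ j → S (λ a → lookup (v a) j) ≡ S (λ a → lookup (v′ a) j)) →
      ∃ λ x → S moved ≡ 2 ℕ.^ m ℕ.* x × (∀ i → i ≤ 2 ℕ.^ m → ∃ λ p → (∀ a → p a ≡ true → moved a ≡ true) × S p ≡ i ℕ.* x)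
    multiples zero v v′ moved step same = S moved , sym (ℕ.+-identityʳ (S moved)) , λ where
      zero          _         → (λ _ → false) , (λ _ ()) , S-empty
      (suc zero)    _         → moved , (λ _ e → e) , sym (ℕ.+-identityʳ (S moved))
      (suc (suc i)) (s≤s ())
    multiples (suc m) v v′ moved step same = x , S-moved , subset
      where
      low carry rest : Fin n → Bool
      low a   = head (v a)
      carry a = moved a ∧ low a
      rest a  = moved a ∧ not (low a)
      tail-step : ∀ a → tail (v′ a) ≡ (if carry a then inc (tail (v a)) else tail (v a))
      tail-step a rewrite step a with moved a | v a
      ... | false | _         = refl
      ... | true  | false ∷ _ = refl
      ... | true  | true ∷ _  = refl
      head-step : ∀ a → lookup (v′ a) zero ≡ low a xor moved a
      head-step a rewrite step a with moved a | v a
      ... | false | false ∷ _ = refl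
      ... | false | true ∷ _  = refl
      ... | true  | false ∷ _ = refl
      ... | true  | true ∷ _  = refl
      lookup-head : ∀ a → lookup (v a) zero ≡ low a
      lookup-head a with v a
      ... | _ ∷ _ = refl
      lookup-tail : ∀ (w : Vec Bool (suc m)) j → lookup w (suc j) ≡ lookup (tail w) j
      lookup-tail (_ ∷ _) j = refl
      S-carry : S carry ≡ S rest
      S-carry = ℕ.+-cancelˡ-≡ (S low) _ _ (trans (cong (ℕ._+ S carry)
          (trans (sym (S-cong lookup-head)) (trans (same zero) (S-cong head-step))))
        (balance (λ a → identity (moved a) (low a))))
        where
        identity : ∀ m b → val (b xor m) ℕ.+ val (m ∧ b) ≡ val b ℕ.+ val (m ∧ not b)
        identity false false = refl
        identity false true  = refl
        identity true  false = refl
        identity true  true  = refl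
      S-split : S carry ℕ.+ S rest ≡ S moved
      S-split = trans (balance {carry} {rest} {moved} {λ _ → false} (λ a → identity (moved a) (low a))) (trans (cong (S moved ℕ.+_) S-empty) (ℕ.+-identityʳ (S moved)))
        where
        identity : ∀ m b → val (m ∧ b) ℕ.+ val (m ∧ not b) ≡ val m ℕ.+ 0
        identity false false = refl
        identity false true  = refl
        identity true  false = refl
        identity true  true  = refl
      IH = multiples m (tail ∘ v) (tail ∘ v′) carry tail-step
        (λ j → trans (S-cong (λ a → sym (lookup-tail (v a) j))) (trans (same (suc j)) (S-cong (λ a → lookup-tail (v′ a) j))))
      x = proj₁ IH
      M = 2 ℕ.^ m
      S-rest : S rest ≡ M ℕ.* x
      S-rest = trans (sym S-carry) (proj₁ (proj₂ IH))
      double : ∀ M x → M ℕ.* x ℕ.+ M ℕ.* x ≡ (2 ℕ.* M) ℕ.* x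
      double = solveℕ-∀
      S-moved : S moved ≡ 2 ℕ.^ suc m ℕ.* x
      S-moved = trans (sym S-split) (trans (cong₂ ℕ._+_ (proj₁ (proj₂ IH)) S-rest) (double M x))
      carry⇒ : ∀ a → carry a ≡ true → moved a ≡ true
      carry⇒ a e with moved a
      ... | true = refl
      -- Multiples up to 2^m x come from the elements that carry. Beyond that all of `rest`, whose
      -- sum is 2^m x, is added.
      subset : ∀ i → i ≤ 2 ℕ.^ suc m → ∃ λ p → (∀ a → p a ≡ true → moved a ≡ true) × S p ≡ i ℕ.* x
      subset i i≤ with i ℕ.≤? M
      ... | yes i≤M = let p , p⇒ , Sp = proj₂ (proj₂ IH) i i≤M in p , (λ a e → carry⇒ a (p⇒ a e)) , Sp
      ... | no i≰M = (λ a → p a ∨ rest a) , (λ a e → union⇒ a e)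
          , trans (sym (trans (balance {p} {rest} {λ a → p a ∨ rest a} {λ _ → false} (λ a → identity (p a) (moved a) (low a) (p⇒ a)))
              (trans (cong (S (λ a → p a ∨ rest a) ℕ.+_) S-empty) (ℕ.+-identityʳ _))))
            (trans (cong₂ ℕ._+_ Sp S-rest) (trans (sym (ℕ.*-distribʳ-+ x (i ℕ.∸ M) M)) (cong (ℕ._* x) (ℕ.m∸n+n≡m (ℕ.<⇒≤ (ℕ.≰⇒> i≰M))))))
        where
        smaller = proj₂ (proj₂ IH) (i ℕ.∸ M) (ℕ.m≤n+o⇒m∸n≤o i M (subst (i ≤_) (cong (M ℕ.+_) (ℕ.+-identityʳ M)) i≤))
        p = proj₁ smaller
        p⇒ = proj₁ (proj₂ smaller)
        Sp = proj₂ (proj₂ smaller)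
        union⇒ : ∀ a → p a ∨ rest a ≡ true → moved a ≡ true
        union⇒ a e with p a in pe
        ... | true = carry⇒ a (p⇒ a pe)
        union⇒ a e | false with moved a
        ...   | true = refl
        identity : ∀ p m b → (p ≡ true → m ∧ b ≡ true) → val p ℕ.+ val (m ∧ not b) ≡ val (p ∨ (m ∧ not b)) ℕ.+ 0
        identity false false b     _ = refl
        identity false true  false _ = refl
        identity false true  true  _ = refl
        identity true  true  true  _ = refl
        identity true  true  false h = contradiction (h refl) λ ()
        identity true  false b     h = contradiction (h refl) λ ()

    S-positive : (∀ a → 1 ≤ A a) → ∀ {p} a → p a ≡ true → 1 ≤ S p
    S-positive A≥1 {p} = go A A≥1 p
      where
      go : ∀ {n} (A : Fin n → ℕ) → (∀ a → 1 ≤ A a) → ∀ p a → p a ≡ true → 1 ≤ total A p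
      go A A≥1 p zero    e rewrite e = ℕ.≤-trans (A≥1 zero) (ℕ.≤-trans (ℕ.m≤m+n (A zero) 0) (ℕ.m≤m+n _ _))
      go A A≥1 p (suc a) e = ℕ.≤-trans (go (A ∘ suc) (A≥1 ∘ suc) (p ∘ suc) a e) (ℕ.m≤n+m _ _)

    module _ {B : ℕ} (m : ℕ) (2^m≡ : 2 ℕ.^ m ≡ suc B) (1≤B : 1 ≤ B) (A≥1 : ∀ a → 1 ≤ A a) where

      bit : (Fin n → Fin (suc B)) → Fin m → Fin n → Bool
      bit φ j a = lookup (bits m (toℕ (φ a))) j

      module Tn = Tensor {B} next (next≢ 1≤B)

      multiples-of-pair : (φ ψ : Fin n → Fin (suc B)) → (∃ λ a → ψ a ≢ φ a) → Tn.Follows φ ψ → (∀ j → S (bit φ j) ≡ S (bit ψ j)) →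
        ∃ λ x → 1 ≤ x × (∀ i → i ≤ 2 ℕ.^ m → ∃ λ p → S p ≡ i ℕ.* x)
      multiples-of-pair φ ψ (a₀ , ne₀) follows same = x , x≥1 , λ i i≤ → let p , _ , Sp = proj₂ (proj₂ flow) i i≤ in p , Sp
        where
        moved : Fin n → Bool
        moved a = not (does (ψ a ≟ φ a))
        step : ∀ a → bits m (toℕ (ψ a)) ≡ (if moved a then inc (bits m (toℕ (φ a))) else bits m (toℕ (φ a)))
        step a with ψ a ≟ φ a | follows a
        ... | yes e | _      = cong (bits m ∘ toℕ) e
        ... | no ne | inj₁ e = contradiction e ne
        ... | no _  | inj₂ e = trans (cong (bits m ∘ toℕ) e) (bits-next m 2^m≡ (φ a))
        flow = multiples m (λ a → bits m (toℕ (φ a))) (λ a → bits m (toℕ (ψ a))) moved step same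
        x = proj₁ flow
        -- A label changes at a₀ and all elements are positive, so the moved elements have sum 2^m x
        -- > 0.
        x≥1 : 1 ≤ x
        x≥1 = ℕ.n≢0⇒n>0 λ x≡0 → ℕ.<⇒≢ (S-positive A≥1 a₀ (cong not (dec-false (ψ a₀ ≟ φ a₀) ne₀)))
          (sym (trans (proj₁ (proj₂ flow)) (trans (cong (2 ℕ.^ m ℕ.*_) x≡0) (ℕ.*-zeroʳ (2 ℕ.^ m)))))

      states-differ : ∀ {i j : Fin (suc B ℕ.^ n)} → i ≢ j → ∃ λ a → finToFun {suc B} {n} j a ≢ finToFun {suc B} {n} i a
      states-differ {i} {j} i≢j with any? (λ a → ¬? (finToFun {suc B} {n} j a ≟ finToFun {suc B} {n} i a))
      ... | yes p = p
      ... | no none = contradiction (finToFun-injective {n} {suc B} i j λ a → sym (decidable-stable (finToFun {suc B} {n} j a ≟ finToFun {suc B} {n} i a) λ ne → none (a , ne))) i≢j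

      -- The m bit sums of a labelling take at most M^m values together. Among the (B + 1)^n
      -- labellings more than B^n therefore share all of them, which is the number that
      -- `following-pair` asks for.
      few-sums : ∀ M (index : (Fin n → Bool) → Fin M) → (∀ p q → index p ≡ index q → S p ≡ S q) →
        M ℕ.^ m ℕ.* B ℕ.^ n < suc B ℕ.^ n →
        ∃ λ x → 1 ≤ x × (∀ i → i ≤ 2 ℕ.^ m → ∃ λ p → S p ≡ i ℕ.* x)
      few-sums M index index-sound large =
        let g , g-injective , same-class = popular-class {suc B ℕ.^ n} (M ℕ.^ m) (B ℕ.^ n) (λ k → toℕ (code k)) (λ k → toℕ<n (code k)) large
            i , j , i≢j , follows = Tn.following-pair {n} (λ k → finToFun {suc B} {n} (g k)) ℕ.≤-refl
        in multiples-of-pair (finToFun {suc B} {n} (g i)) (finToFun {suc B} {n} (g j)) (states-differ (λ e → i≢j (g-injective e))) follows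
          (same (g i) (g j) (toℕ-injective (same-class i j)))
        where
        codes : Fin (suc B ℕ.^ n) → Fin m → Fin M
        codes k j = index (bit (finToFun {suc B} {n} k) j)
        code : Fin (suc B ℕ.^ n) → Fin (M ℕ.^ m)
        code k = funToFin {m} {M} (codes k)
        same : ∀ i j → code i ≡ code j → ∀ b → S (bit (finToFun {suc B} {n} i) b) ≡ S (bit (finToFun {suc B} {n} j) b)
        same i j e b = index-sound _ _ (trans (sym (finToFun-funToFin {m} {M} (codes i) b))
          (trans (cong (λ x → finToFun {M} {m} x b) e) (finToFun-funToFin {m} {M} (codes j) b)))

-- Multiples of x that are all powers

module Multiples where

  open import Defs using (PurePower)
  open Counting
  open import Data.Empty using (⊥)
  open import Data.List using (List; []; _∷_; length; filter; map; downFrom)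
  open import Data.List.Properties using (length-map; length-downFrom)
  open import Data.List.Membership.Propositional using (_∈_)
  open import Data.List.Membership.Propositional.Properties using (∈-filter⁻; ∈-downFrom⁻)
  open import Data.List.Relation.Unary.All as All using (All; []; _∷_)
  import Data.List.Relation.Unary.All.Properties as All
  open import Data.List.Relation.Unary.AllPairs as AllPairs using (AllPairs; []; _∷_)
  import Data.List.Relation.Unary.AllPairs.Properties as AllPairs
  open import Data.List.Relation.Unary.Unique.Propositional using (Unique)
  import Data.List.Relation.Unary.Unique.Propositional.Properties as Unique
  open import Data.Nat hiding (parity)
  open import Data.Nat.Coprimality using (Coprime; coprime-divisor; coprime-/gcd) renaming (sym to coprime-sym)
  open import Data.Nat.DivMod using (m/n*n≡m)
  open import Data.Nat.Divisibility
  open import Data.Nat.GCD using (gcd; gcd[m,n]∣m; gcd[m,n]∣n; gcd[m,n]≢0)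
  open import Data.Nat.Induction using (<-rec)
  open import Data.Nat.ListAction using (product)
  open import Data.Nat.Properties
  open import Data.Nat.Tactic.RingSolver using (solve-∀)
  open import Data.Product using (∃; ∃₂; _×_; _,_; proj₁; proj₂)
  open import Data.Sum using (_⊎_; inj₁; inj₂)
  open import Relation.Binary.PropositionalEquality
  open import Level using (0ℓ)
  open import Relation.Unary using (Pred; Decidable)
  open import Relation.Nullary using (¬_; Dec; yes; no; contradiction; ¬?)
  open import Relation.Nullary.Decidable using (_×-dec_)

  parity : ∀ n → (∃ λ k → n ≡ 2 * k) ⊎ (∃ λ k → n ≡ suc (2 * k))
  parity zero = inj₁ (0 , refl)
  parity (suc n) with parity n
  ... | inj₁ (k , refl) = inj₂ (k , refl)
  ... | inj₂ (k , refl) = inj₁ (suc k , cong suc (sym (+-suc k (k + 0))))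

  odd≢even : ∀ k l → suc (2 * k) ≢ 2 * l
  odd≢even k zero    ()
  odd≢even zero    (suc l) e = contradiction (trans (suc-injective e) (+-suc l (l + 0))) λ ()
  odd≢even (suc k) (suc l) e = odd≢even k l (trans (sym (+-suc k (k + 0))) (suc-injective (trans (suc-injective e) (+-suc l (l + 0)))))

  two-adic : ∀ n → 1 ≤ n → ∃₂ λ v k → n ≡ 2 ^ v * suc (2 * k)
  two-adic = <-rec _ step
    where
    step : ∀ n → (∀ {m} → m < n → 1 ≤ m → ∃₂ λ v k → m ≡ 2 ^ v * suc (2 * k)) → 1 ≤ n → ∃₂ λ v k → n ≡ 2 ^ v * suc (2 * k)
    step n rec 1≤n with parity n
    ... | inj₂ (k , e) = 0 , k , trans e (sym (*-identityˡ _))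
    step .(2 * 0) rec () | inj₁ (zero , refl)
    step n rec 1≤n | inj₁ (suc k , refl) with rec {suc k} (m<m+n (suc k) (s≤s z≤n)) (s≤s z≤n)
    ... | v , l , e = suc v , l , trans (cong (2 *_) e) (sym (*-assoc 2 (2 ^ v) (suc (2 * l))))

  two-adic-unique : ∀ v w k l → 2 ^ v * suc (2 * k) ≡ 2 ^ w * suc (2 * l) → v ≡ w × suc (2 * k) ≡ suc (2 * l)
  two-adic-unique zero    zero    k l e = refl , trans (sym (*-identityˡ _)) (trans e (*-identityˡ _))
  two-adic-unique zero    (suc w) k l e = contradiction (trans (sym (*-identityˡ (suc (2 * k)))) (trans e (*-assoc 2 (2 ^ w) (suc (2 * l))))) (odd≢even k (2 ^ w * suc (2 * l)))
  two-adic-unique (suc v) zero    k l e = contradiction (trans (sym (*-identityˡ (suc (2 * l)))) (trans (sym e) (*-assoc 2 (2 ^ v) (suc (2 * k))))) (odd≢even l (2 ^ v * suc (2 * k)))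
  two-adic-unique (suc v) (suc w) k l e with two-adic-unique v w k l (*-cancelˡ-≡ _ _ 2 (trans (sym (*-assoc 2 (2 ^ v) _)) (trans e (*-assoc 2 (2 ^ w) _))))
  ... | v≡w , k≡l = cong suc v≡w , k≡l

  odd-* : ∀ k l → ∃ λ j → suc (2 * k) * suc (2 * l) ≡ suc (2 * j)
  odd-* k l = k + l + 2 * k * l , lem k l
    where
    lem : ∀ k l → suc (2 * k) * suc (2 * l) ≡ suc (2 * (k + l + 2 * k * l))
    lem = solve-∀

  odd-^ : ∀ k n → ∃ λ j → suc (2 * k) ^ n ≡ suc (2 * j)
  odd-^ k zero    = 0 , refl
  odd-^ k (suc n) with odd-^ k n
  ... | j , e = proj₁ (odd-* k j) , trans (cong (suc (2 * k) *_) e) (proj₂ (odd-* k j))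

  ^-distribʳ-* : ∀ a b n → (a * b) ^ n ≡ a ^ n * b ^ n
  ^-distribʳ-* a b zero    = refl
  ^-distribʳ-* a b (suc n) = trans (cong (a * b *_) (^-distribʳ-* a b n)) (lem a b (a ^ n) (b ^ n))
    where
    lem : ∀ a b x y → a * b * (x * y) ≡ a * x * (b * y)
    lem = solve-∀

  odd-part-of-power : ∀ v k b n → 1 ≤ b → 2 ^ v * suc (2 * k) ≡ b ^ n → ∃₂ λ w l → v ≡ w * n × suc (2 * k) ≡ suc (2 * l) ^ n
  odd-part-of-power v k b n 1≤b e with two-adic b 1≤b
  ... | w , l , refl with odd-^ l n
  ...   | j , odd with two-adic-unique v (w * n) k j (trans e (trans (^-distribʳ-* (2 ^ w) (suc (2 * l)) n)
            (cong₂ _*_ (^-*-assoc 2 w n) odd)))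
  ...     | v≡ , k≡ = w , l , v≡ , trans k≡ (sym odd)

  -- Only odd squares are tested, which for odd j amounts to squarefreeness.
  SquarefreeOdd : ℕ → Set
  SquarefreeOdd j = ∀ k → 1 ≤ k → ¬ suc (2 * k) * suc (2 * k) ∣ j

  coprime-power-divisor : ∀ {s t} d j → Coprime s t → s ∣ t ^ d * j → s ∣ j
  coprime-power-divisor zero    j c s∣ = subst (_ ∣_) (*-identityˡ j) s∣
  coprime-power-divisor {s} {t} (suc d) j c s∣ = coprime-power-divisor d j c
    (coprime-divisor c (subst (s ∣_) (*-assoc t (t ^ d) j) s∣))

  -- As s is coprime to t and d ≥ 2, the equation forces s² to divide j. An even s is excluded since
  -- j is odd, an odd s > 1 since j is squarefree.
  squarefree-part : ∀ {s t j j′ i : ℕ} d → 2 ≤ d → 1 ≤ s → Coprime s t → j ≡ suc (2 * i) → SquarefreeOdd j → j * t ^ d ≡ j′ * s ^ d → s ≡ 1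
  squarefree-part (suc zero) (s≤s ())
  squarefree-part {s} {t} {j} {j′} {i} (suc (suc d)) _ 1≤s c j-odd sqf e with parity s
  ... | inj₁ (k , refl) = contradiction (trans (sym j-odd) (proj₂ even)) (odd≢even i (proj₁ even))
    where
    s∣j : 2 * k ∣ j
    s∣j = coprime-power-divisor (suc (suc d)) j c (divides (j′ * (2 * k) ^ suc d) (trans (*-comm _ j) (trans e (lem j′ (2 * k) ((2 * k) ^ suc d)))))
      where
      lem : ∀ a b c → a * (b * c) ≡ a * c * b
      lem = solve-∀
    even : ∃ λ l → j ≡ 2 * l
    even with s∣j
    ... | divides l e = l * k , trans e (lem l k)
      where
      lem : ∀ l k → l * (2 * k) ≡ 2 * (l * k)
      lem = solve-∀
  ... | inj₂ (zero , s≡1)    = s≡1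
  ... | inj₂ (suc k , refl) = contradiction s²∣j (sqf (suc k) (s≤s z≤n))
    where
    s′ : ℕ
    s′ = suc (2 * suc k)
    s′∣j : s′ ∣ j
    s′∣j = coprime-power-divisor (suc (suc d)) j c (divides (j′ * s′ ^ suc d) (trans (*-comm _ j) (trans e (lem j′ s′ (s′ ^ suc d)))))
      where
      lem : ∀ a b c → a * (b * c) ≡ a * c * b
      lem = solve-∀
    s²∣j : s′ * s′ ∣ j
    s²∣j with s′∣j
    ... | divides l refl with coprime-power-divisor (suc (suc d)) l c (divides (j′ * s′ ^ d) (*-cancelʳ-≡ _ _ s′
            (trans (lem₁ (t ^ suc (suc d)) l s′) (trans e (lem₂ j′ s′ (s′ ^ d))))))
      where
      lem₁ : ∀ t l s → t * l * s ≡ l * s * t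
      lem₁ = solve-∀
      lem₂ : ∀ j s x → j * (s * (s * x)) ≡ j * x * s * s
      lem₂ = solve-∀
    ...   | divides l′ refl = divides l′ (*-assoc l′ s′ s′)

  zero-power : ∀ {d} → 2 ≤ d → 0 ^ d ≡ 0
  zero-power (s≤s _) = refl

  -- The quotient of the two d-th powers is j / j′. Written as (s / t)^d in lowest terms, it is 1 by
  -- `squarefree-part` applied in both directions.
  same-radical : ∀ {x i i′ : ℕ} α β d → 1 ≤ x → 2 ≤ d → SquarefreeOdd (suc (2 * i)) → SquarefreeOdd (suc (2 * i′)) →
    suc (2 * i) * x ≡ α ^ d → suc (2 * i′) * x ≡ β ^ d → i ≡ i′
  same-radical {x} {i} {i′} α β d 1≤x 2≤d sqf sqf′ eα eβ =
    *-cancelˡ-≡ i i′ 2 (suc-injective (trans (sym (*-identityʳ j)) (trans (cong (j *_) (sym (one-power t t≡1)))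
      (trans reduced (trans (cong (j′ *_) (one-power s s≡1)) (*-identityʳ j′))))))
    where
    j  = suc (2 * i)
    j′ = suc (2 * i′)
    positive : ∀ j {a} → suc j * x ≡ a ^ d → a ≢ 0
    positive j e refl = <⇒≢ (*-mono-≤ {1} {suc j} {1} {x} (s≤s z≤n) 1≤x) (sym (trans e (zero-power 2≤d)))
    g = gcd α β
    g≢0 : g ≢ 0
    g≢0 = gcd[m,n]≢0 α β (inj₁ (positive (2 * i) eα))
    instance
      g-nonZero : NonZero g
      g-nonZero = ≢-nonZero g≢0
    s = α / g
    t = β / g
    α≡ : s * g ≡ α
    α≡ = m/n*n≡m (gcd[m,n]∣m α β)
    β≡ : t * g ≡ β
    β≡ = m/n*n≡m (gcd[m,n]∣n α β)
    c : Coprime s t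
    c = coprime-/gcd α β
    cross : j * β ^ d ≡ j′ * α ^ d
    cross = trans (cong (j *_) (sym eβ)) (trans (lem j j′ x) (cong (j′ *_) eα))
      where
      lem : ∀ j j′ x → j * (j′ * x) ≡ j′ * (j * x)
      lem = solve-∀
    reduced : j * t ^ d ≡ j′ * s ^ d
    reduced = *-cancelʳ-≡ _ _ (g ^ d) {{m^n≢0 g d}} (trans (split j t β β≡) (trans cross (sym (split j′ s α α≡))))
      where
      split : ∀ (j t β : ℕ) → t * g ≡ β → j * t ^ d * g ^ d ≡ j * β ^ d
      split j t β e = trans (*-assoc j (t ^ d) (g ^ d)) (cong (j *_) (trans (sym (^-distribʳ-* t g d)) (cong (_^ d) e)))
    nonzero-factor : ∀ {s α : ℕ} → s * g ≡ α → α ≢ 0 → 1 ≤ s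
    nonzero-factor {zero}  e α≢0 = contradiction (sym e) α≢0
    nonzero-factor {suc s} e α≢0 = s≤s z≤n
    s≡1 : s ≡ 1
    s≡1 = squarefree-part {j′ = j′} {i = i} d 2≤d (nonzero-factor {s} α≡ (positive (2 * i) eα)) c refl sqf reduced
    t≡1 : t ≡ 1
    t≡1 = squarefree-part {j′ = j} {i = i′} d 2≤d (nonzero-factor {t} β≡ (positive (2 * i′) eβ)) (coprime-sym c) refl sqf′ (sym reduced)
    one-power : ∀ s → s ≡ 1 → s ^ d ≡ 1
    one-power _ refl = ^-zeroˡ d

  module _ (d₀ : ℕ) (divides? : ∀ i → Dec (suc (suc d₀) ∣ suc (2 * i))) where

    private
      d : ℕ
      d = suc (suc d₀)

      lem₁ : ∀ d₀ k → 2 * (suc (suc d₀) * suc k) ≡ suc (2 * k) * suc (suc d₀) + suc (suc d₀)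
      lem₁ = solve-∀
      lem₂ : ∀ H d₀ → suc (2 * H) + suc (suc d₀) ≡ 2 * suc H + suc d₀
      lem₂ = solve-∀
      lem₃ : ∀ H d₀ → suc (2 * H + suc d₀) ≡ suc (2 * H) + suc d₀
      lem₃ = solve-∀
      lem₄ : ∀ x → x + x ≡ 2 * x
      lem₄ = solve-∀

    -- Consecutive odd multiples of d differ by 2 d, beginning with d itself; the summand d - 1 is
    -- the rounding error, and it makes the induction close at each new multiple.
    count-multiples : ∀ H → 2 * (d * count divides? (downFrom H)) ≤ 2 * H + suc d₀
    count-multiples zero    = ≤-trans (≤-reflexive (cong (2 *_) (*-zeroʳ d))) z≤n
    count-multiples (suc H) with divides? H
    ... | no _  = ≤-trans (count-multiples H) (+-monoˡ-≤ (suc d₀) (*-monoʳ-≤ 2 (n≤1+n H)))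
    ... | yes (divides u e) with parity u
    ...   | inj₁ (k , refl) = contradiction (trans e (*-assoc 2 k d)) (odd≢even H (k * d))
    ...   | inj₂ (k , refl) = ≤-trans (*-monoʳ-≤ 2 (*-monoʳ-≤ d (s≤s c≤k)))
              (≤-reflexive (trans (lem₁ d₀ k) (trans (cong (_+ d) (sym e)) (lem₂ H d₀))))
      where
      c = count divides? (downFrom H)
      c≤k : c ≤ k
      c≤k = s≤s⁻¹ (*-cancelˡ-< (2 * d) c (suc k) (≤-trans (s≤s (≤-trans (≤-reflexive (*-assoc 2 d c)) (count-multiples H)))
        (≤-trans (≤-reflexive (trans (lem₃ H d₀) (cong (_+ suc d₀) e))) (≤-trans (+-monoʳ-≤ (suc (2 * k) * d) (n≤1+n (suc d₀)))
          (≤-reflexive (trans (sym (lem₁ d₀ k)) (sym (*-assoc 2 d (suc k)))))))))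

    -- A nonzero count c satisfies d ≤ d c, so the rounding error is absorbed by half of 2 d c.
    count-multiples′ : ∀ H → d * count divides? (downFrom H) ≤ 2 * H
    count-multiples′ H with count divides? (downFrom H) | count-multiples H
    ... | zero  | _ = ≤-trans (≤-reflexive (*-zeroʳ d)) z≤n
    ... | suc c | b = +-cancelʳ-≤ (d * suc c) _ _ (≤-trans (≤-reflexive (lem₄ (d * suc c))) (≤-trans b (+-monoʳ-≤ (2 * H)
          (≤-trans (n≤1+n (suc d₀)) (≤-trans (≤-reflexive (sym (*-identityʳ d))) (*-monoʳ-≤ d (s≤s z≤n)))))))

  count-multiples-≥2 : ∀ d H → 2 ≤ d → d * count (λ i → d ∣? suc (2 * i)) (downFrom H) ≤ 2 * H
  count-multiples-≥2 (suc zero)     H (s≤s ())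
  count-multiples-≥2 (suc (suc d₀)) H _ = count-multiples′ d₀ (λ i → suc (suc d₀) ∣? suc (2 * i)) H

  SquareDivisor : ℕ → ℕ → Set
  SquareDivisor i k = 1 ≤ k × suc (2 * k) * suc (2 * k) ∣ suc (2 * i)

  square-divisor? : ∀ i → Dec (∃ λ k → k < suc i × SquareDivisor i k)
  square-divisor? i = anyUpTo? (λ k → (1 ≤? k) ×-dec (suc (2 * k) * suc (2 * k) ∣? suc (2 * i))) (suc i)

  -- 0 marks a squarefree 2 i + 1. Otherwise the label is k + 1 ≥ 2 for a divisor (2 k + 1)², the
  -- range in which `weighted-popular` operates.
  label : ℕ → ℕ
  label i with square-divisor? i
  ... | yes (k , _) = suc k
  ... | no _        = 0

  label-suc : ∀ i k → label i ≡ suc k → k < suc i × SquareDivisor i k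
  label-suc i k e with square-divisor? i
  label-suc i k refl | yes (.k , p) = p

  label-0 : ∀ i → label i ≡ 0 → SquarefreeOdd (suc (2 * i))
  label-0 i e k 1≤k s²∣ with square-divisor? i
  ... | no none = none (k , s≤s (*-cancelˡ-≤ 2 (s≤s⁻¹ (≤-trans (m≤m*n (suc (2 * k)) (suc (2 * k))) (∣⇒≤ s²∣)))) , 1≤k , s²∣)

  -- Some (2 k + 1)² accounts for at least the share 1/(k (k + 1)) of the numbers that are not
  -- squarefree, yet it divides at most 2 H / (2 k + 1)² < H / (2 k (k + 1)) of the H odd numbers.
  -- Hence at most half are not squarefree, without estimating a sum of inverse squares.
  squarefree-many : ∀ H → H ≤ 2 * count (λ i → label i ≟ 0) (downFrom H)
  squarefree-many H = +-cancelʳ-≤ (2 * bad) _ _ (≤-trans (+-monoʳ-≤ H 2bad≤) (≤-reflexive (trans (cong₂ _+_ (sym len) (sym len)) (lem good bad))))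
    where
    xs = downFrom H
    bads = filter (λ i → ¬? (label i ≟ 0)) xs
    good = count (λ i → label i ≟ 0) xs
    bad  = length bads
    len : good + bad ≡ H
    len = trans (count-complement (λ i → label i ≟ 0) xs) (length-downFrom H)
    lem : ∀ g b → (g + b) + (g + b) ≡ 2 * g + 2 * b
    lem = solve-∀
    bads∈ : ∀ {i} → i ∈ bads → i < H × label i ≢ 0
    bads∈ i∈ = let a , b = ∈-filter⁻ (λ i → ¬? (label i ≟ 0)) {xs = xs} i∈ in ∈-downFrom⁻ a , b
    low : All (λ i → 2 ≤ label i) bads
    low = All.tabulate λ {i} i∈ → at-least-2 i (label i) refl (proj₂ (bads∈ i∈))
      where
      at-least-2 : ∀ i l → label i ≡ l → l ≢ 0 → 2 ≤ l
      at-least-2 i zero    e ne = contradiction refl ne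
      at-least-2 i (suc k) e _  = s≤s (proj₁ (proj₂ (label-suc i k e)))
    high : All (λ i → label i ≤ H) bads
    high = All.tabulate λ {i} i∈ → at-most i (label i) refl (proj₁ (bads∈ i∈))
      where
      at-most : ∀ i l → label i ≡ l → i < H → l ≤ H
      at-most i zero    e i<H = z≤n
      at-most i (suc k) e i<H = ≤-trans (proj₁ (label-suc i k e)) i<H
    2bad≤ : 2 * bad ≤ H
    2bad≤ with bad in eq
    ... | zero  = z≤n
    ... | suc b with weighted-popular H label bads low high (subst (0 <_) (sym eq) (s≤s z≤n))
    ...   | suc k , 2≤q , _ , big = *-cancelˡ-≤ 2 (≤-trans (*-monoʳ-≤ 2 (*-monoʳ-≤ 2 (≤-trans (≤-reflexive (sym eq)) big)))
              (≤-trans (≤-reflexive (lem′ k c₁)) (≤-trans (*-monoʳ-≤ (4 * (k * suc k)) (≤-trans (count-filter (λ i → label i ≟ suc k) (λ i → ¬? (label i ≟ 0)) xs) c≤c′))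
                (≤-trans (*-monoˡ-≤ c′ (≤-trans (n≤1+n _) (≤-reflexive (sym (lem″ k))))) (count-multiples-≥2 d H 2≤d)))))
      where
      d = suc (2 * k) * suc (2 * k)
      c₁ = count (λ i → label i ≟ suc k) bads
      c′ = count (λ i → d ∣? suc (2 * i)) xs
      lem′ : ∀ k c → 2 * (2 * (k * (suc k * c))) ≡ 4 * (k * suc k) * c
      lem′ = solve-∀
      lem″ : ∀ k → suc (2 * k) * suc (2 * k) ≡ suc (4 * (k * suc k))
      lem″ = solve-∀
      2≤d : 2 ≤ d
      2≤d = ≤-trans (s≤s (≤-trans (s≤s⁻¹ 2≤q) (m≤m+n k (k + 0)))) (m≤m*n (suc (2 * k)) (suc (2 * k)))
      c≤c′ : count (λ i → label i ≟ suc k) xs ≤ c′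
      c≤c′ = count-mono (λ i → label i ≟ suc k) (λ i → d ∣? suc (2 * i)) (λ {i} e → proj₂ (proj₂ (label-suc i k e))) xs

  unique-bounded : ∀ T (xs : List ℕ) → Unique xs → All (_< T) xs → length xs ≤ T
  unique-bounded T xs u b = ≮⇒≥ λ T<len → case (popular T 1 (λ x → x) xs b (subst (_< length xs) (sym (*-identityʳ T)) T<len))
    where
    two : ∀ c ys → Unique ys → All (_≡ c) ys → 1 < length ys → ⊥
    two c (x ∷ y ∷ ys) ((x≢y ∷ _) ∷ _) (x≡ ∷ y≡ ∷ _) _ = x≢y (trans x≡ (sym y≡))
    two c (x ∷ []) _ _ (s≤s ())
    case : (∃ λ c → c < T × 1 < count (_≟ c) xs) → ⊥
    case (c , _ , 1<) = two c (filter (_≟ c) xs) (Unique.filter⁺ (_≟ c) u) (All.all-filter (_≟ c) xs) 1<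

  coprime-product : ∀ {n u} ns → All (Coprime n) ns → n ∣ u * product ns → n ∣ u
  coprime-product {n} {u} []       []       d = subst (n ∣_) (*-identityʳ u) d
  coprime-product {n} {u} (k ∷ ns) (c ∷ cs) d = coprime-product ns cs (coprime-divisor c (subst (n ∣_) (lem u k (product ns)) d))
    where
    lem : ∀ u k p → u * (k * p) ≡ k * (u * p)
    lem = solve-∀

  product-∣ : ∀ {v} ns → All (_∣ v) ns → AllPairs Coprime ns → product ns ∣ v
  product-∣ {v} []       []        []       = 1∣ v
  product-∣ {v} (n ∷ ns) (n∣ ∷ ns∣) (c ∷ cs) with product-∣ ns ns∣ cs
  ... | divides u e with coprime-product {n} {u} ns c (subst (n ∣_) e n∣)
  ...   | divides w e′ = divides w (trans e (trans (cong (_* product ns) e′) (*-assoc w n (product ns))))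

  product-large : ∀ T {P : Pred ℕ 0ℓ} (P? : Decidable P) → (∀ {n} → P n → T ≤ n) → ∀ ns → All (1 ≤_) ns → T ^ count P? ns ≤ product ns
  product-large T P? p []       []        = ≤-refl
  product-large T P? p (n ∷ ns) (1≤n ∷ ns≥1) with P? n
  ... | no _   = ≤-trans (product-large T P? p ns ns≥1) (m≤n*m (product ns) n {{>-nonZero 1≤n}})
  ... | yes Pn = *-mono-≤ (p Pn) (product-large T P? p ns ns≥1)

  record IsExponent (y n : ℕ) : Set where
    field
      base   : ℕ
      1≤b    : 1 ≤ base
      2≤n    : 2 ≤ n
      power≡ : y ≡ base ^ n
  open IsExponent

  isExponent : ∀ {y} → PurePower y → ∃ (IsExponent y)
  isExponent (b , n , 1≤b , 2≤n , e) = n , record { base = b ; 1≤b = 1≤b ; 2≤n = 2≤n ; power≡ = e }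

  -- Put T = 2^a. At least 2 T of the odd j are squarefree. Their exponents are pairwise coprime and
  -- thus distinct, so at least T of them are at least T. The product is then at least T^T = 2^(a
  -- 2^a) ≥ 2^lam, although it divides the 2-adic valuation of x, which is below 2^lam.
  no-multiples : ∀ a lam x → 1 ≤ x → lam ≤ a * 2 ^ a → x < 2 ^ (2 ^ lam) → (∀ j → 1 ≤ j → j ≤ 2 ^ (3 + a) → PurePower (j * x)) → ⊥
  no-multiples a lam x 1≤x lam≤ x< pure with two-adic x 1≤x
  ... | v , k , x≡ = contradiction (<-≤-trans v<2^lam (≤-trans 2^lam≤product (∣⇒≤ {{≢-nonZero v≢0}} (product-∣ ns ns∣v ns-coprime)))) (<-irrefl refl)
    where
    H = 2 ^ (2 + a)
    j≤ : ∀ {i} → i < H → suc (2 * i) ≤ 2 ^ (3 + a)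
    j≤ {i} i<H = ≤-trans (≤-trans (n≤1+n _) (≤-reflexive (lem i))) (*-monoʳ-≤ 2 i<H)
      where
      lem : ∀ i → suc (suc (2 * i)) ≡ 2 * suc i
      lem = solve-∀
    exponents : ∀ i → i < H → ∃ (IsExponent (suc (2 * i) * x))
    exponents i i<H = isExponent (pure (suc (2 * i)) (s≤s z≤n) (j≤ i<H))
    exponent : ℕ → ℕ
    exponent i with i <? H
    ... | yes i<H = proj₁ (exponents i i<H)
    ... | no _    = 2
    exponent-spec : ∀ i → i < H → IsExponent (suc (2 * i) * x) (exponent i)
    exponent-spec i i<H with i <? H
    ... | no ≮H  = contradiction i<H ≮H
    ... | yes <H = proj₂ (exponents i <H)
    is = filter (λ i → label i ≟ 0) (downFrom H)
    is∈ : ∀ {i} → i ∈ is → i < H × SquarefreeOdd (suc (2 * i))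
    is∈ {i} i∈ = let p , q = ∈-filter⁻ (λ i → label i ≟ 0) {xs = downFrom H} i∈ in ∈-downFrom⁻ p , label-0 i q
    ns = map exponent is
    divides-v : ∀ i → i < H → exponent i ∣ v
    divides-v i i<H with exponent-spec i i<H
    ... | spec with odd-part-of-power v (proj₁ (odd-* i k)) (base spec) (exponent i) (1≤b spec)
          (trans (trans (cong (2 ^ v *_) (sym (proj₂ (odd-* i k)))) (trans (lem (2 ^ v) (suc (2 * i)) (suc (2 * k))) (cong (suc (2 * i) *_) (sym x≡)))) (power≡ spec))
      where
      lem : ∀ p j k → p * (j * k) ≡ j * (p * k)
      lem = solve-∀
    ...   | w , l , v≡ , _ = divides w v≡
    ns∣v : All (_∣ v) ns
    ns∣v = All.map⁺ (All.tabulate λ {i} i∈ → divides-v i (proj₁ (is∈ i∈)))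
    coprime-exponents : ∀ {i i′} → i ∈ is → i′ ∈ is → i ≢ i′ → Coprime (exponent i) (exponent i′)
    coprime-exponents {i} {i′} i∈ i′∈ i≢ {zero} (0∣ , _) = contradiction (≤-trans (2≤n (exponent-spec i (proj₁ (is∈ i∈)))) (≤-reflexive (0∣⇒≡0 0∣))) λ ()
    coprime-exponents i∈ i′∈ i≢ {suc zero} _ = refl
    coprime-exponents {i} {i′} i∈ i′∈ i≢ {suc (suc d)} (divides e₁ n≡ , divides e₂ n′≡) = contradiction
      (same-radical {x} {i} {i′} (base s₁ ^ e₁) (base s₂ ^ e₂) (suc (suc d)) 1≤x (s≤s (s≤s z≤n)) (proj₂ (is∈ i∈)) (proj₂ (is∈ i′∈))
        (trans (power≡ s₁) (trans (cong (base s₁ ^_) n≡) (sym (^-*-assoc (base s₁) e₁ (suc (suc d))))))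
        (trans (power≡ s₂) (trans (cong (base s₂ ^_) n′≡) (sym (^-*-assoc (base s₂) e₂ (suc (suc d))))))) i≢
      where
      s₁ = exponent-spec i (proj₁ (is∈ i∈))
      s₂ = exponent-spec i′ (proj₁ (is∈ i′∈))
    pairs : ∀ {js} → (∀ {i} → i ∈ js → i ∈ is) → Unique js → AllPairs Coprime (map exponent js)
    pairs sub []       = []
    pairs sub (i∉ ∷ u) = All.map⁺ (All.tabulate λ j∈ → coprime-exponents (sub (here refl)) (sub (there j∈)) (All.lookup i∉ j∈)) ∷ pairs (λ j∈ → sub (there j∈)) u
      where open import Data.List.Relation.Unary.Any using (here; there)
    ns-coprime : AllPairs Coprime ns
    ns-coprime = pairs (λ i∈ → i∈) (Unique.filter⁺ (λ i → label i ≟ 0) (Unique.downFrom⁺ H))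
    ns≥2 : All (2 ≤_) ns
    ns≥2 = All.map⁺ (All.tabulate λ {i} i∈ → 2≤n (exponent-spec i (proj₁ (is∈ i∈))))
    coprime⇒unique : ∀ {ns} → All (2 ≤_) ns → AllPairs Coprime ns → Unique ns
    coprime⇒unique []        []       = []
    coprime⇒unique (2≤ ∷ p) (c ∷ cs) = All.map (λ { c refl → contradiction (subst (2 ≤_) (c (∣-refl , ∣-refl)) 2≤) λ { (s≤s ()) } }) c ∷ coprime⇒unique p cs
    T = 2 ^ a
    smalls = filter (_<? T) ns
    length-ns : 2 * T ≤ length ns
    length-ns = *-cancelˡ-≤ 2 (≤-trans (squarefree-many H) (≤-reflexive (cong (2 *_) (sym (length-map exponent is)))))
    small-count : count (_<? T) ns ≤ T
    small-count = unique-bounded T smalls (Unique.filter⁺ (_<? T) (coprime⇒unique ns≥2 ns-coprime)) (All.all-filter (_<? T) ns)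
    large-count : T ≤ count (λ n → ¬? (n <? T)) ns
    large-count = +-cancelˡ-≤ T _ _ (≤-trans (≤-trans (≤-reflexive (lem T)) length-ns) (≤-trans (≤-reflexive (sym (count-complement (_<? T) ns))) (+-monoˡ-≤ _ small-count)))
      where
      lem : ∀ x → x + x ≡ 2 * x
      lem = solve-∀
    2^lam≤product : 2 ^ lam ≤ product ns
    2^lam≤product = ≤-trans (^-monoʳ-≤ 2 lam≤) (≤-trans (≤-reflexive (sym (^-*-assoc 2 a T)))
      (≤-trans (^-monoʳ-≤ T {{m^n≢0 2 a}} large-count) (product-large T (λ n → ¬? (n <? T)) ≮⇒≥ ns (All.map (≤-trans (s≤s z≤n)) ns≥2))))
    v<2^lam : v < 2 ^ lam
    v<2^lam = ≰⇒> λ ≤v → contradiction (<-≤-trans x< (≤-trans (^-monoʳ-≤ 2 ≤v) (≤-trans (m≤m*n (2 ^ v) (suc (2 * k))) (≤-reflexive (sym x≡))))) (<-irrefl refl)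
    -- Divisibility bounds the product only if v is nonzero. For odd x the number 2 x has valuation
    -- 1 and is not a power.
    v≢0 : v ≢ 0
    v≢0 refl with pure 2 (s≤s z≤n) (*-monoʳ-≤ 2 (m^n>0 2 (2 + a)))
    ... | b , n , 1≤b , 2≤n , e with odd-part-of-power 1 k b n 1≤b (trans (trans (cong (2 *_) (trans (sym (*-identityˡ _)) (sym x≡))) refl) e)
    ...   | w , _ , 1≡wn , _ = contradiction (≤-trans 2≤n (∣⇒≤ (divides w 1≡wn))) λ { (s≤s ()) }

-- Two sets of sums whose pairwise sums are powers

module Grid where

  open Counting
  open Multiples using (parity; odd≢even; ^-distribʳ-*)
  open TwoAdic hiding (parity; odd-*; odd-^)
  open Points using (module TooManyPoints; residue-injective; odd≢0)
  open Cyclic using (val)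
  open import Data.Bool using (true; false)
  open import Data.Empty using (⊥)
  open import Data.Fin using (Fin; zero; suc)
  open import Data.Integer as ℤ using (ℤ; +_; 1ℤ) renaming (_^_ to _^ℤ_)
  import Data.Integer.Properties as ℤ
  open import Data.Integer.Tactic.RingSolver using () renaming (solve-∀ to solveℤ-∀)
  open import Data.List using (List; []; _∷_; length; filter; lookup)
  open import Data.List.Membership.Propositional using (_∈_)
  open import Data.List.Membership.Propositional.Properties using (∈-filter⁻; ∈-lookup)
  open import Data.List.Relation.Unary.All as All using (All; []; _∷_)
  import Data.List.Relation.Unary.All.Properties as All
  open import Data.List.Relation.Unary.Any using (here)
  open import Data.List.Relation.Unary.Unique.Propositional using (Unique)
  import Data.List.Relation.Unary.Unique.Propositional.Properties as Unique
  open import Data.Nat hiding (parity)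
  open import Data.Nat.DivMod using (_%_; _/_; m%n<n; m≡m%n+[m/n]*n; m/n*n≤m)
  open import Data.Nat.Properties
  open import Data.Nat.Tactic.RingSolver using (solve-∀)
  open import Data.Product using (∃; ∃₂; _×_; _,_; proj₁; proj₂)
  open import Data.Sum using (_⊎_; inj₁; inj₂)
  open import Function using (Injective)
  open import Relation.Binary.PropositionalEquality
  open import Relation.Nullary using (Dec; yes; no; contradiction)
  open import Relation.Nullary.Decidable using (_⊎-dec_)

  -- Every power with exponent at least 2 is a square or has an odd exponent. These are the cases in
  -- which q-th roots of odd numbers are controlled modulo 4.
  ExponentCase : ℕ → Set
  ExponentCase q = q ≡ 2 ⊎ ∃ λ j → q ≡ suc (2 * j)

  exponentCase? : ∀ q → Dec (ExponentCase q)
  exponentCase? q = (q ≟ 2) ⊎-dec odd? (parity q)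
    where
    odd? : (∃ λ k → q ≡ 2 * k) ⊎ (∃ λ k → q ≡ suc (2 * k)) → Dec (∃ λ j → q ≡ suc (2 * j))
    odd? (inj₂ p)       = yes p
    odd? (inj₁ (k , e)) = no λ { (j , e′) → odd≢even j k (trans (sym e′) e) }

  record Colour (u q : ℕ) : Set where
    constructor colours
    field
      ≥2   : 2 ≤ q
      case : ExponentCase q
      root : ∃ λ b → b < suc u × b ^ q ≡ u
  open Colour

  colour? : ∀ u q → Dec (Colour u q)
  colour? u q with 2 ≤? q | exponentCase? q | anyUpTo? (λ b → b ^ q ≟ u) (suc u)
  ... | yes a | yes b | yes c = yes (colours a b c)
  ... | no ¬a | _     | _     = no (λ p → ¬a (≥2 p))
  ... | yes _ | no ¬b | _     = no (λ p → ¬b (case p))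
  ... | yes _ | yes _ | no ¬c = no (λ p → ¬c (root p))

  -- with the junk value 2 if u is not a power
  colour : ℕ → ℕ → ℕ
  colour K u with anyUpTo? (colour? u) (suc K)
  ... | yes (q , _) = q
  ... | no _        = 2

  colour-range : ∀ K → 2 ≤ K → ∀ u → 2 ≤ colour K u × colour K u ≤ K
  colour-range K 2≤K u with anyUpTo? (colour? u) (suc K)
  ... | yes (q , s≤s q≤K , c) = ≥2 c , q≤K
  ... | no _                  = ≤-refl , 2≤K

  colour-spec : ∀ K u q → q ≤ K → Colour u q → Colour u (colour K u)
  colour-spec K u q q≤K c with anyUpTo? (colour? u) (suc K)
  ... | yes (_ , _ , c′) = c′
  ... | no none          = contradiction (q , s≤s q≤K , c) none

  OddPower : ℕ → ℕ → Set
  OddPower K u = u < 2 ^ K × ∃₂ λ l n → 2 ≤ n × u ≡ suc (2 * l) ^ n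

  ≤-power : ∀ b q → 1 ≤ b → 1 ≤ q → b ≤ b ^ q
  ≤-power b q 1≤b 1≤q = subst (_≤ b ^ q) (^-identityʳ b) (^-monoʳ-≤ b {{>-nonZero 1≤b}} 1≤q)

  -- The base 1 puts no bound on its exponent, so 1 is treated as a square. A base of at least 3
  -- forces n ≤ K by u < 2^K, and an even n is replaced by 2.
  power-colour : ∀ K u → 2 ≤ K → OddPower K u → Colour u (colour K u)
  power-colour K u 2≤K (_ , zero , n , _ , e) = colour-spec K u 2 2≤K
    (colours ≤-refl (inj₁ refl) (1 , s≤s (≤-reflexive (sym (trans e (^-zeroˡ n)))) , sym (trans e (^-zeroˡ n))))
  power-colour K u 2≤K (u< , suc l , n , 2≤n , refl) with parity n
  ... | inj₁ (k , refl) = colour-spec K u 2 2≤K (colours ≤-refl (inj₁ refl) (b , s≤s (≤-trans (≤-power b 2 (m^n>0 _ k) (s≤s z≤n)) (≤-reflexive e)) , e))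
    where
    b = suc (2 * suc l) ^ k
    e : b ^ 2 ≡ suc (2 * suc l) ^ (2 * k)
    e = trans (^-*-assoc (suc (2 * suc l)) k 2) (cong (suc (2 * suc l) ^_) (*-comm k 2))
  ... | inj₂ (k , n≡) = colour-spec K u n n≤K (colours 2≤n (inj₂ (k , n≡)) (suc (2 * suc l) , s≤s (≤-power _ n (s≤s z≤n) (≤-trans (s≤s z≤n) 2≤n)) , refl))
    where
    n≤K : n ≤ K
    n≤K = ≮⇒≥ λ K<n → <-irrefl refl (<-trans u< (<-≤-trans (^-monoʳ-< 2 (s≤s (s≤s z≤n)) K<n) (^-monoˡ-≤ n (s≤s (s≤s z≤n)))))

  pos-^ : ∀ b q → (+ b) ^ℤ q ≡ + (b ^ q)
  pos-^ b zero    = refl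
  pos-^ b (suc q) = trans (cong (+ b ℤ.*_) (pos-^ b q)) (sym (ℤ.pos-* b (b ^ q)))

  odd-ℕ : ∀ k → Odd (+ suc (2 * k))
  odd-ℕ k = + k , cong (λ x → 1ℤ ℤ.+ x) (ℤ.pos-* 2 k)

  odd-≡ : ∀ {n} k → n ≡ suc (2 * k) → Odd (+ n)
  odd-≡ k refl = odd-ℕ k

  odd⇒ℕ : ∀ u → Odd (+ u) → ∃ λ k → u ≡ suc (2 * k)
  odd⇒ℕ u (j , e) with parity u
  ... | inj₂ p = p
  ... | inj₁ (k , refl) = contradiction (trans (sym (ℤ.+-inverseʳ (+ (2 * k)))) (trans (cong (ℤ._- + (2 * k)) e)
          (trans (cong (λ x → 1ℤ ℤ.+ + 2 ℤ.* j ℤ.- x) (ℤ.pos-* 2 k)) (lem j (+ k))))) (λ e → odd≢0 (j ℤ.- + k , refl) (sym e))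
    where
    lem : ∀ j k → 1ℤ ℤ.+ + 2 ℤ.* j ℤ.- + 2 ℤ.* k ≡ 1ℤ ℤ.+ + 2 ℤ.* (j ℤ.- k)
    lem = solveℤ-∀

  odd-mod : ∀ {a b} → a ≡ b [mod + 2 ] → Odd b → Odd a
  odd-mod (by k e) (j , refl) = j ℤ.+ k , trans e (lem j k)
    where
    lem : ∀ j k → 1ℤ ℤ.+ + 2 ℤ.* j ℤ.+ k ℤ.* + 2 ≡ 1ℤ ℤ.+ + 2 ℤ.* (j ℤ.+ k)
    lem = solveℤ-∀

  -- Chosen so that the class of the root depends on u modulo 4 only. For odd q and odd b one has
  -- b^q ≡ b modulo 4, because b² ≡ 1.
  residue-mod-4 : ∀ {q} → ExponentCase q → ℕ → ℤ
  residue-mod-4 (inj₁ _) u = 1ℤ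
  residue-mod-4 (inj₂ _) u = + u

  odd-square : ∀ {a} → Odd a → a ℤ.* a ≡ 1ℤ [mod + 4 ]
  odd-square (k , refl) = by (k ℤ.+ k ℤ.* k) (lem k)
    where
    lem : ∀ k → (1ℤ ℤ.+ + 2 ℤ.* k) ℤ.* (1ℤ ℤ.+ + 2 ℤ.* k) ≡ 1ℤ ℤ.+ (k ℤ.+ k ℤ.* k) ℤ.* + 4
    lem = solveℤ-∀

  -- For q = 2 the sign of the root is chosen so that it is 1 modulo 4.
  signed-root : ∀ {q u} (c : ExponentCase q) b → b ^ q ≡ u → Odd (+ b) →
    ∃ λ μ → (μ ^ℤ q ≡ + u) × Odd μ × (μ ≡ residue-mod-4 c u [mod + 4 ])
  signed-root {u = u} (inj₁ refl) b e (j , b≡) with TwoAdic.parity j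
  ... | inj₁ (i , refl) = + b , trans (pos-^ b 2) (cong +_ e) , (+ 2 ℤ.* i , b≡) , by i (trans b≡ (lem i))
    where
    lem : ∀ i → 1ℤ ℤ.+ + 2 ℤ.* (+ 2 ℤ.* i) ≡ 1ℤ ℤ.+ i ℤ.* + 4
    lem = solveℤ-∀
  ... | inj₂ (i , refl) = ℤ.- + b , trans (square-neg (+ b)) (trans (pos-^ b 2) (cong +_ e))
      , (ℤ.- (+ 2 ℤ.+ + 2 ℤ.* i) , trans (cong ℤ.-_ b≡) (lem₁ i)) , by (ℤ.- (1ℤ ℤ.+ i)) (trans (cong ℤ.-_ b≡) (lem₂ i))
    where
    square-neg : ∀ b → (ℤ.- b) ℤ.* ((ℤ.- b) ℤ.* 1ℤ) ≡ b ℤ.* (b ℤ.* 1ℤ)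
    square-neg = solveℤ-∀
    lem₁ : ∀ i → ℤ.- (1ℤ ℤ.+ + 2 ℤ.* (1ℤ ℤ.+ + 2 ℤ.* i)) ≡ 1ℤ ℤ.+ + 2 ℤ.* (ℤ.- (+ 2 ℤ.+ + 2 ℤ.* i))
    lem₁ = solveℤ-∀
    lem₂ : ∀ i → ℤ.- (1ℤ ℤ.+ + 2 ℤ.* (1ℤ ℤ.+ + 2 ℤ.* i)) ≡ 1ℤ ℤ.+ (ℤ.- (1ℤ ℤ.+ i)) ℤ.* + 4
    lem₂ = solveℤ-∀
  signed-root {u = u} (inj₂ (j , refl)) b e odd-b = + b , trans (pos-^ b (suc (2 * j))) (cong +_ e) , odd-b
    , modsym (modtrans (≡⇒mod (sym (trans (pos-^ b (suc (2 * j))) (cong +_ e)))) (modtrans (mod*ˡ (+ b) (even-power j)) (≡⇒mod (ℤ.*-identityʳ (+ b)))))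
    where
    even-power : ∀ j → (+ b) ^ℤ (2 * j) ≡ 1ℤ [mod + 4 ]
    even-power j = modtrans (≡⇒mod (sym (ℤ.^-*-assoc (+ b) 2 j))) (modtrans (mod^ j (modtrans (≡⇒mod (cong (+ b ℤ.*_) (ℤ.*-identityʳ (+ b)))) (odd-square odd-b)))
      (≡⇒mod (ℤ.^-zeroˡ j)))

  odd-root : ∀ b q {k} → 1 ≤ q → b ^ q ≡ suc (2 * k) → Odd (+ b)
  odd-root b (suc q) {k} _ e with parity b
  ... | inj₂ (l , refl) = odd-ℕ l
  ... | inj₁ (l , refl) = contradiction (trans (sym e) (*-assoc 2 l ((2 * l) ^ q))) (odd≢even k (l * (2 * l) ^ q))

  least-power : ∀ q T → 2 ≤ q → 2 ≤ T → ∃ λ r → T ≤ q ^ suc r × q ^ r < T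
  least-power q T 2≤q 2≤T = search T (grows T)
    where
    grows : ∀ n → n ≤ q ^ n
    grows zero    = z≤n
    grows (suc n) = ≤-trans (+-mono-≤ {1} {q ^ n} {n} {q ^ n} (m^n>0 q {{>-nonZero (≤-trans (s≤s z≤n) 2≤q)}} n) (grows n))
      (≤-trans (≤-reflexive (lem (q ^ n))) (*-monoˡ-≤ (q ^ n) 2≤q))
      where
      lem : ∀ x → x + x ≡ 2 * x
      lem = solve-∀
    search : ∀ n → T ≤ q ^ n → ∃ λ r → T ≤ q ^ suc r × q ^ r < T
    search zero    T≤ = contradiction (≤-trans 2≤T T≤) λ { (s≤s ()) }
    search (suc n) T≤ with T ≤? q ^ n
    ... | yes T≤′ = search n T≤′
    ... | no T≰   = n , T≤ , ≰⇒> T≰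

  -- After fixing residue classes all h + y have the same parity, possibly even. Adding the odd c₀
  -- to all of them repairs this.
  shift-choice : ∀ y₀ h₀ c₀ → Odd (+ c₀) → ∃ λ b → Odd (+ (y₀ + val b * c₀ + h₀))
  shift-choice y₀ h₀ c₀ odd-c₀ with TwoAdic.parity (+ (y₀ + h₀))
  ... | inj₂ o = false , subst (λ x → Odd (+ (x + h₀))) (sym (+-identityʳ y₀)) o
  ... | inj₁ (j , e) = true , subst (λ x → Odd (+ x)) (lem y₀ c₀ h₀)
          (odd-mod {+ (y₀ + h₀ + c₀)} {+ c₀} (by j (trans (cong (ℤ._+ + c₀) e) (trans (ℤ.+-comm (+ 2 ℤ.* j) (+ c₀)) (cong (λ x → + c₀ ℤ.+ x) (ℤ.*-comm (+ 2) j))))) odd-c₀)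
    where
    lem : ∀ y c h → y + h + c ≡ y + 1 * c + h
    lem = solve-∀

  odd-sum : ∀ {y h} y₀ s h₀ → y % 16 ≡ y₀ % 16 → h % 2 ≡ h₀ % 2 → Odd (+ (y₀ + s + h₀)) → ∃ λ j → y + s + h ≡ suc (2 * j)
  odd-sum {y} {h} y₀ s h₀ y≡ h≡ o = odd⇒ℕ (y + s + h) (odd-mod {+ (y + s + h)} {+ (y₀ + s + h₀)} (mod+ {+ (y + s)} {+ (y₀ + s)} {+ h} {+ h₀}
    (mod+ {+ y} {+ y₀} {+ s} {+ s} (mod-weaken {s = + 8} {+ 2} (residue-injective 16 {+ y} {+ y₀} y≡)) modrefl) (residue-injective 2 {+ h} {+ h₀} h≡)) o)

  nonempty : ∀ {A : Set} (xs : List A) → 0 < length xs → ∃ λ x → x ∈ xs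
  nonempty (x ∷ _) _ = x , here refl

  module NoGrid (lam : ℕ) (1≤lam : 1 ≤ lam) (large : 16 * (lam * lam) < 2 ^ lam) where

    K : ℕ
    K = 2 ^ lam

    16lam≤K : 16 * lam ≤ K
    16lam≤K = ≤-trans (*-monoʳ-≤ 16 (≤-trans (≤-reflexive (sym (*-identityˡ lam))) (*-monoˡ-≤ lam 1≤lam))) (<⇒≤ large)

    16≤K : 16 ≤ K
    16≤K = ≤-trans (*-monoʳ-≤ 16 1≤lam) 16lam≤K

    2≤K : 2 ≤ K
    2≤K = ≤-trans (s≤s (s≤s z≤n)) 16≤K

    instance
      K-nonZero : NonZero K
      K-nonZero = >-nonZero (≤-trans (s≤s z≤n) 2≤K)

    -- r is least with q^r ≥ K³, so D lies between K³ and K⁴: large enough for the pigeonhole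
    -- condition N² < D, and small enough for K^5 points to satisfy the elimination.
    module Exponent (q : ℕ) (2≤q : 2 ≤ q) (q≤K : q ≤ K) where

      private
        least = least-power q (K ^ 3) 2≤q (≤-trans 2≤K (≤-power K 3 (≤-trans (s≤s z≤n) 2≤K) (s≤s z≤n)))

      r r₀ D : ℕ
      r₀ = proj₁ least
      r  = suc r₀
      D  = q ^ r

      K³≤D : K ^ 3 ≤ D
      K³≤D = proj₁ (proj₂ least)

      D≤K⁴ : D ≤ K ^ 4
      D≤K⁴ = *-mono-≤ q≤K (<⇒≤ (proj₂ (proj₂ least)))

      r≤3lam : r ≤ 3 * lam
      r≤3lam = ≰⇒> λ 3lam≤r₀ → <-irrefl refl (<-≤-trans (proj₂ (proj₂ least))
        (≤-trans (≤-reflexive (trans (^-*-assoc 2 lam 3) (cong (2 ^_) (*-comm lam 3)))) (≤-trans (^-monoʳ-≤ 2 3lam≤r₀) (^-monoˡ-≤ r₀ 2≤q))))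

      n : ℕ
      -- 2^n = K^4 (2^K)^r bounds the number D of terms times the largest monomial.
      n = K * r + 4 * lam

      -- Since r ≤ 3 lam, N is at most 4 lam K, and 16 lam² < K is the hypothesis `large`.
      N²<D : suc (suc n) * suc (suc n) < D
      N²<D = <-≤-trans (≤-<-trans (*-mono-≤ N≤ N≤) (≤-<-trans (≤-reflexive (lem₁ lam K)) (*-monoˡ-< (K * K) {{m*n≢0 K K}} large)))
        (≤-trans (≤-reflexive (lem₂ K)) K³≤D)
        where
        lem₁ : ∀ lam K → (4 * lam * K) * (4 * lam * K) ≡ 16 * (lam * lam) * (K * K)
        lem₁ = solve-∀
        lem₂ : ∀ K → K * (K * K) ≡ K * (K * (K * 1))
        lem₂ = solve-∀
        lem₃ : ∀ K lam x → suc (suc (K * (3 * lam) + x)) ≡ K * (3 * lam) + (2 + x)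
        lem₃ = solve-∀
        lem₄ : ∀ K lam → K * (3 * lam) + lam * K ≡ 4 * lam * K
        lem₄ = solve-∀
        small : 2 + 4 * lam ≤ lam * K
        small = ≤-trans (+-monoˡ-≤ (4 * lam) (*-monoʳ-≤ 2 1≤lam)) (≤-trans (≤-reflexive (lem₅ lam))
          (*-monoʳ-≤ lam (≤-trans (s≤s (s≤s (s≤s (s≤s (s≤s (s≤s z≤n)))))) 16≤K)))
          where
          lem₅ : ∀ lam → 2 * lam + 4 * lam ≡ lam * 6
          lem₅ = solve-∀
        N≤ : suc (suc n) ≤ 4 * lam * K
        N≤ = ≤-trans (s≤s (s≤s (+-monoˡ-≤ (4 * lam) (*-monoʳ-≤ K r≤3lam))))
          (≤-trans (≤-reflexive (lem₃ K lam (4 * lam))) (≤-trans (+-monoʳ-≤ (K * (3 * lam)) small) (≤-reflexive (lem₄ K lam))))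

      size : D * (2 ^ K) ^ r < 2 ^ suc n
      size = ≤-<-trans (*-monoˡ-≤ ((2 ^ K) ^ r) D≤K⁴) (≤-<-trans (≤-reflexive eq) (^-monoʳ-< 2 (s≤s (s≤s z≤n)) (n<1+n n)))
        where
        eq : K ^ 4 * (2 ^ K) ^ r ≡ 2 ^ n
        eq = trans (cong₂ _*_ (trans (^-*-assoc 2 lam 4) (cong (2 ^_) (*-comm lam 4))) (^-*-assoc 2 K r))
          (trans (sym (^-distribˡ-+-* 2 (4 * lam) (K * r))) (cong (2 ^_) (+-comm (4 * lam) (K * r))))

      many : D * r + r ≤ K ^ 5
      many = ≤-trans (≤-reflexive (lem₁ D r)) (≤-trans (*-mono-≤ r≤3lam (+-mono-≤ {1} {K ^ 4} (m^n>0 K 4) D≤K⁴))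
        (≤-trans (≤-reflexive (lem₂ lam (K ^ 4))) (*-monoˡ-≤ (K ^ 4) (≤-trans (*-monoˡ-≤ lam {6} {16} (s≤s (s≤s (s≤s (s≤s (s≤s (s≤s z≤n))))))) 16lam≤K))))
        where
        lem₁ : ∀ D r → D * r + r ≡ r * (1 + D)
        lem₁ = solve-∀
        lem₂ : ∀ lam x → 3 * lam * (x + x) ≡ 6 * lam * x
        lem₂ = solve-∀

      D³≤K¹² : (q ^ 3) ^ r ≤ K ^ 12
      D³≤K¹² = ≤-trans (≤-reflexive (trans (^-*-assoc q 3 r) (trans (cong (q ^_) (*-comm 3 r)) (sym (^-*-assoc q r 3)))))
        (≤-trans (^-monoˡ-≤ 3 D≤K⁴) (≤-reflexive (^-*-assoc K 4 3)))

      module _ (case-q : ExponentCase q) (s : ℕ) (h : Fin r → ℕ) (h-injective : Injective _≡_ _≡_ h)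
        (y₀ : ℕ) (ys : List ℕ) (unique : Unique (y₀ ∷ ys)) (long : K ^ 5 < length (y₀ ∷ ys))
        (mod-16 : ∀ i → lookup (y₀ ∷ ys) i % 16 ≡ y₀ % 16)
        (colouring : ∀ i k → Colour (lookup (y₀ ∷ ys) i + s + h k) q)
        (odd : ∀ i k → ∃ λ j → lookup (y₀ ∷ ys) i + s + h k ≡ suc (2 * j))
        (bounded : ∀ i k → lookup (y₀ ∷ ys) i + s + h k < 2 ^ K) where

        private
          y : Fin (suc (length ys)) → ℕ
          y = lookup (y₀ ∷ ys)
          T : Fin (suc (length ys)) → ℤ
          T i = + (y i + s)
          T-injective : Injective _≡_ _≡_ T
          T-injective {i} {j} e = lookup-injective unique i j (+-cancelʳ-≡ s (y i) (y j) (ℤ.+-injective e))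
          signed : ∀ i k → ∃ λ μ → (μ ^ℤ q ≡ + (y i + s + h k)) × Odd μ × (μ ≡ residue-mod-4 case-q (y i + s + h k) [mod + 4 ])
          signed i k = let b , _ , e = root (colouring i k) ; j , u≡ = odd i k in
            signed-root case-q b e (odd-root b q {j} (≤-trans (s≤s z≤n) 2≤q) (trans e u≡))
          y-mod : ∀ i → + y i ≡ + y₀ [mod + 16 ]
          y-mod i = residue-injective 16 {+ y i} {+ y₀} (mod-16 i)
          T-mod : ∀ i → T i ≡ T zero [mod + 16 ]
          T-mod i = mod+ (y-mod i) (modrefl {+ s})
          target-mod : ∀ c i k → residue-mod-4 {q} c (y i + s + h k) ≡ residue-mod-4 {q} c (y zero + s + h k) [mod + 4 ]
          target-mod (inj₁ _) i k = modrefl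
          target-mod (inj₂ _) i k = mod-weaken {s = + 4} {+ 4} (mod+ (T-mod i) (modrefl {+ h k}))

          q-suc : ∃ λ q′ → suc q′ ≡ q
          q-suc = pred q , q-suc-≥ 2≤q
            where
            q-suc-≥ : ∀ {q} → 2 ≤ q → suc (pred q) ≡ q
            q-suc-≥ (s≤s _) = refl

          q-case : ExponentCase q → q ≡ 2 ⊎ Odd (+ q)
          q-case (inj₁ e)          = inj₁ e
          q-case (inj₂ (j , refl)) = inj₂ (odd-ℕ j)

        many-points-impossible : ⊥
        many-points-impossible = go (proj₁ q-suc) (proj₂ q-suc)
          where
          go : ∀ q′ → suc q′ ≡ q → ⊥
          go q′ e = TooManyPoints.impossible q′ r K n (length ys) (s≤s z≤n) (λ k → + h k) (λ e → h-injective (ℤ.+-injective e))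
            (subst (λ q → q ≡ 2 ⊎ Odd (+ q)) (sym e) (q-case case-q))
            (subst (λ q → suc (suc n) * suc (suc n) < q ^ r) (sym e) N²<D)
            (subst (λ q → q ^ r * (2 ^ K) ^ r < 2 ^ suc n) (sym e) size)
            T T-injective (subst (λ q → q ^ r * r + r ≤ suc (length ys)) (sym e) (≤-trans many (<⇒≤ long)))
            (λ i k → proj₁ (signed i k))
            (λ i k → trans (cong (proj₁ (signed i k) ^ℤ_) e) (proj₁ (proj₂ (signed i k))))
            (λ i k → proj₁ (proj₂ (proj₂ (signed i k))))
            (λ i k → modtrans (proj₂ (proj₂ (proj₂ (signed i k)))) (modtrans (target-mod case-q i k) (modsym (proj₂ (proj₂ (proj₂ (signed zero k)))))))
            T-mod (λ i k → <⇒≤ (bounded i k))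

    module Monochromatic (q s : ℕ) (2≤q : 2 ≤ q) (q≤K : q ≤ K) (rows cols : List ℕ) (u-rows : Unique rows) (u-cols : Unique cols)
      (n₁-large : 8 * K ^ 19 < length rows) (cols-long : K ^ 17 < length cols)
      (same-residue : ∀ {y y′} → y ∈ cols → y′ ∈ cols → y % 16 ≡ y′ % 16)
      (odd-entry : ∀ {h y} → h ∈ rows → y ∈ cols → ∃ λ j → y + s + h ≡ suc (2 * j))
      (entry : ∀ {h y} → h ∈ rows → y ∈ cols → OddPower K (y + s + h))
      (count-q : ∀ {y} → y ∈ cols → length rows ≤ pred q * (q * count (λ h → colour K (y + s + h) ≟ q) rows)) where

      open Exponent q 2≤q q≤K

      private
        instance
          q-nonZero : NonZero q
          q-nonZero = >-nonZero (≤-trans (s≤s z≤n) 2≤q)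
          q³-nonZero : NonZero (q ^ 3)
          q³-nonZero = m^n≢0 q 3
        n₁ = length rows
        0<cols : 0 < length cols
        0<cols = ≤-<-trans z≤n cols-long
        x t : ℕ
        -- A column has at least n₁ / (q (q - 1)) rows of colour q. As q ≥ 2, half of n₁ / q²
        -- already covers n₁ / q³; the other half pays for the r rows to be discarded and the
        -- rounding.
        x = n₁ / (q ^ 3)
        t = suc x

        r≤K : r ≤ K
        r≤K = ≤-trans r≤3lam (≤-trans (*-monoˡ-≤ lam {3} {16} (s≤s (s≤s (s≤s z≤n)))) 16lam≤K)

        enough-rows : ∀ {y} → y ∈ cols → t + r ≤ count (λ h → colour K (y + s + h) ≟ q) rows
        enough-rows {y} y∈ = ≮⇒≥ λ c< → <-irrefl refl (<-≤-trans n₁-large (≤-trans (n₁≤ (s≤s⁻¹ c<)) (*-mono-≤ {2} {8} (s≤s (s≤s z≤n)) (^-monoʳ-≤ K (s≤s (s≤s (s≤s (z≤n {16}))))))))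
          where
          c = count (λ h → colour K (y + s + h) ≟ q) rows
          n₁≤ : c ≤ x + r → n₁ ≤ 2 * K ^ 3
          n₁≤ c≤ = +-cancelˡ-≤ n₁ _ _ (≤-trans (≤-trans (≤-reflexive (lem₁ n₁))
              (*-monoʳ-≤ 2 (≤-trans (count-q y∈) (*-mono-≤ (pred[n]≤n {q}) (*-monoʳ-≤ q c≤)))))
            (≤-trans (≤-reflexive (lem₂ q x r)) (+-mono-≤
              (≤-trans (*-monoˡ-≤ (q * q * x) 2≤q) (≤-trans (≤-reflexive (lem₃ q x)) (m/n*n≤m n₁ (q ^ 3))))
              (*-monoʳ-≤ 2 (≤-trans (*-mono-≤ (*-mono-≤ q≤K q≤K) r≤K) (≤-reflexive (lem₄ K)))))))
            where
            lem₁ : ∀ n → n + n ≡ 2 * n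
            lem₁ = solve-∀
            lem₂ : ∀ q x r → 2 * (q * (q * (x + r))) ≡ 2 * (q * q * x) + 2 * (q * q * r)
            lem₂ = solve-∀
            lem₃ : ∀ q x → q * (q * q * x) ≡ x * (q * (q * (q * 1)))
            lem₃ = solve-∀
            lem₄ : ∀ K → K * K * K ≡ K * (K * (K * 1))
            lem₄ = solve-∀

        clique = biclique {R = λ h y → colour K (y + s + h) ≡ q} (λ h y → colour K (y + s + h) ≟ q) _≟_ n₁ t r rows cols ≤-refl
          u-rows u-cols
          0<cols (s≤s z≤n) (All.tabulate enough-rows)
        h = proj₁ clique
        h-injective = proj₁ (proj₂ clique)
        h∈ = proj₁ (proj₂ (proj₂ clique))
        zs = proj₁ (proj₂ (proj₂ (proj₂ clique)))
        u-zs = proj₁ (proj₂ (proj₂ (proj₂ (proj₂ clique))))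
        zs-good = proj₁ (proj₂ (proj₂ (proj₂ (proj₂ (proj₂ clique)))))
        zs-bound = proj₂ (proj₂ (proj₂ (proj₂ (proj₂ (proj₂ clique)))))

        n₁≤tq³ : n₁ ≤ t * q ^ 3
        n₁≤tq³ = ≤-trans (≤-reflexive (m≡m%n+[m/n]*n n₁ (q ^ 3))) (+-monoˡ-≤ (x * q ^ 3) (<⇒≤ (m%n<n n₁ (q ^ 3))))

        -- The r greedy steps lose at most (n₁ / t)^r ≤ q^(3r) = D³.
        cols≤ : length cols ≤ K ^ 12 * length zs
        cols≤ = *-cancelˡ-≤ (t ^ r) {{m^n≢0 t r}} (≤-trans (≤-reflexive (*-comm (t ^ r) (length cols))) (≤-trans zs-bound
          (≤-trans (*-monoˡ-≤ (length zs) (≤-trans (^-monoˡ-≤ r n₁≤tq³) (≤-trans (≤-reflexive (^-distribʳ-* t (q ^ 3) r)) (*-monoʳ-≤ (t ^ r) D³≤K¹²))))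
            (≤-reflexive (*-assoc (t ^ r) (K ^ 12) (length zs))))))

        zs-long : K ^ 5 < length zs
        zs-long = *-cancelˡ-< (K ^ 12) (K ^ 5) (length zs) (<-≤-trans (≤-<-trans (≤-reflexive (sym (^-distribˡ-+-* K 12 5))) cols-long) cols≤)

        finish : ∀ zs → Unique zs → K ^ 5 < length zs → (∀ {y} → y ∈ zs → y ∈ cols × (∀ k → colour K (y + s + h k) ≡ q)) → ⊥
        finish (z ∷ zs) u long good = many-points-impossible (case (coloured zero zero)) s h h-injective z zs u long
          (λ i → same-residue (col i) (col zero)) coloured
          (λ i k → odd-entry (h∈ k) (col i)) (λ i k → proj₁ (entry (h∈ k) (col i)))
          where
          col : ∀ i → lookup (z ∷ zs) i ∈ cols
          col i = proj₁ (good (∈-lookup i))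
          coloured : ∀ i k → Colour (lookup (z ∷ zs) i + s + h k) q
          coloured i k = subst (Colour (lookup (z ∷ zs) i + s + h k)) (proj₂ (good (∈-lookup i)) k) (power-colour K (lookup (z ∷ zs) i + s + h k) 2≤K (entry (h∈ k) (col i)))

      impossible : ⊥
      impossible = finish zs u-zs zs-long zs-good

    module Coloured (s : ℕ) (rows cols : List ℕ) (u-rows : Unique rows) (u-cols : Unique cols)
      (rows-long : 8 * K ^ 19 < length rows) (cols-long : K ^ 19 < length cols)
      (same-residue : ∀ {y y′} → y ∈ cols → y′ ∈ cols → y % 16 ≡ y′ % 16)
      (odd-entry : ∀ {h y} → h ∈ rows → y ∈ cols → ∃ λ j → y + s + h ≡ suc (2 * j))
      (entry : ∀ {h y} → h ∈ rows → y ∈ cols → OddPower K (y + s + h)) where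

      Popular : ℕ → ℕ → Set
      Popular y q = 2 ≤ q × q ≤ K × length rows ≤ pred q * (q * count (λ h → colour K (y + s + h) ≟ q) rows)

      best : ∀ y → ∃ (Popular y)
      best y = weighted-popular K (λ h → colour K (y + s + h)) rows
        (All.tabulate λ {h} _ → proj₁ (colour-range K 2≤K (y + s + h))) (All.tabulate λ {h} _ → proj₂ (colour-range K 2≤K (y + s + h)))
        (≤-<-trans z≤n rows-long)

      Q : ℕ → ℕ
      Q y = proj₁ (best y)

      -- A common popular colour for the columns is chosen once, at the cost of a factor K + 1 ≤ K².
      enough-columns : suc K * K ^ 17 < length cols
      enough-columns = ≤-<-trans (≤-trans (*-monoˡ-≤ (K ^ 17) suc-K≤) (≤-reflexive (*-assoc K K (K ^ 17)))) cols-long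
        where
        double : ∀ K → K + K ≡ 2 * K
        double = solve-∀
        suc-K≤ : suc K ≤ K * K
        suc-K≤ = ≤-trans (+-monoˡ-≤ K (≤-trans (s≤s z≤n) 2≤K)) (≤-trans (≤-reflexive (double K)) (*-monoˡ-≤ K 2≤K))

      impossible : ⊥
      impossible = go (popular (suc K) (K ^ 17) Q cols (All.tabulate λ {y} _ → s≤s (proj₁ (proj₂ (proj₂ (best y))))) enough-columns)
        where
        go : (∃ λ q → q < suc K × K ^ 17 < count (λ y → Q y ≟ q) cols) → ⊥
        go (q , _ , long) = Monochromatic.impossible q s (proj₁ (spec y∈)) (proj₁ (proj₂ (spec y∈))) rows cols′ u-rows
            (Unique.filter⁺ (λ y → Q y ≟ q) u-cols) rows-long long
            (λ y∈ y′∈ → same-residue (proj₁ (sub y∈)) (proj₁ (sub y′∈))) (λ h∈ y∈ → odd-entry h∈ (proj₁ (sub y∈)))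
            (λ h∈ y∈ → entry h∈ (proj₁ (sub y∈))) (λ y∈ → proj₂ (proj₂ (spec y∈)))
          where
          cols′ = filter (λ y → Q y ≟ q) cols
          sub : ∀ {y} → y ∈ cols′ → y ∈ cols × Q y ≡ q
          sub = ∈-filter⁻ (λ y → Q y ≟ q) {xs = cols}
          spec : ∀ {y} → y ∈ cols′ → Popular y q
          spec {y} y∈ = subst (Popular y) (proj₂ (sub y∈)) (proj₂ (best y))
          y∈ = proj₂ (nonempty cols′ (≤-<-trans z≤n long))

    -- Fixing h modulo 2 and y modulo 16 gives all entries one parity, which a shift by c₀ makes odd
    -- if necessary. The class modulo 16 is the 2-adic disc of `TooManyPoints`.
    no-grid : ∀ rows cols → Unique rows → Unique cols → 16 * K ^ 19 < length rows → 16 * K ^ 19 < length cols → ∀ c₀ → Odd (+ c₀) →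
      (∀ {h y} → h ∈ rows → y ∈ cols → ∀ b → (∃ λ j → y + val b * c₀ + h ≡ suc (2 * j)) → OddPower K (y + val b * c₀ + h)) → ⊥
    no-grid rows cols u-rows u-cols long-rows long-cols c₀ odd-c₀ powers = go
        (popular 2 (8 * K ^ 19) (_% 2) rows (All.tabulate λ {h} _ → m%n<n h 2) (subst (_< length rows) (*-assoc 2 8 (K ^ 19)) long-rows))
        (popular 16 (K ^ 19) (_% 16) cols (All.tabulate λ {y} _ → m%n<n y 16) long-cols)
      where
      go : (∃ λ ε → ε < 2 × 8 * K ^ 19 < count (λ h → h % 2 ≟ ε) rows) → (∃ λ η → η < 16 × K ^ 19 < count (λ y → y % 16 ≟ η) cols) → ⊥
      go (ε , _ , rows-long) (η , _ , cols-long) = shifted (nonempty rows′ (≤-<-trans z≤n rows-long)) (nonempty cols′ (≤-<-trans z≤n cols-long))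
        where
        rows′ = filter (λ h → h % 2 ≟ ε) rows
        cols′ = filter (λ y → y % 16 ≟ η) cols
        rows∈ : ∀ {h} → h ∈ rows′ → h ∈ rows × h % 2 ≡ ε
        rows∈ = ∈-filter⁻ (λ h → h % 2 ≟ ε) {xs = rows}
        cols∈ : ∀ {y} → y ∈ cols′ → y ∈ cols × y % 16 ≡ η
        cols∈ = ∈-filter⁻ (λ y → y % 16 ≟ η) {xs = cols}
        shifted : (∃ λ h → h ∈ rows′) → (∃ λ y → y ∈ cols′) → ⊥
        shifted (h₀ , h₀∈) (y₀ , y₀∈) with shift-choice y₀ h₀ c₀ odd-c₀
        ... | b , o = Coloured.impossible (val b * c₀) rows′ cols′ (Unique.filter⁺ (λ h → h % 2 ≟ ε) u-rows) (Unique.filter⁺ (λ y → y % 16 ≟ η) u-cols)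
            rows-long cols-long (λ y∈ y′∈ → trans (proj₂ (cols∈ y∈)) (sym (proj₂ (cols∈ y′∈)))) odd-entry
            (λ h∈ y∈ → powers (proj₁ (rows∈ h∈)) (proj₁ (cols∈ y∈)) b (odd-entry h∈ y∈))
          where
          odd-entry : ∀ {h y} → h ∈ rows′ → y ∈ cols′ → ∃ λ j → y + val b * c₀ + h ≡ suc (2 * j)
          odd-entry {h} {y} h∈ y∈ = odd-sum {y} {h} y₀ (val b * c₀) h₀ (trans (proj₂ (cols∈ y∈)) (sym (proj₂ (cols∈ y₀∈))))
            (trans (proj₂ (rows∈ h∈)) (sym (proj₂ (rows∈ h₀∈)))) o

-- Subset sums as masks, subfamilies and lists of distinct sums

module SubsetSums where

  open import Defs using (PurePower; subsetSum; Admissible)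
  open Cyclic using (val; total; module MaskSums)
  open import Data.Bool using (Bool; true; false)
  open import Data.Fin using (Fin; zero; suc; _↑ˡ_; _↑ʳ_; inject≤; punchIn)
  open import Data.Fin.Properties using (_≟_; suc-injective; inject≤-injective; punchIn-injective; punchInᵢ≢i)
  open import Data.Fin.Subset using (Nonempty)
  open import Data.List using (List; []; _∷_; _++_; map; length; deduplicate; lookup)
  open import Data.List.Membership.Propositional using (_∈_)
  open import Data.List.Membership.Propositional.Properties using (∈-++⁺ˡ; ∈-++⁺ʳ; ∈-++⁻; ∈-map⁺; ∈-map⁻; ∈-deduplicate⁺; ∈-deduplicate⁻)
  open import Data.List.Relation.Unary.Any as Any using (here)
  open import Data.List.Relation.Unary.Any.Properties using (lookup-index)
  open import Data.List.Relation.Unary.Unique.Propositional using (Unique)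
  open import Data.Nat hiding (_≟_)
  import Data.Nat as ℕ
  open import Data.List.Relation.Unary.Unique.DecPropositional.Properties ℕ._≟_ using (deduplicate-!)
  open import Data.Nat.Properties hiding (_≟_; suc-injective)
  open import Data.Product using (∃; _×_; _,_; proj₁; proj₂)
  open import Data.Sum using (inj₁; inj₂)
  open import Data.Vec using (tabulate)
  open import Data.Vec.Properties using (lookup∘tabulate; lookup⇒[]=)
  open import Function using (Injective; _∘_)
  open import Relation.Binary.PropositionalEquality
  open import Relation.Nullary using (yes; no; contradiction)

  total-cong : ∀ {n} {A B : Fin n → ℕ} {p q : Fin n → Bool} → (∀ i → A i ≡ B i) → (∀ i → p i ≡ q i) → total A p ≡ total B q
  total-cong {zero}  e f = refl
  total-cong {suc n} e f = cong₂ _+_ (cong₂ (λ b x → val b * x) (f zero) (e zero)) (total-cong (e ∘ suc) (f ∘ suc))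

  total-scale : ∀ {n} c (A : Fin n → ℕ) p → total (λ i → c * A i) p ≡ c * total A p
  total-scale {zero}  c A p = sym (*-zeroʳ c)
  total-scale {suc n} c A p = trans (cong₂ _+_ (trans (sym (*-assoc (val (p zero)) c (A zero))) (trans (cong (_* A zero) (*-comm (val (p zero)) c)) (*-assoc c (val (p zero)) (A zero))))
    (total-scale c (A ∘ suc) (p ∘ suc))) (sym (*-distribˡ-+ c (val (p zero) * A zero) (total (A ∘ suc) (p ∘ suc))))

  total-splitAt : ∀ m {n} (A : Fin (m + n) → ℕ) p → total A p ≡ total (λ i → A (i ↑ˡ n)) (λ i → p (i ↑ˡ n)) + total (λ i → A (m ↑ʳ i)) (λ i → p (m ↑ʳ i))
  total-splitAt zero    A p = refl
  total-splitAt (suc m) A p = trans (cong (val (p zero) * A zero +_) (total-splitAt m (A ∘ suc) (p ∘ suc))) (sym (+-assoc (val (p zero) * A zero) _ _))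

  total-empty : ∀ {n} (A : Fin n → ℕ) → total A (λ _ → false) ≡ 0
  total-empty {zero}  A = refl
  total-empty {suc n} A = total-empty (A ∘ suc)

  total≡subsetSum : ∀ {n} (A : Fin n → ℕ) p → total A p ≡ subsetSum A (tabulate p)
  total≡subsetSum {zero}  A p = refl
  total≡subsetSum {suc n} A p with p zero
  ... | true  = cong₂ _+_ (+-identityʳ (A zero)) (total≡subsetSum (A ∘ suc) (p ∘ suc))
  ... | false = total≡subsetSum (A ∘ suc) (p ∘ suc)

  total-nonempty : ∀ {n} (A : Fin n → ℕ) p → 1 ≤ total A p → ∃ λ i → p i ≡ true
  total-nonempty {suc n} A p 1≤ with p zero in e
  ... | true  = zero , e
  ... | false = let i , e′ = total-nonempty (A ∘ suc) (p ∘ suc) 1≤ in suc i , e′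

  -- The form of `Admissible` for Boolean masks. Positivity of the sum expresses that the mask is
  -- nonempty, and the property passes to subfamilies by `PowerSums-∘`.
  PowerSums : ∀ {n} → ℕ → (Fin n → ℕ) → Set
  PowerSums {n} N A = ∀ (p : Fin n → Bool) → 1 ≤ total A p → PurePower (total A p) × total A p ≤ N

  admissible⇒PowerSums : ∀ {N d} {a : Fin d → ℕ} → Admissible N d a → PowerSums N a
  admissible⇒PowerSums {N} {d} {a} (_ , _ , sums) p 1≤ = subst (λ x → PurePower x × x ≤ N) (sym (total≡subsetSum a p)) (proj₁ (sums (tabulate p) nonempty) , proj₂ (proj₂ (sums (tabulate p) nonempty)))
    where
    nonempty : Nonempty (tabulate p)
    nonempty = let i , e = total-nonempty a p 1≤ in i , lookup⇒[]= i (tabulate p) (trans (lookup∘tabulate p i) e)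

  update : ∀ {d} → (Fin d → Bool) → Fin d → Bool → Fin d → Bool
  update p i b j with j ≟ i
  ... | yes _ = b
  ... | no _  = p j

  total-update : ∀ {d} (a : Fin d → ℕ) p i b → p i ≡ false → total a (update p i b) ≡ val b * a i + total a p
  total-update {suc d} a p zero b e rewrite e = cong (val b * a zero +_) (total-cong {A = a ∘ suc} (λ _ → refl) (λ j → refl))
  total-update {suc d} a p (suc i) b e = trans (cong (val (p zero) * a zero +_) (trans (total-cong {A = a ∘ suc} (λ _ → refl) update-suc) (total-update (a ∘ suc) (p ∘ suc) i b e)))
    (swap (val (p zero) * a zero) (val b * a (suc i)) (total (a ∘ suc) (p ∘ suc)))
    where
    swap : ∀ x y z → x + (y + z) ≡ y + (x + z)
    swap x y z = trans (sym (+-assoc x y z)) (trans (cong (_+ z) (+-comm x y)) (+-assoc y x z))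
    update-suc : ∀ j → update p (suc i) b (suc j) ≡ update (p ∘ suc) i b j
    update-suc j with j ≟ i
    ... | yes _ = refl
    ... | no _  = refl

  image : ∀ {k d} → (Fin k → Fin d) → (Fin k → Bool) → Fin d → Bool
  image {zero}  σ p = λ _ → false
  image {suc k} σ p = update (image (σ ∘ suc) (p ∘ suc)) (σ zero) (p zero)

  image-outside : ∀ {k d} (σ : Fin k → Fin d) p j → (∀ i → σ i ≢ j) → image σ p j ≡ false
  image-outside {zero}  σ p j _ = refl
  image-outside {suc k} σ p j outside with j ≟ σ zero
  ... | yes e = contradiction (sym e) (outside zero)
  ... | no _  = image-outside (σ ∘ suc) (p ∘ suc) j (outside ∘ suc)

  total-image : ∀ {k d} (a : Fin d → ℕ) (σ : Fin k → Fin d) → Injective _≡_ _≡_ σ → ∀ p → total a (image σ p) ≡ total (a ∘ σ) p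
  total-image {zero}  a σ inj p = total-empty a
  total-image {suc k} a σ inj p = trans (total-update a (image (σ ∘ suc) (p ∘ suc)) (σ zero) (p zero)
      (image-outside (σ ∘ suc) (p ∘ suc) (σ zero) (λ i e → contradiction (inj e) λ ())))
    (cong (val (p zero) * a (σ zero) +_) (total-image a (σ ∘ suc) (λ e → suc-injective (inj e)) (p ∘ suc)))

  PowerSums-∘ : ∀ {N k d} {a : Fin d → ℕ} (σ : Fin k → Fin d) → Injective _≡_ _≡_ σ → PowerSums N a → PowerSums N (a ∘ σ)
  PowerSums-∘ {N} {a = a} σ inj sums p 1≤ = subst (λ x → PurePower x × x ≤ N) (total-image a σ inj p)
    (sums (image σ p) (subst (1 ≤_) (sym (total-image a σ inj p)) 1≤))

  sums : ∀ {n} → (Fin n → ℕ) → List ℕ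
  sums {zero}  A = 0 ∷ []
  sums {suc n} A = sums (A ∘ suc) ++ map (A zero +_) (sums (A ∘ suc))

  total∈sums : ∀ {n} (A : Fin n → ℕ) p → total A p ∈ sums A
  total∈sums {zero}  A p = here refl
  total∈sums {suc n} A p with p zero
  ... | true  = ∈-++⁺ʳ (sums (A ∘ suc)) (subst (λ x → x + total (A ∘ suc) (p ∘ suc) ∈ map (A zero +_) (sums (A ∘ suc))) (sym (+-identityʳ (A zero)))
                  (∈-map⁺ (A zero +_) (total∈sums (A ∘ suc) (p ∘ suc))))
  ... | false = ∈-++⁺ˡ (total∈sums (A ∘ suc) (p ∘ suc))

  sums-total : ∀ {n} (A : Fin n → ℕ) {v} → v ∈ sums A → ∃ λ p → v ≡ total A p
  sums-total {zero}  A (here refl) = (λ ()) , refl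
  sums-total {suc n} A v∈ with ∈-++⁻ (sums (A ∘ suc)) v∈
  ... | inj₁ v∈ˡ = let p , e = sums-total (A ∘ suc) v∈ˡ in (λ { zero → false ; (suc i) → p i }) , e
  ... | inj₂ v∈ʳ with ∈-map⁻ (A zero +_) v∈ʳ
  ...   | w , w∈ , refl = let p , e = sums-total (A ∘ suc) w∈ in (λ { zero → true ; (suc i) → p i }) , cong₂ _+_ (sym (+-identityʳ (A zero))) e

  distinct-sums : ∀ {n} → (Fin n → ℕ) → List ℕ
  distinct-sums A = deduplicate ℕ._≟_ (sums A)

  distinct-sums-unique : ∀ {n} (A : Fin n → ℕ) → Unique (distinct-sums A)
  distinct-sums-unique A = deduplicate-! (sums A)

  distinct-sums-total : ∀ {n} (A : Fin n → ℕ) {v} → v ∈ distinct-sums A → ∃ λ p → v ≡ total A p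
  distinct-sums-total A v∈ = sums-total A (∈-deduplicate⁻ ℕ._≟_ (sums A) v∈)

  few-distinct-sums : ∀ {n B} (A : Fin n → ℕ) m M → 2 ^ m ≡ suc B → 1 ≤ B → (∀ i → 1 ≤ A i) → length (distinct-sums A) ≤ M →
    M ^ m * B ^ n < suc B ^ n → ∃ λ x → 1 ≤ x × (∀ i → i ≤ 2 ^ m → ∃ λ p → total A p ≡ i * x)
  few-distinct-sums {n} A m M 2^m≡ 1≤B A≥1 few = MaskSums.few-sums A m 2^m≡ 1≤B A≥1 M (λ p → inject≤ (Any.index (member p)) few) sound
    where
    member : ∀ p → total A p ∈ distinct-sums A
    member p = ∈-deduplicate⁺ ℕ._≟_ (total∈sums A p)
    sound : ∀ p q → inject≤ (Any.index (member p)) few ≡ inject≤ (Any.index (member q)) few → total A p ≡ total A q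
    sound p q e = trans (lookup-index (member p)) (trans (cong (lookup (distinct-sums A)) (inject≤-injective few few _ _ e)) (sym (lookup-index (member q))))

  -- Brings the element of least 2-adic valuation to index 0, where the odd shift is expected.
  choose : ∀ {d k} → Fin (suc d) → k ≤ d → Fin (suc k) → Fin (suc d)
  choose i k≤d zero    = i
  choose i k≤d (suc j) = punchIn i (inject≤ j k≤d)

  choose-injective : ∀ {d k} (i : Fin (suc d)) (k≤d : k ≤ d) → Injective _≡_ _≡_ (choose i k≤d)
  choose-injective i k≤d {zero}  {zero}   e = refl
  choose-injective i k≤d {zero}  {suc j}  e = contradiction (sym e) (punchInᵢ≢i i (inject≤ j k≤d))
  choose-injective i k≤d {suc j} {zero}   e = contradiction e (punchInᵢ≢i i (inject≤ j k≤d))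
  choose-injective i k≤d {suc j} {suc j′} e = cong suc (inject≤-injective k≤d k≤d j j′ (punchIn-injective i _ _ e))

  minimal : ∀ {n} (f : Fin (suc n) → ℕ) → ∃ λ i → ∀ j → f i ≤ f j
  minimal {zero}  f = zero , λ { zero → ≤-refl }
  minimal {suc n} f with minimal (f ∘ suc)
  ... | i , min with f zero ≤? f (suc i)
  ...   | yes le = zero , λ { zero → ≤-refl ; (suc j) → ≤-trans le (min j) }
  ...   | no nle = suc i , λ { zero → <⇒≤ (≰⇒> nle) ; (suc j) → min j }

-- Two blocks of the family and the choice of parameters

open import Defs
open Cyclic using (val; total)
open Multiples using (two-adic; odd-part-of-power; no-multiples; ^-distribʳ-*)
open Grid using (OddPower; odd-≡; module NoGrid)
open SubsetSums
open import Data.Bool using (Bool; false)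
open import Data.Empty using (⊥)
open import Data.Fin using (Fin; zero; suc; splitAt; _↑ˡ_; _↑ʳ_)
open import Data.Fin.Properties using (splitAt-↑ˡ; splitAt-↑ʳ)
open import Data.List using (length)
open import Data.Nat
open import Data.Nat.Logarithm using (⌊log₂_⌋; ⌊log₂⌋-mono-≤; ⌊log₂[2^n]⌋≡n)
open import Data.Nat.Properties
open import Data.Nat.Tactic.RingSolver using (solve-∀)
open import Data.Product using (Σ; ∃; ∃₂; _×_; _,_; proj₁; proj₂)
open import Data.Sum using ([_,_]′)
open import Data.Unit using (tt)
open import Function using (_∘_)
open import Relation.Binary.PropositionalEquality
open import Relation.Nullary using (yes; no)

module TwoBlocks (lam a n B : ℕ) (1≤lam : 1 ≤ lam) (large : 16 * (lam * lam) < 2 ^ lam) (lam≤ : lam ≤ a * 2 ^ a)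
  (2^m≡ : 2 ^ (3 + a) ≡ suc B) (1≤B : 1 ≤ B) (n-large : (16 * (2 ^ lam) ^ 19) ^ (3 + a) * B ^ n < suc B ^ n)
  (N : ℕ) (N< : N < 2 ^ (2 ^ lam)) (v : ℕ) (A C : Fin (suc (n + n)) → ℕ) (A≡ : ∀ i → A i ≡ 2 ^ v * C i) (C≥1 : ∀ i → 1 ≤ C i)
  (c : ℕ) (C₀-odd : C zero ≡ suc (2 * c)) (powers : PowerSums N A) where

  private
    C₁ C₂ : Fin n → ℕ
    C₁ i = C (suc (i ↑ˡ n))
    C₂ i = C (suc (n ↑ʳ i))

    mask : Bool → (Fin n → Bool) → (Fin n → Bool) → Fin (suc (n + n)) → Bool
    mask b p₁ p₂ zero    = b
    mask b p₁ p₂ (suc i) = [ p₁ , p₂ ]′ (splitAt n i)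

    total-mask : ∀ b p₁ p₂ → total A (mask b p₁ p₂) ≡ 2 ^ v * (val b * C zero + (total C₁ p₁ + total C₂ p₂))
    total-mask b p₁ p₂ = trans (total-cong {p = mask b p₁ p₂} A≡ (λ _ → refl)) (trans (total-scale (2 ^ v) C (mask b p₁ p₂))
      (cong (λ x → 2 ^ v * (val b * C zero + x)) (trans (total-splitAt n (C ∘ suc) (mask b p₁ p₂ ∘ suc))
        (cong₂ _+_ (total-cong {A = C₁} (λ _ → refl) (λ i → cong [ p₁ , p₂ ]′ (splitAt-↑ˡ n i n)))
          (total-cong {A = C₂} (λ _ → refl) (λ i → cong [ p₁ , p₂ ]′ (splitAt-↑ʳ n n i)))))))

    positive : ∀ {x} → 1 ≤ x → 1 ≤ 2 ^ v * x
    positive 1≤x = *-mono-≤ (m^n>0 2 v) 1≤x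

    -- The multiples j x are sums in the block of quotients. Multiplied by 2^v they become sums of
    -- the family, so 2^v x is the number all of whose multiples are powers.
    block-sums : ∀ D → (∀ p → ∃ λ p′ → total A p′ ≡ 2 ^ v * total D p) → (∀ i → 1 ≤ D i) → length (distinct-sums {n} D) ≤ 16 * (2 ^ lam) ^ 19 → ⊥
    block-sums D lift D≥1 few = go (few-distinct-sums D (3 + a) (16 * (2 ^ lam) ^ 19) 2^m≡ 1≤B D≥1 few n-large)
      where
      go : (∃ λ x → 1 ≤ x × (∀ i → i ≤ 2 ^ (3 + a) → ∃ λ p → total D p ≡ i * x)) → ⊥
      go (x , 1≤x , multiples) = no-multiples a lam (2 ^ v * x) (positive 1≤x) lam≤
          (≤-<-trans (subst (_≤ N) (*-identityˡ (2 ^ v * x)) (proj₂ (power 1 ≤-refl (m^n>0 2 (3 + a))))) N<) (λ j 1≤j j≤ → proj₁ (power j 1≤j j≤))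
        where
        lem : ∀ p j x → p * (j * x) ≡ j * (p * x)
        lem = solve-∀
        power : ∀ j → 1 ≤ j → j ≤ 2 ^ (3 + a) → PurePower (j * (2 ^ v * x)) × j * (2 ^ v * x) ≤ N
        power j 1≤j j≤ = subst (λ y → PurePower y × y ≤ N) e (powers p′ (subst (1 ≤_) (sym e) (*-mono-≤ 1≤j (positive 1≤x))))
          where
          p = proj₁ (multiples j j≤)
          p′ = proj₁ (lift p)
          e : total A p′ ≡ j * (2 ^ v * x)
          e = trans (proj₂ (lift p)) (trans (cong (2 ^ v *_) (proj₂ (multiples j j≤))) (lem (2 ^ v) j x))

    lift₁ : ∀ p → ∃ λ p′ → total A p′ ≡ 2 ^ v * total C₁ p
    lift₁ p = mask false p (λ _ → false) , trans (total-mask false p (λ _ → false))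
      (cong (2 ^ v *_) (trans (cong (total C₁ p +_) (total-empty C₂)) (+-identityʳ (total C₁ p))))

    lift₂ : ∀ p → ∃ λ p′ → total A p′ ≡ 2 ^ v * total C₂ p
    lift₂ p = mask false (λ _ → false) p , trans (total-mask false (λ _ → false) p)
      (cong (2 ^ v *_) (cong (_+ total C₂ p) (total-empty C₁)))

    -- By unique factorisation the odd part of a k-th power is a k-th power, so for an odd sum u the
    -- factor 2^v can be removed without changing the exponent.
    odd-power : ∀ b p₁ p₂ → (∃ λ j → total C₂ p₂ + val b * C zero + total C₁ p₁ ≡ suc (2 * j)) →
      OddPower (2 ^ lam) (total C₂ p₂ + val b * C zero + total C₁ p₁)
    odd-power b p₁ p₂ (j , odd) = go (powers (mask b p₁ p₂) (subst (1 ≤_) (sym e) (positive (subst (1 ≤_) (sym odd) (s≤s z≤n)))))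
      where
      u = total C₂ p₂ + val b * C zero + total C₁ p₁
      lem : ∀ p x y z → p * (x + (y + z)) ≡ p * (z + x + y)
      lem = solve-∀
      e : total A (mask b p₁ p₂) ≡ 2 ^ v * u
      e = trans (total-mask b p₁ p₂) (lem (2 ^ v) (val b * C zero) (total C₁ p₁) (total C₂ p₂))
      go : PurePower (total A (mask b p₁ p₂)) × total A (mask b p₁ p₂) ≤ N → OddPower (2 ^ lam) u
      go ((β , k , 1≤β , 2≤k , β^k) , ≤N) = ≤-<-trans (≤-trans (m≤n*m u (2 ^ v) {{m^n≢0 2 v}}) (subst (_≤ N) e ≤N)) N<
        , root (odd-part-of-power v j β k 1≤β (trans (cong (2 ^ v *_) (sym odd)) (trans (sym e) β^k)))
        where
        root : (∃₂ λ w l → v ≡ w * k × suc (2 * j) ≡ suc (2 * l) ^ k) → ∃₂ λ l k → 2 ≤ k × u ≡ suc (2 * l) ^ k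
        root (w , l , _ , eq) = l , k , 2≤k , trans odd eq

    powers′ : ∀ {h y} b → (∃ λ p₁ → h ≡ total C₁ p₁) → (∃ λ p₂ → y ≡ total C₂ p₂) → (∃ λ j → y + val b * C zero + h ≡ suc (2 * j)) →
      OddPower (2 ^ lam) (y + val b * C zero + h)
    powers′ b (p₁ , refl) (p₂ , refl) = odd-power b p₁ p₂

  impossible : ⊥
  impossible with length (distinct-sums C₁) ≤? 16 * (2 ^ lam) ^ 19 | length (distinct-sums C₂) ≤? 16 * (2 ^ lam) ^ 19
  ... | yes few | _       = block-sums C₁ lift₁ (λ i → C≥1 (suc (i ↑ˡ n))) few
  ... | no _    | yes few = block-sums C₂ lift₂ (λ i → C≥1 (suc (n ↑ʳ i))) few
  ... | no many₁ | no many₂ = NoGrid.no-grid lam 1≤lam large (distinct-sums C₁) (distinct-sums C₂) (distinct-sums-unique C₁) (distinct-sums-unique C₂)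
        (≰⇒> many₁) (≰⇒> many₂) (C zero) (odd-≡ c C₀-odd)
        (λ h∈ y∈ b → powers′ b (distinct-sums-total C₁ h∈) (distinct-sums-total C₂ y∈))

-- Dividing by the least power of 2 that occurs keeps all quotients integral and makes one of them
-- odd; that element becomes the parity shift.
family-impossible : ∀ lam a n B → 1 ≤ lam → 16 * (lam * lam) < 2 ^ lam → lam ≤ a * 2 ^ a → 2 ^ (3 + a) ≡ suc B → 1 ≤ B →
  (16 * (2 ^ lam) ^ 19) ^ (3 + a) * B ^ n < suc B ^ n → ∀ N → N < 2 ^ (2 ^ lam) →
  ∀ {d} (f : Fin (suc d) → ℕ) → (∀ i → 1 ≤ f i) → PowerSums N f → n + n ≤ d → ⊥
family-impossible lam a n B 1≤lam large lam≤ 2^m≡ 1≤B n-large N N< {d} f f≥1 powers n+n≤d = go (minimal v)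
  where
  v : Fin (suc d) → ℕ
  v i = proj₁ (two-adic (f i) (f≥1 i))
  odd : Fin (suc d) → ℕ
  odd i = suc (2 * proj₁ (proj₂ (two-adic (f i) (f≥1 i))))
  f≡ : ∀ i → f i ≡ 2 ^ v i * odd i
  f≡ i = proj₂ (proj₂ (two-adic (f i) (f≥1 i)))
  go : (∃ λ i → ∀ j → v i ≤ v j) → ⊥
  go (i , v-min) = TwoBlocks.impossible lam a n B 1≤lam large lam≤ 2^m≡ 1≤B n-large N N< (v i) (f ∘ σ) (C ∘ σ) (C≡ ∘ σ) (C≥1 ∘ σ)
    (proj₁ (proj₂ (two-adic (f i) (f≥1 i)))) (trans (cong (λ x → 2 ^ x * odd i) (n∸n≡0 (v i))) (*-identityˡ (odd i))) (PowerSums-∘ {a = f} σ (choose-injective i n+n≤d) powers)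
    where
    σ = choose i n+n≤d
    C : Fin (suc d) → ℕ
    C j = 2 ^ (v j ∸ v i) * odd j
    C≡ : ∀ j → f j ≡ 2 ^ v i * C j
    C≡ j = trans (f≡ j) (trans (cong (λ x → 2 ^ x * odd j) (sym (m+[n∸m]≡n (v-min j)))) (trans (cong (_* odd j) (^-distribˡ-+-* 2 (v i) (v j ∸ v i))) (*-assoc (2 ^ v i) _ (odd j))))
    C≥1 : ∀ j → 1 ≤ C j
    C≥1 j = *-mono-≤ (m^n>0 2 (v j ∸ v i)) (s≤s z≤n)

-- Bernoulli's inequality for (1 + 1/B)^k with denominators cleared.
bernoulli : ∀ B k → B ^ k * (B + k) ≤ suc B ^ k * B
bernoulli B zero    = ≤-reflexive (cong (1 *_) (+-identityʳ B))
bernoulli B (suc k) = ≤-trans (≤-reflexive (lem₁ B k (B ^ k))) (≤-trans (+-monoʳ-≤ (B * (B ^ k * (B + k))) (*-monoʳ-≤ (B ^ k) (m≤m+n B k)))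
  (≤-trans (≤-reflexive (lem₂ B (B ^ k * (B + k)))) (≤-trans (*-monoʳ-≤ (suc B) (bernoulli B k)) (≤-reflexive (sym (*-assoc (suc B) (suc B ^ k) B))))))
  where
  lem₁ : ∀ B k x → B * x * (B + suc k) ≡ B * (x * (B + k)) + x * B
  lem₁ = solve-∀
  lem₂ : ∀ B y → B * y + y ≡ suc B * y
  lem₂ = solve-∀

doubling : ∀ B → 1 ≤ B → 2 * B ^ B ≤ suc B ^ B
doubling B 1≤B = *-cancelʳ-≤ (2 * B ^ B) (suc B ^ B) B {{>-nonZero 1≤B}} (≤-trans (≤-reflexive (lem B (B ^ B))) (bernoulli B B))
  where
  lem : ∀ B x → 2 * x * B ≡ x * (B + B)
  lem = solve-∀

-- By `doubling` each group of B elements gains a factor 2 in (1 + 1/B)^n, so μ m + 1 groups exceed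
-- the 2^(μ m) classes of bit sums.
block-size : ∀ B m μ → 1 ≤ B → (2 ^ μ) ^ m * B ^ (B * suc (μ * m)) < suc B ^ (B * suc (μ * m))
block-size B m μ 1≤B = <-≤-trans (*-monoˡ-< (B ^ (B * e)) {{m^n≢0 B (B * e) {{>-nonZero 1≤B}}}}
    (≤-<-trans (≤-reflexive (^-*-assoc 2 μ m)) (^-monoʳ-< 2 (s≤s (s≤s z≤n)) (n<1+n (μ * m)))))
  (≤-trans (≤-reflexive (trans (cong (2 ^ e *_) (sym (^-*-assoc B B e))) (sym (^-distribʳ-* 2 (B ^ B) e))))
    (≤-trans (^-monoˡ-≤ e (doubling B 1≤B)) (≤-reflexive (^-*-assoc (suc B) B e))))
  where
  e = suc (μ * m)

-- It starts with 16 · 11² = 1936 < 2^11, whence the threshold `loglog N` ≥ 10, and one doubling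
-- outgrows one step of the square.
quadratic<exponential : ∀ k → 16 * ((11 + k) * (11 + k)) < 2 ^ (11 + k)
quadratic<exponential zero    = ≤ᵇ⇒≤ 1937 2048 tt
quadratic<exponential (suc k) = ≤-<-trans (≤-trans (m≤m+n _ (16 * (98 + 20 * k + k * k))) (≤-reflexive (lem k)))
  (*-monoʳ-< 2 (quadratic<exponential k))
  where
  lem : ∀ k → 16 * ((11 + suc k) * (11 + suc k)) + 16 * (98 + 20 * k + k * k) ≡ 2 * (16 * ((11 + k) * (11 + k)))
  lem = solve-∀

-- The first inequality is the demand of `no-multiples`, with 2 + a for a. The second keeps a 2^a of
-- order lam, which bounds the block length; at a = 0 it is 2 < lam.
choose-a : ∀ lam → 3 ≤ lam → ∃ λ a → lam ≤ (2 + a) * 2 ^ (2 + a) × (1 + a) * 2 ^ (1 + a) < lam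
choose-a lam 3≤lam = search lam (≤-trans (m≤n*m lam (2 ^ (2 + lam)) {{m^n≢0 2 (2 + lam)}})
    (≤-trans (≤-reflexive (*-comm (2 ^ (2 + lam)) lam)) (*-monoˡ-≤ (2 ^ (2 + lam)) (m≤n+m lam 2))))
  where
  search : ∀ b → lam ≤ (2 + b) * 2 ^ (2 + b) → ∃ λ a → lam ≤ (2 + a) * 2 ^ (2 + a) × (1 + a) * 2 ^ (1 + a) < lam
  search zero    le = 0 , le , 3≤lam
  search (suc b) le with lam ≤? (2 + b) * 2 ^ (2 + b)
  ... | yes le′ = search b le′
  ... | no nle  = suc b , le , ≰⇒> nle

-- 15361 = 2 · 7680 + 1: two blocks of at most 7680 l² elements and the parity shift. Here B < 16 ·
-- 2^(1+a), 5 + a ≤ 5 (1 + a), and 4 + 19 (l + 1) is the binary logarithm of the threshold 16 K^19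
-- for the number of sums.
size-bound : ∀ l a B → 1 ≤ l → (1 + a) * 2 ^ (1 + a) < suc l → 2 ^ (5 + a) ≡ suc B →
  let n = B * suc ((4 + 19 * suc l) * (5 + a)) in suc (n + n) ≤ 15361 * (l * (l * 1))
size-bound l a B 1≤l a< 2^m≡ = ≤-trans (s≤s (+-mono-≤ n≤ n≤)) (≤-trans (+-monoˡ-≤ _ 1≤l²) (≤-reflexive (lem₅ l)))
  where
  n = B * suc ((4 + 19 * suc l) * (5 + a))
  lem₁ : ∀ a y l → 16 * y * ((5 + 19 * suc l) * (5 + a)) + 16 * y * ((5 + 19 * suc l) * (4 * a)) ≡ 16 * (5 * ((1 + a) * y)) * (5 + 19 * suc l)
  lem₁ = solve-∀
  lem₂ : ∀ l → 5 + 19 * suc l + 5 * l ≡ 24 * suc l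
  lem₂ = solve-∀
  lem₃ : ∀ l → 16 * (5 * (l + l)) * (24 * (l + l)) ≡ 7680 * (l * (l * 1))
  lem₃ = solve-∀
  lem₄ : ∀ x m → suc (x * m) + m ≡ 1 + (suc x * m)
  lem₄ = solve-∀
  lem₅ : ∀ l → l * (l * 1) + (7680 * (l * (l * 1)) + 7680 * (l * (l * 1))) ≡ 15361 * (l * (l * 1))
  lem₅ = solve-∀
  1≤l² : 1 ≤ l * (l * 1)
  1≤l² = *-mono-≤ 1≤l (*-mono-≤ {1} {l} {1} {1} 1≤l ≤-refl)
  suc-l≤ : suc l ≤ l + l
  suc-l≤ = +-monoˡ-≤ l 1≤l
  B≤ : B ≤ 16 * 2 ^ (1 + a)
  B≤ = ≤-trans (n≤1+n B) (≤-reflexive (trans (sym 2^m≡) (^-distribˡ-+-* 2 4 (1 + a))))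
  exponent≤ : suc ((4 + 19 * suc l) * (5 + a)) ≤ (5 + 19 * suc l) * (5 + a)
  exponent≤ = +-monoˡ-≤ ((4 + 19 * suc l) * (5 + a)) {1} {5 + a} (s≤s z≤n)
  n≤ : n ≤ 7680 * (l * (l * 1))
  n≤ = ≤-trans (*-mono-≤ B≤ exponent≤) (≤-trans (m≤m+n _ _) (≤-trans (≤-reflexive (lem₁ a (2 ^ (1 + a)) l))
    (≤-trans (*-mono-≤ (*-monoʳ-≤ 16 (*-monoʳ-≤ 5 (≤-trans (<⇒≤ a<) suc-l≤))) (≤-trans (m≤m+n _ (5 * l)) (≤-trans (≤-reflexive (lem₂ l)) (*-monoʳ-≤ 24 suc-l≤))))
      (≤-reflexive (lem₃ l)))))

<2^suc-log₂ : ∀ n → n < 2 ^ suc ⌊log₂ n ⌋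
<2^suc-log₂ n = ≰⇒> λ le → <-irrefl refl (subst (_≤ ⌊log₂ n ⌋) (⌊log₂[2^n]⌋≡n (suc ⌊log₂ n ⌋)) (⌊log₂⌋-mono-≤ le))

<2^2^suc-loglog : ∀ N → N < 2 ^ (2 ^ suc (loglog N))
<2^2^suc-loglog N = <-≤-trans (<2^suc-log₂ N) (^-monoʳ-≤ 2 (<2^suc-log₂ ⌊log₂ N ⌋))

loglog-≥ : ∀ k N → 2 ^ (2 ^ k) ≤ N → k ≤ loglog N
loglog-≥ k N le = subst (_≤ loglog N) (⌊log₂[2^n]⌋≡n k) (⌊log₂⌋-mono-≤ (subst (_≤ ⌊log₂ N ⌋) (⌊log₂[2^n]⌋≡n (2 ^ k)) (⌊log₂⌋-mono-≤ le)))

large-family-impossible : ∀ N l → 10 ≤ l → N < 2 ^ (2 ^ suc l) → ∀ {d} (f : Fin d → ℕ) → Admissible N d f → 15361 * (l * (l * 1)) < d → ⊥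
large-family-impossible N l 10≤l N< {suc d} f adm d> = go (choose-a (suc l) (≤-trans (s≤s (s≤s (s≤s z≤n))) (s≤s 10≤l)))
  where
  large : 16 * (suc l * suc l) < 2 ^ suc l
  large = subst (λ x → 16 * (suc x * suc x) < 2 ^ suc x) (m+[n∸m]≡n 10≤l) (quadratic<exponential (l ∸ 10))
  1≤l : 1 ≤ l
  1≤l = ≤-trans (s≤s z≤n) 10≤l
  go : (∃ λ a → suc l ≤ (2 + a) * 2 ^ (2 + a) × (1 + a) * 2 ^ (1 + a) < suc l) → ⊥
  go (a , l≤ , a<) = family-impossible (suc l) (2 + a) n B (s≤s z≤n) large l≤ 2^m≡ 1≤B
      (subst (λ x → x ^ (5 + a) * B ^ n < suc B ^ n) M≡ (block-size B (5 + a) (4 + 19 * suc l) 1≤B)) N N< f (proj₁ (proj₂ adm)) (admissible⇒PowerSums adm)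
      (s≤s⁻¹ (≤-trans (≤-trans (size-bound l a B 1≤l a< 2^m≡) (<⇒≤ d>)) ≤-refl))
    where
    B n : ℕ
    B = pred (2 ^ (5 + a))
    n = B * suc ((4 + 19 * suc l) * (5 + a))
    2^m≡ : 2 ^ (5 + a) ≡ suc B
    2^m≡ = sym (suc-pred (2 ^ (5 + a)) {{m^n≢0 2 (5 + a)}})
    1≤B : 1 ≤ B
    1≤B = s≤s⁻¹ (subst (2 ≤_) 2^m≡ (^-monoʳ-≤ 2 {1} {5 + a} (s≤s z≤n)))
    M≡ : 2 ^ (4 + 19 * suc l) ≡ 16 * (2 ^ suc l) ^ 19
    M≡ = trans (^-distribˡ-+-* 2 4 (19 * suc l)) (cong (16 *_) (trans (cong (2 ^_) (*-comm 19 (suc l))) (sym (^-*-assoc 2 (suc l) 19))))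

theorem1p7 : Σ ℕ λ C → Σ ℕ λ N₀ → ∀ (N : ℕ) → N₀ ≤ N →
    ∀ (d : ℕ) (a : Fin d → ℕ) → Admissible N d a → d ≤ C * (loglog N ^ 2)
theorem1p7 = 15361 , 2 ^ (2 ^ 10) , λ N N₀≤N d a adm → ≮⇒≥ (large-family-impossible N (loglog N) (loglog-≥ 10 N N₀≤N) (<2^2^suc-loglog N) a adm)
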